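{- Let $k\geq 4$ be an integer, let $0<\gamma<1$, and let $\mathcal{H}$ be a $2$-contractible $k$-tree with $s$ vertices, $t$ edges and cross-cut number $\sigma=\sigma(\mathcal{H})$. Then there exists $\beta>0$, depending on $\mathcal{H}$ and $\gamma$, such that for all sufficiently large $n$ the following holds: if $\mathcal{F}$ is a $k$-graph on $[n]$ with $|\mathcal{F}|=a\binom{n}{k-1}$ where $a\geq\sigma-1+\gamma$, then $\mathcal{F}$ contains at least $\beta a^t n^{s-t}$ copies of $\mathcal{H}$.
   Context: Hypertrees: a single edge is a hypertree; a hypergraph with at least two edges is a hypertree if it has an edge $E$ such that removing $E$ leaves a hypertree $\mathcal{H}'$ and some edge $F$ of $\mathcal{H}'$ satisfies $E\cap V(\mathcal{H}')=E\cap F$. A $k$-tree is a $k$-uniform hypertree; it is $2$-contractible if every edge contains at least two vertices of degree $1$. A cross-cut of $\mathcal{H}$ is a vertex set meeting every edge in exactly one vertex; $\sigma(\mathcal{H})$ is the minimum size of a cross-cut. -}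

module Defs where

open import Data.Nat using (ℕ; zero; suc; _≥_)
open import Data.Fin using (Fin)
open import Data.Fin.Subset using (Subset; _∈_; _∩_; ⋃; ∣_∣)
open import Data.List using (List; []; _∷_; length)
open import Data.List.Membership.Propositional renaming (_∈_ to _∈ˡ_)
open import Data.List.Relation.Unary.All using (All)
open import Data.List.Relation.Unary.Unique.Propositional using (Unique)
open import Data.List.Relation.Unary.AllPairs using (AllPairs)
open import Data.List.Relation.Binary.Permutation.Propositional using (_↭_)
open import Data.Product using (Σ; ∃; ∃-syntax; _×_)
open import Data.Rational using (ℚ; 1ℚ; _*_)
open import Function using (_⇔_)
open import Function.Definitions using (Injective)
open import Relation.Binary.PropositionalEquality using (_≡_)
open import Relation.Nullary using (¬_)

_^ℚ_ : ℚ → ℕ → ℚ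
x ^ℚ zero  = 1ℚ
x ^ℚ suc m = x * (x ^ℚ m)

-- A hypergraph on vertex set Fin s is a list of edges (subsets of Fin s).
-- V(L) = union of the edges of L.
V : ∀ {s} → List (Subset s) → Subset s
V = ⋃

data IsHypertree {s : ℕ} : List (Subset s) → Set where
  single : (E : Subset s) → IsHypertree (E ∷ [])
  step   : (L L' : List (Subset s)) (E : Subset s) →
           L ↭ (E ∷ L') → IsHypertree L' →
           (∃[ F ] (F ∈ˡ L' × (E ∩ V L') ≡ (E ∩ F))) →
           IsHypertree L

record KGraphOn (k s : ℕ) (edges : List (Subset s)) : Set where
  field
    distinct  : Unique edges
    uniform   : All (λ E → ∣ E ∣ ≡ k) edges
    covering  : ∀ (v : Fin s) → ∃[ E ] (E ∈ˡ edges × v ∈ E)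

record IsKTree (k s : ℕ) (edges : List (Subset s)) : Set where
  field
    kgraph    : KGraphOn k s edges
    hypertree : IsHypertree edges

Degree1 : ∀ {s} → List (Subset s) → Fin s → Set
Degree1 edges v = ∃[ E ] ((E ∈ˡ edges × v ∈ E) ×
                   (∀ E' → E' ∈ˡ edges → v ∈ E' → E' ≡ E))

TwoContractible : ∀ {s} → List (Subset s) → Set
TwoContractible edges =
  All (λ E → ∃[ u ] ∃[ w ] (¬ (u ≡ w) × u ∈ E × w ∈ E ×
                            Degree1 edges u × Degree1 edges w)) edges

IsCrossCut : ∀ {s} → List (Subset s) → Subset s → Set
IsCrossCut edges S = All (λ E → ∣ S ∩ E ∣ ≡ 1) edges

IsCrossCutNumber : ∀ {s} → List (Subset s) → ℕ → Set
IsCrossCutNumber edges σ =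
  (∃[ S ] (IsCrossCut edges S × ∣ S ∣ ≡ σ)) ×
  (∀ S → IsCrossCut edges S → ∣ S ∣ ≥ σ)

IsKGraph : (k n : ℕ) → List (Subset n) → Set
IsKGraph k n F = Unique F × All (λ e → ∣ e ∣ ≡ k) F

IsImage : ∀ {s n} → (Fin s → Fin n) → Subset s → Subset n → Set
IsImage φ E e = ∀ j → (j ∈ e) ⇔ (∃[ v ] (v ∈ E × φ v ≡ j))

IsCopy : ∀ {s n} → List (Subset s) → List (Subset n) → List (Subset n) → Set
IsCopy {s} {n} H F G =
  All (λ e → e ∈ˡ F) G ×
  ∃[ φ ] (Injective _≡_ _≡_ φ ×
          (∀ e → (e ∈ˡ G) ⇔ (∃[ E ] (E ∈ˡ H × IsImage φ E e))))

SameEdgeSet : ∀ {n} → List (Subset n) → List (Subset n) → Set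
SameEdgeSet G G' = ∀ e → (e ∈ˡ G) ⇔ (e ∈ˡ G')

-- F contains at least m copies of H (m a natural number bound here as
-- a list of pairwise distinct copies).
CopiesList : ∀ {s n} → List (Subset s) → List (Subset n) → List (List (Subset n)) → Set
CopiesList H F Cs = All (IsCopy H F) Cs × AllPairs (λ G G' → ¬ SameEdgeSet G G') Cs

{-# OPTIONS --safe #-}

-- Peel off edges having a low-degree subset or a (k−1)-subset of degree at most s. If something is left, every edge
-- meeting a small set U can be moved off U one vertex at a time, so H embeds greedily and in enough ways.
--
-- Otherwise almost every edge e was removed together with a light (k−1)-subset, its base, and a base belongs to
-- boundedly many edges. As |F| ≥ (σ − 1 + γ) C(n, k−1), a positive proportion of all (k−1)-sets B are the base of σ
-- edges B ∪ {x₁}, …, B ∪ {x_σ}; a random colouring of the vertices makes the centres x_i and the bases disjoint.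
-- Peel this family of items (B, x₁, …, x_σ) again, now with respect to the (k−1)-subsets containing the centre.
-- If something is left, send the i-th vertex of a cross-cut of size σ to an i-th centre: at a common centre the other
-- vertices are moved off U as before, and away from the centres one may pass to any other centre of the same base.
--
-- If nothing is left, a positive proportion of edges have two light (k−1)-subsets e − u and e − w. Such edges are
-- determined up to boundedly many choices by k − 1 of their vertices, so those meeting U are negligible, and H embeds
-- greedily with the two degree-one vertices of each edge placed at u and w.

module Submission where

-- The number a may grow with n, so counting against `n C (k ∸ 1)` would be too weak. Every degree
-- condition is instead measured against X, the size of the family being pruned, in the form X ≤ K
-- n^|P| deg(P): each embedded edge then costs a factor X / (K n^k) relative to a free choice of its
-- vertices, which is the claimed order. Only when the first peeling leaves nothing is a bounded,
-- and then passing to a family of bases loses just a constant factor.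
--
-- Each edge is ordered once, and degrees are counted by position. Together with a colouring of H
-- whose colours are the positions, this replaces passing to a k-partite subgraph.
--
-- In a family of centred items a base determines its centres, so a vertex placed at a centre cannot
-- be moved off U with the base kept. This is why the cross-cut must take that position and why
-- classes have to keep the centres apart. The same rigidity is later an asset: it is one of the two
-- sparse directions needed when the second peeling leaves nothing.

module Combinatorics where

  open import Data.Bool using (Bool; true; false)
  import Data.Bool.Properties as Boolₚ
  import Data.Empty as Empty
  import Data.Unit as Unit
  import Data.Product.Properties as Productₚ
  import Data.Sum.Properties as Sumₚ
  open import Defs
  open import Data.Nat
  open import Data.Nat.Properties
  open import Data.Nat.DivMod using (m≡m%n+[m/n]*n; m%n<n; m/n*n≤m)
  open import Data.Nat.ListAction using (sum)
  open import Data.Nat.Combinatorics using (_C_; nCk+nC[k+1]≡[n+1]C[k+1]; nC1≡n)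
  open import Data.Nat.Tactic.RingSolver using (solve-∀)
  open import Algebra.Properties.CommutativeSemigroup +-commutativeSemigroup using () renaming (x∙yz≈y∙xz to +-exchange)
  open import Data.Fin using (Fin; zero; suc)
  import Data.Fin.Properties as Finₚ
  open import Data.Fin.Subset using (Subset; inside; outside; ∣_∣; _∪_; _∩_; ⁅_⁆; ⊥; ⊤; ∁) renaming (_∈_ to _∈ˢ_; _∉_ to _∉ˢ_)
  open import Data.Fin.Subset.Properties
  open import Data.Vec using (Vec; []; _∷_; lookup; removeAt; tabulate; here; there)
  import Data.Vec as Vec
  import Data.Vec.Properties as Vecₚ
  open import Data.Vec.Properties using (removeAt-punchOut; insertAt-removeAt; tabulate∘lookup; lookup∘tabulate; tabulate-cong; ∷-injective; lookup-map)
  import Data.List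
  open import Data.List using (List; []; _∷_; length; filter; map; _++_; cartesianProductWith; cartesianProduct; allFin)
  open import Data.List.Properties using (length-map; length-++; length-filter; length-tabulate)
  open import Data.List.Membership.Propositional using (_∈_; _∉_; find; lose)
  open import Data.List.Membership.Propositional.Properties using (∈-filter⁺; ∈-filter⁻; ∈-map⁺; ∈-map⁻; ∈-∃++; ∈-++⁺ˡ; ∈-++⁺ʳ; ∈-++⁻; ∈-cartesianProductWith⁺; ∈-cartesianProduct⁺; ∈-cartesianProduct⁻; ∈-allFin; ∈-lookup)
  open import Data.List.Relation.Unary.Any as Any using (here; there; any?)
  open import Data.List.Relation.Unary.Any.Properties using (lookup-index)
  open import Data.List.Relation.Unary.All as All using (All; []; _∷_)
  open import Data.List.Relation.Unary.AllPairs as AllPairs using (AllPairs; []; _∷_)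
  import Data.List.Relation.Unary.All.Properties as Allₚ
  open import Data.List.Relation.Unary.Unique.Propositional using (Unique)
  import Data.List.Relation.Unary.Unique.Propositional.Properties as Uniqueₚ
  open import Data.List.Relation.Binary.Permutation.Propositional using (_↭_; ↭-sym; ↭-trans; ↭-refl; prep; ↭⇒↭ₛ)
  open import Data.List.Relation.Binary.Permutation.Propositional.Properties using (∈-resp-↭; ↭-length; filter-↭; shift)
  import Data.List.Relation.Binary.Permutation.Setoid.Properties as Permₚ
  open import Data.Maybe as Maybe using (Maybe; just; nothing)
  open import Data.Maybe.Properties using (just-injective)
  open import Data.Product using (Σ; ∃; ∃-syntax; _×_; _,_; proj₁; proj₂)
  open import Data.Sum as Sum using (_⊎_; inj₁; inj₂)
  open import Data.Empty using (⊥-elim)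
  open import Function using (_∘_; id; mk⇔)
  open import Function.Bundles using (Equivalence)
  open import Relation.Binary using (DecidableEquality)
  open import Relation.Binary.PropositionalEquality using (_≡_; _≢_; refl; sym; trans; cong; cong₂; subst; subst₂; setoid; module ≡-Reasoning)
  open import Relation.Nullary using (¬_; Dec; yes; no; ¬?)
  open import Relation.Nullary.Decidable using (_→-dec_; _×-dec_; decidable-stable)
  open import Relation.Unary using (Decidable)

  -- Counting in lists

  private
    variable
      A B : Set

  length≤-of-⊆ : {xs ys : List A} → Unique xs → (∀ {x} → x ∈ xs → x ∈ ys) → length xs ≤ length ys
  length≤-of-⊆ {xs = []} _ _ = z≤n
  length≤-of-⊆ {xs = x ∷ xs} (x∉ ∷ u) sub with ∈-∃++ (sub (here refl))
  ... | ys , zs , refl = begin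
    suc (length xs)             ≤⟨ s≤s (length≤-of-⊆ u sub′) ⟩
    suc (length (ys ++ zs))     ≡⟨ cong suc (length-++ ys) ⟩
    suc (length ys + length zs) ≡⟨ +-suc (length ys) (length zs) ⟨
    length ys + suc (length zs) ≡⟨ length-++ ys ⟨
    length (ys ++ x ∷ zs)       ∎
    where
    open ≤-Reasoning
    sub′ : ∀ {y} → y ∈ xs → y ∈ ys ++ zs
    sub′ y∈ with ∈-++⁻ ys (sub (there y∈))
    ... | inj₁ p           = ∈-++⁺ˡ p
    ... | inj₂ (here refl) = ⊥-elim (All.lookup x∉ y∈ refl)
    ... | inj₂ (there p)   = ∈-++⁺ʳ ys p

  length-filter-split : {P : A → Set} (P? : Decidable P) (xs : List A) →
    length xs ≡ length (filter P? xs) + length (filter (¬? ∘ P?) xs)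
  length-filter-split P? [] = refl
  length-filter-split P? (x ∷ xs) with P? x
  ... | yes _ = cong suc (length-filter-split P? xs)
  ... | no  _ = trans (cong suc (length-filter-split P? xs)) (sym (+-suc _ _))

  filter-swap-≤ : {P Q : A → Set} (P? : Decidable P) (Q? : Decidable Q) (xs : List A) →
    length (filter P? (filter Q? xs)) ≤ length (filter P? xs)
  filter-swap-≤ P? Q? [] = z≤n
  filter-swap-≤ P? Q? (x ∷ xs) with Q? x
  ... | no _ with P? x
  ...   | yes _ = m≤n⇒m≤1+n (filter-swap-≤ P? Q? xs)
  ...   | no  _ = filter-swap-≤ P? Q? xs
  filter-swap-≤ P? Q? (x ∷ xs) | yes _ with P? x
  ...   | yes _ = s≤s (filter-swap-≤ P? Q? xs)
  ...   | no  _ = filter-swap-≤ P? Q? xs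

  sum-map-≤ : (g : A → ℕ) (m : ℕ) (xs : List A) → (∀ {x} → x ∈ xs → g x ≤ m) → sum (map g xs) ≤ m * length xs
  sum-map-≤ g m [] _ = z≤n
  sum-map-≤ g m (x ∷ xs) h =
    ≤-trans (+-mono-≤ (h (here refl)) (sum-map-≤ g m xs (h ∘ there))) (≤-reflexive (sym (*-suc m (length xs))))

  module Fibres {B : Set} (_≟_ : DecidableEquality B) where

    fibre : (A → B) → B → List A → List A
    fibre f y = filter (λ x → f x ≟ y)

    ∈-fibre⁻ : (f : A → B) {y : B} (xs : List A) {x : A} → x ∈ fibre f y xs → x ∈ xs × f x ≡ y
    ∈-fibre⁻ f {y} xs = ∈-filter⁻ (λ x → f x ≟ y)

    length≤sum-fibres : (f : A → B) (xs : List A) (ys : List B) → (∀ {x} → x ∈ xs → f x ∈ ys) →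
      length xs ≤ sum (map (λ y → length (fibre f y xs)) ys)
    length≤sum-fibres f [] ys _ = z≤n
    length≤sum-fibres f (x ∷ xs) [] h with () ← h (here refl)
    length≤sum-fibres {A = A} f xs@(_ ∷ _) (y ∷ ys) h = begin
      length xs
        ≡⟨ length-filter-split (λ x → f x ≟ y) xs ⟩
      length (fibre f y xs) + length rest
        ≤⟨ +-monoʳ-≤ _ (length≤sum-fibres f rest ys h′) ⟩
      length (fibre f y xs) + sum (map (λ z → length (fibre f z rest)) ys)
        ≤⟨ +-monoʳ-≤ _ (shrink ys) ⟩
      length (fibre f y xs) + sum (map (λ z → length (fibre f z xs)) ys) ∎
      where
      open ≤-Reasoning
      rest : List A
      rest = filter (¬? ∘ (λ x → f x ≟ y)) xs
      h′ : ∀ {x} → x ∈ rest → f x ∈ ys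
      h′ x∈ with ∈-filter⁻ (¬? ∘ (λ x → f x ≟ y)) {xs = xs} x∈
      ... | x∈xs , ne with h x∈xs
      ...   | here eq = ⊥-elim (ne eq)
      ...   | there p = p
      shrink : ∀ zs → sum (map (λ z → length (fibre f z rest)) zs) ≤ sum (map (λ z → length (fibre f z xs)) zs)
      shrink [] = z≤n
      shrink (z ∷ zs) = +-mono-≤ (filter-swap-≤ (λ x → f x ≟ z) (¬? ∘ (λ x → f x ≟ y)) xs) (shrink zs)

    length≤-by-fibres : (f : A → B) (xs : List A) (ys : List B) (m : ℕ) → (∀ {x} → x ∈ xs → f x ∈ ys) →
      (∀ {y} → y ∈ ys → length (fibre f y xs) ≤ m) → length xs ≤ m * length ys
    length≤-by-fibres f xs ys m h b = ≤-trans (length≤sum-fibres f xs ys h) (sum-map-≤ _ m ys b)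

    representatives : (f : A → B) (xs : List A) →
      ∃[ ys ] ((∀ {y} → y ∈ ys → y ∈ xs) × AllPairs (λ y z → ¬ f y ≡ f z) ys × (∀ {x} → x ∈ xs → f x ∈ map f ys))
    representatives f [] = [] , (λ ()) , [] , (λ ())
    representatives f (x ∷ xs) with representatives f xs
    ... | ys , sub , ap , cov with any? (f x ≟_) (map f ys)
    ...   | yes p = ys , there ∘ sub , ap , λ { (here refl) → p ; (there q) → cov q }
    ...   | no ¬p = x ∷ ys , (λ { (here refl) → here refl ; (there q) → there (sub q) })
                  , All.tabulate (λ {y} y∈ eq → ¬p (subst (_∈ map f ys) (sym eq) (∈-map⁺ f y∈))) ∷ ap
                  , (λ { (here refl) → here refl ; (there q) → there (cov q) })

  -- Serves to count light edges by their bases: most bases weigh at most m, and the exceptional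
  -- ones are charged the cruder M.
  sum-map-≤-split : {P : A → Set} (P? : Decidable P) (g : A → ℕ) (m M : ℕ) (xs : List A) →
    (∀ {x} → x ∈ xs → g x ≤ M) → (∀ {x} → x ∈ xs → ¬ P x → g x ≤ m) →
    sum (map g xs) ≤ m * length xs + M * length (filter P? xs)
  sum-map-≤-split P? g m M [] _ _ = z≤n
  sum-map-≤-split P? g m M (x ∷ xs) h h′ with ih ← sum-map-≤-split P? g m M xs (h ∘ there) (h′ ∘ there) | P? x
  ... | yes _ = begin
    g x + sum (map g xs)                   ≤⟨ +-mono-≤ (h (here refl)) ih ⟩
    M + (m * l + M * l′)                   ≡⟨ +-exchange M (m * l) (M * l′) ⟩
    m * l + (M + M * l′)                   ≡⟨ cong (m * l +_) (*-suc M l′) ⟨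
    m * l + M * suc l′                     ≤⟨ +-monoˡ-≤ _ (*-monoʳ-≤ m (n≤1+n l)) ⟩
    m * suc l + M * suc l′                 ∎
    where
    open ≤-Reasoning
    l = length xs
    l′ = length (filter P? xs)
  ... | no ¬p = begin
    g x + sum (map g xs)                   ≤⟨ +-mono-≤ (h′ (here refl) ¬p) ih ⟩
    m + (m * l + M * l′)                   ≡⟨ +-assoc m (m * l) (M * l′) ⟨
    (m + m * l) + M * l′                   ≡⟨ cong (_+ M * l′) (*-suc m l) ⟨
    m * suc l + M * l′                     ∎
    where
    open ≤-Reasoning
    l = length xs
    l′ = length (filter P? xs)

  exists-≥-average : (g : A → ℕ) (m : ℕ) (xs : List A) → 0 < length xs → m * length xs ≤ sum (map g xs) →
    ∃[ x ] (x ∈ xs × m ≤ g x)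
  exists-≥-average g m (x ∷ xs) _ h with m ≤? g x
  ... | yes p = x , here refl , p
  exists-≥-average g m (x ∷ []) _ h | no ¬p =
    ⊥-elim (¬p (subst₂ _≤_ (*-identityʳ m) (+-identityʳ (g x)) h))
  exists-≥-average g m (x ∷ xs@(_ ∷ _)) _ h | no ¬p
    with y , y∈ , q ← exists-≥-average g m xs (s≤s z≤n)
           (+-cancelˡ-≤ m _ _ (≤-trans (≤-reflexive (sym (*-suc m (length xs))))
                              (≤-trans h (+-monoˡ-≤ _ (<⇒≤ (≰⇒> ¬p)))))) = y , there y∈ , q

  module _ {R : A → B → Set} (R? : ∀ x y → Dec (R x y)) where

    sum-by-rows : List A → List B → ℕ
    sum-by-rows xs ys = sum (map (λ x → length (filter (R? x) ys)) xs)

    sum-by-cols : List A → List B → ℕ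
    sum-by-cols xs ys = sum (map (λ y → length (filter (λ x → R? x y) xs)) ys)

    double-counting : ∀ xs ys → sum-by-rows xs ys ≡ sum-by-cols xs ys
    double-counting [] ys = sym (zeros ys)
      where
      zeros : ∀ ys → sum-by-cols [] ys ≡ 0
      zeros [] = refl
      zeros (_ ∷ ys) = zeros ys
    double-counting (x ∷ xs) ys = trans (cong (_ +_) (double-counting xs ys)) (peel-row ys)
      where
      peel-row : ∀ ys → length (filter (R? x) ys) + sum-by-cols xs ys ≡ sum-by-cols (x ∷ xs) ys
      peel-row [] = refl
      peel-row (y ∷ ys) with R? x y
      ... | yes _ = cong suc (trans (+-exchange (length (filter (R? x) ys)) (length (filter (λ x → R? x y) xs)) (sum-by-cols xs ys)) (cong (_ +_) (peel-row ys)))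
      ... | no _ = trans (+-exchange (length (filter (R? x) ys)) (length (filter (λ x → R? x y) xs)) (sum-by-cols xs ys)) (cong (_ +_) (peel-row ys))

  Unique-map-on : (f : A → B) {xs : List A} → (∀ {x y} → x ∈ xs → y ∈ xs → f x ≡ f y → x ≡ y) →
    Unique xs → Unique (map f xs)
  Unique-map-on f inj [] = []
  Unique-map-on f inj (x∉ ∷ u) =
    Allₚ.map⁺ (All.tabulate (λ y∈ eq → All.lookup x∉ y∈ (inj (here refl) (there y∈) eq)))
    ∷ Unique-map-on f (λ p q → inj (there p) (there q)) u

  length-filter-map : {P : B → Set} (P? : Decidable P) (f : A → B) (xs : List A) →
    length (filter P? (map f xs)) ≡ length (filter (P? ∘ f) xs)
  length-filter-map P? f [] = refl
  length-filter-map P? f (x ∷ xs) with P? (f x)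
  ... | yes _ = cong suc (length-filter-map P? f xs)
  ... | no  _ = length-filter-map P? f xs

  -- Since `back` recovers the parent of an extension, the extensions of different parents are
  -- disjoint and their numbers add up. A step of the greedy embedding is an instance, `back` being
  -- the restriction to the vertices placed earlier.
  Unique-bind : {Good : A → Set} {Good′ : B → Set} (back : B → A) (X K : ℕ) →
    (∀ a → Good a → ∃[ ys ] (Unique ys × All (λ y → Good′ y × back y ≡ a) ys × X ≤ K * length ys)) →
    (xs : List A) → Unique xs → All Good xs →
    ∃[ zs ] (Unique zs × All (λ z → Good′ z × back z ∈ xs) zs × X * length xs ≤ K * length zs)
  Unique-bind back X K ext [] _ _ = [] , [] , [] , subst₂ _≤_ (sym (*-zeroʳ X)) (sym (*-zeroʳ K)) z≤n
  Unique-bind back X K ext (x ∷ xs) (x∉ ∷ u) (g ∷ gs)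
    with ys , uy , ay , by ← ext x g | zs , uz , az , bz ← Unique-bind back X K ext xs u gs
    = ys ++ zs
    , Uniqueₚ.++⁺ uy uz (λ { (p , q) → All.lookup x∉ (subst (_∈ xs) (proj₂ (All.lookup ay p)) (proj₂ (All.lookup az q))) refl })
    , Allₚ.++⁺ (All.map (λ { (g , eq) → g , here eq }) ay) (All.map (λ { (g , p) → g , there p }) az)
    , (begin
        X * suc (length xs)          ≡⟨ *-suc X (length xs) ⟩
        X + X * length xs            ≤⟨ +-mono-≤ by bz ⟩
        K * length ys + K * length zs ≡⟨ *-distribˡ-+ K (length ys) (length zs) ⟨
        K * (length ys + length zs)  ≡⟨ cong (K *_) (length-++ ys) ⟨
        K * length (ys ++ zs)        ∎)
    where open ≤-Reasoning

  length≤-of-injection : (f : A → B) {xs : List A} {ys : List B} → Unique xs →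
    (∀ {x y} → x ∈ xs → y ∈ xs → f x ≡ f y → x ≡ y) → (∀ {x} → x ∈ xs → f x ∈ ys) → length xs ≤ length ys
  length≤-of-injection f {xs} {ys} u inj h = subst (_≤ length ys) (length-map f xs)
    (length≤-of-⊆ (Unique-map-on f inj u) (λ y∈ → let x , x∈ , eq = ∈-map⁻ f y∈ in subst (_∈ ys) (sym eq) (h x∈)))

  sum-map-≥ : (g : A → ℕ) (m : ℕ) (xs : List A) → (∀ {x} → x ∈ xs → m ≤ g x) → m * length xs ≤ sum (map g xs)
  sum-map-≥ g m [] _ = ≤-reflexive (*-zeroʳ m)
  sum-map-≥ g m (x ∷ xs) h =
    ≤-trans (≤-reflexive (*-suc m (length xs))) (+-mono-≤ (h (here refl)) (sum-map-≥ g m xs (h ∘ there)))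

  sum-map-* : (a : ℕ) (g : A → ℕ) (xs : List A) → sum (map (λ x → a * g x) xs) ≡ a * sum (map g xs)
  sum-map-* a g [] = sym (*-zeroʳ a)
  sum-map-* a g (x ∷ xs) = trans (cong (a * g x +_) (sum-map-* a g xs)) (sym (*-distribˡ-+ a (g x) (sum (map g xs))))

  ifDec : {P : Set} → Dec P → A → A → A
  ifDec (yes _) x y = x
  ifDec (no _)  x y = y

  ifDec-yes : {P : Set} (d : Dec P) {x y : A} → P → ifDec d x y ≡ x
  ifDec-yes (yes _) _ = refl
  ifDec-yes (no ¬p) p = ⊥-elim (¬p p)

  ifDec-no : {P : Set} (d : Dec P) {x y : A} → ¬ P → ifDec d x y ≡ y
  ifDec-no (yes p) ¬p = ⊥-elim (¬p p)
  ifDec-no (no _)  _  = refl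

  Unique-map⇒injective-on : (f : A → B) {xs : List A} → Unique (map f xs) → ∀ {x y} → x ∈ xs → y ∈ xs → f x ≡ f y → x ≡ y
  Unique-map⇒injective-on f (_ ∷ _) (here refl) (here refl) _ = refl
  Unique-map⇒injective-on f (x∉ ∷ _) (here refl) (there y∈) eq = ⊥-elim (All.lookup x∉ (∈-map⁺ f y∈) eq)
  Unique-map⇒injective-on f (x∉ ∷ _) (there x∈) (here refl) eq = ⊥-elim (All.lookup x∉ (∈-map⁺ f x∈) (sym eq))
  Unique-map⇒injective-on f (_ ∷ u) (there x∈) (there y∈) eq = Unique-map⇒injective-on f u x∈ y∈ eq

  choose-preimages : (f : A → B) {Q : A → Set} (ys : List B) → (∀ {y} → y ∈ ys → ∃[ x ] (f x ≡ y × Q x)) →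
    ∃[ xs ] (map f xs ≡ ys × All Q xs)
  choose-preimages f [] _ = [] , refl , []
  choose-preimages f (y ∷ ys) h
    with x , refl , q ← h (here refl)
    with xs , eq , qs ← choose-preimages f ys (h ∘ there) = x ∷ xs , cong (f x ∷_) eq , q ∷ qs

  sum-≤-max : (g : A → ℕ) (xs : List A) → 0 < length xs → ∃[ x ] (x ∈ xs × sum (map g xs) ≤ length xs * g x)
  sum-≤-max g (x ∷ []) _ = x , here refl , ≤-refl
  sum-≤-max g (x ∷ xs@(_ ∷ _)) _ with y , y∈ , le ← sum-≤-max g xs (s≤s z≤n) | ≤-total (g x) (g y)
  ... | inj₁ x≤y = y , there y∈ , +-mono-≤ x≤y le
  ... | inj₂ y≤x = x , here refl , +-monoʳ-≤ (g x) (≤-trans le (*-monoʳ-≤ (length xs) y≤x))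

  -- Subsets and tuples: enumeration, projection and images.

  module SubsetsAndTuples where

    private
      variable
        k n s : ℕ

    vec-ext : {u v : Vec A k} → (∀ c → lookup u c ≡ lookup v c) → u ≡ v
    vec-ext {u = u} {v} h = trans (sym (tabulate∘lookup u)) (trans (tabulate-cong h) (tabulate∘lookup v))

    length-cartesianProductWith : {C : Set} (f : A → B → C) (xs : List A) (ys : List B) →
      length (cartesianProductWith f xs ys) ≡ length xs * length ys
    length-cartesianProductWith f [] ys = refl
    length-cartesianProductWith f (x ∷ xs) ys =
      trans (length-++ (map (f x) ys)) (cong₂ _+_ (length-map (f x) ys) (length-cartesianProductWith f xs ys))

    vecsOver : List A → (j : ℕ) → List (Vec A j)
    vecsOver xs zero    = [] ∷ []
    vecsOver xs (suc j) = cartesianProductWith _∷_ xs (vecsOver xs j)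

    length-vecsOver : (xs : List A) (j : ℕ) → length (vecsOver xs j) ≡ length xs ^ j
    length-vecsOver xs zero    = refl
    length-vecsOver xs (suc j) = trans (length-cartesianProductWith _∷_ xs (vecsOver xs j))
                                       (cong (length xs *_) (length-vecsOver xs j))

    ∈-vecsOver : {xs : List A} {j : ℕ} (v : Vec A j) → (∀ c → lookup v c ∈ xs) → v ∈ vecsOver xs j
    ∈-vecsOver []      _ = here refl
    ∈-vecsOver (x ∷ v) h = ∈-cartesianProductWith⁺ _∷_ (h zero) (∈-vecsOver v (h ∘ suc))

    allVecs : (n j : ℕ) → List (Vec (Fin n) j)
    allVecs n = vecsOver (allFin n)

    length-allVecs : ∀ n j → length (allVecs n j) ≡ n ^ j
    length-allVecs n j = trans (length-vecsOver (allFin n) j) (cong (_^ j) (length-tabulate id))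

    ∈-allVecs : {j : ℕ} (v : Vec (Fin n) j) → v ∈ allVecs n j
    ∈-allVecs v = ∈-vecsOver v (λ c → ∈-allFin (lookup v c))

    allSubsets : (k : ℕ) → List (Subset k)
    allSubsets = vecsOver (inside ∷ outside ∷ [])

    ∈-allSubsets : (P : Subset k) → P ∈ allSubsets k
    ∈-allSubsets P = ∈-vecsOver P (λ c → side (lookup P c))
      where
      side : ∀ b → b ∈ inside ∷ outside ∷ []
      side inside  = here refl
      side outside = there (here refl)

    -- The recursion is Pascal's rule, so that the length is a binomial coefficient by the same
    -- induction.
    subsetsOfSize : (n j : ℕ) → List (Subset n)
    subsetsOfSize zero    zero    = [] ∷ []
    subsetsOfSize zero    (suc j) = []
    subsetsOfSize (suc n) zero    = ⊥ ∷ []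
    subsetsOfSize (suc n) (suc j) = map (inside ∷_) (subsetsOfSize n j) ++ map (outside ∷_) (subsetsOfSize n (suc j))


    length-subsetsOfSize : ∀ n j → length (subsetsOfSize n j) ≡ n C j
    length-subsetsOfSize zero    zero    = refl
    length-subsetsOfSize zero    (suc j) = refl
    length-subsetsOfSize (suc n) zero    = refl
    length-subsetsOfSize (suc n) (suc j) = begin
      length (map (inside ∷_) (subsetsOfSize n j) ++ map (outside ∷_) (subsetsOfSize n (suc j)))
        ≡⟨ length-++ (map (inside ∷_) (subsetsOfSize n j)) ⟩
      length (map (inside ∷_) (subsetsOfSize n j)) + length (map (outside ∷_) (subsetsOfSize n (suc j)))
        ≡⟨ cong₂ _+_ (length-map _ (subsetsOfSize n j)) (length-map _ (subsetsOfSize n (suc j))) ⟩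
      length (subsetsOfSize n j) + length (subsetsOfSize n (suc j))
        ≡⟨ cong₂ _+_ (length-subsetsOfSize n j) (length-subsetsOfSize n (suc j)) ⟩
      n C j + n C suc j
        ≡⟨ nCk+nC[k+1]≡[n+1]C[k+1] n j ⟩
      suc n C suc j ∎
      where open ≡-Reasoning

    ∣p∣≡0⇒p≡⊥ : (p : Subset n) → ∣ p ∣ ≡ 0 → p ≡ ⊥
    ∣p∣≡0⇒p≡⊥ [] _ = refl
    ∣p∣≡0⇒p≡⊥ (outside ∷ p) eq = cong (outside ∷_) (∣p∣≡0⇒p≡⊥ p eq)

    ∈-subsetsOfSize : {j : ℕ} (p : Subset n) → ∣ p ∣ ≡ j → p ∈ subsetsOfSize n j
    ∈-subsetsOfSize {j = zero}  []            _    = here refl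
    ∈-subsetsOfSize {j = zero}  p@(_ ∷ _)     eq   = here (∣p∣≡0⇒p≡⊥ p eq)
    ∈-subsetsOfSize {j = suc j} (inside ∷ p)  eq   = ∈-++⁺ˡ (∈-map⁺ _ (∈-subsetsOfSize p (suc-injective eq)))
    ∈-subsetsOfSize {suc n} {j = suc j} (outside ∷ p) eq =
      ∈-++⁺ʳ (map (inside ∷_) (subsetsOfSize n j)) (∈-map⁺ _ (∈-subsetsOfSize p eq))

    -- The result has length |P|, so there are n^|P| possible values: the factor that accompanies
    -- every degree with respect to P.
    proj : (P : Subset k) → Vec A k → Vec A ∣ P ∣
    proj []            []      = []
    proj (inside ∷ P)  (x ∷ v) = x ∷ proj P v
    proj (outside ∷ P) (x ∷ v) = proj P v

    proj-≡⇒ : (P : Subset k) (u v : Vec A k) → proj P u ≡ proj P v → ∀ {c} → c ∈ˢ P → lookup u c ≡ lookup v c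
    proj-≡⇒ (inside ∷ P)  (_ ∷ _) (_ ∷ _) eq here       = proj₁ (∷-injective eq)
    proj-≡⇒ (inside ∷ P)  (_ ∷ u) (_ ∷ v) eq (there c∈) = proj-≡⇒ P u v (proj₂ (∷-injective eq)) c∈
    proj-≡⇒ (outside ∷ P) (_ ∷ u) (_ ∷ v) eq (there c∈) = proj-≡⇒ P u v eq c∈

    ⇒proj-≡ : (P : Subset k) (u v : Vec A k) → (∀ {c} → c ∈ˢ P → lookup u c ≡ lookup v c) → proj P u ≡ proj P v
    ⇒proj-≡ []            []      []      _ = refl
    ⇒proj-≡ (inside ∷ P)  (_ ∷ u) (_ ∷ v) h = cong₂ _∷_ (h here) (⇒proj-≡ P u v (h ∘ there))
    ⇒proj-≡ (outside ∷ P) (_ ∷ u) (_ ∷ v) h = ⇒proj-≡ P u v (h ∘ there)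

    removeAt-≡⇒ : (u v : Vec A (suc k)) {c d : Fin (suc k)} → removeAt u c ≡ removeAt v c → ¬ c ≡ d → lookup u d ≡ lookup v d
    removeAt-≡⇒ u v eq ne =
      trans (sym (removeAt-punchOut u ne)) (trans (cong (λ w → lookup w _) eq) (removeAt-punchOut v ne))

    removeAt-lookup-≡⇒ : (u v : Vec A (suc k)) (c : Fin (suc k)) → removeAt u c ≡ removeAt v c → lookup u c ≡ lookup v c → u ≡ v
    removeAt-lookup-≡⇒ u v c eq eq′ =
      trans (sym (insertAt-removeAt u c)) (trans (cong₂ (λ w x → Vec.insertAt w c x) eq eq′) (insertAt-removeAt v c))

    ⇒removeAt-≡ : (u v : Vec A (suc k)) (c : Fin (suc k)) → (∀ {d} → ¬ c ≡ d → lookup u d ≡ lookup v d) → removeAt u c ≡ removeAt v c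
    ⇒removeAt-≡ (_ ∷ u) (_ ∷ v) zero h = vec-ext (λ d → h {suc d} (λ ()))
    ⇒removeAt-≡ (x ∷ u@(_ ∷ _)) (y ∷ v@(_ ∷ _)) (suc c) h =
      cong₂ _∷_ (h {zero} (λ ())) (⇒removeAt-≡ u v c (λ ne → h (ne ∘ Finₚ.suc-injective)))

    image : (Fin s → Fin n) → Subset s → Subset n
    image f []            = ⊥
    image f (inside ∷ p)  = ⁅ f zero ⁆ ∪ image (f ∘ suc) p
    image f (outside ∷ p) = image (f ∘ suc) p

    ∈-image⁺ : (f : Fin s → Fin n) {p : Subset s} {v : Fin s} → v ∈ˢ p → f v ∈ˢ image f p
    ∈-image⁺ f {inside ∷ p}  here       = p⊆p∪q (image (f ∘ suc) p) (x∈⁅x⁆ (f zero))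
    ∈-image⁺ f {inside ∷ p}  (there v∈) = q⊆p∪q ⁅ f zero ⁆ _ (∈-image⁺ (f ∘ suc) v∈)
    ∈-image⁺ f {outside ∷ p} (there v∈) = ∈-image⁺ (f ∘ suc) v∈

    ∈-image⁻ : (f : Fin s → Fin n) (p : Subset s) {j : Fin n} → j ∈ˢ image f p → ∃[ v ] (v ∈ˢ p × f v ≡ j)
    ∈-image⁻ f [] j∈ = ⊥-elim (∉⊥ j∈)
    ∈-image⁻ f (inside ∷ p) j∈ with x∈p∪q⁻ ⁅ f zero ⁆ (image (f ∘ suc) p) j∈
    ... | inj₁ q = zero , here , sym (x∈⁅y⁆⇒x≡y _ q)
    ... | inj₂ q with v , v∈ , eq ← ∈-image⁻ (f ∘ suc) p q = suc v , there v∈ , eq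
    ∈-image⁻ f (outside ∷ p) j∈ with v , v∈ , eq ← ∈-image⁻ (f ∘ suc) p j∈ = suc v , there v∈ , eq

    ∣⁅x⁆∪p∣≤ : (x : Fin n) (p : Subset n) → ∣ ⁅ x ⁆ ∪ p ∣ ≤ suc ∣ p ∣
    ∣⁅x⁆∪p∣≤ zero    (inside ∷ p)  rewrite ∪-identityˡ p = s≤s (n≤1+n ∣ p ∣)
    ∣⁅x⁆∪p∣≤ zero    (outside ∷ p) rewrite ∪-identityˡ p = ≤-refl
    ∣⁅x⁆∪p∣≤ (suc x) (inside ∷ p)  = s≤s (∣⁅x⁆∪p∣≤ x p)
    ∣⁅x⁆∪p∣≤ (suc x) (outside ∷ p) = ∣⁅x⁆∪p∣≤ x p

    ∣⁅x⁆∪p∣≡ : {x : Fin n} {p : Subset n} → x ∉ˢ p → ∣ ⁅ x ⁆ ∪ p ∣ ≡ suc ∣ p ∣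
    ∣⁅x⁆∪p∣≡ {x = zero}  {inside ∷ p}  x∉ = ⊥-elim (x∉ here)
    ∣⁅x⁆∪p∣≡ {x = zero}  {outside ∷ p} x∉ rewrite ∪-identityˡ p = refl
    ∣⁅x⁆∪p∣≡ {x = suc x} {inside ∷ p}  x∉ = cong suc (∣⁅x⁆∪p∣≡ (x∉ ∘ there))
    ∣⁅x⁆∪p∣≡ {x = suc x} {outside ∷ p} x∉ = ∣⁅x⁆∪p∣≡ (x∉ ∘ there)

    ∣image∣≤ : (f : Fin s → Fin n) (p : Subset s) → ∣ image f p ∣ ≤ ∣ p ∣
    ∣image∣≤ {n = n} f [] = ≤-reflexive (∣⊥∣≡0 n)
    ∣image∣≤ f (inside ∷ p)  = ≤-trans (∣⁅x⁆∪p∣≤ (f zero) (image (f ∘ suc) p)) (s≤s (∣image∣≤ (f ∘ suc) p))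
    ∣image∣≤ f (outside ∷ p) = ∣image∣≤ (f ∘ suc) p

    InjectiveOn : Subset s → (Fin s → B) → Set
    InjectiveOn p f = ∀ {u v} → u ∈ˢ p → v ∈ˢ p → f u ≡ f v → u ≡ v

    ∣image∣≡ : (f : Fin s → Fin n) (p : Subset s) → InjectiveOn p f → ∣ image f p ∣ ≡ ∣ p ∣
    ∣image∣≡ {n = n} f [] _ = ∣⊥∣≡0 n
    ∣image∣≡ f (inside ∷ p) inj =
      trans (∣⁅x⁆∪p∣≡ fresh) (cong suc (∣image∣≡ (f ∘ suc) p (λ u∈ v∈ eq → Finₚ.suc-injective (inj (there u∈) (there v∈) eq))))
      where
      fresh : f zero ∉ˢ image (f ∘ suc) p
      fresh z∈ with v , v∈ , eq ← ∈-image⁻ (f ∘ suc) p z∈ with () ← inj (there v∈) here eq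
    ∣image∣≡ f (outside ∷ p) inj =
      ∣image∣≡ (f ∘ suc) p (λ u∈ v∈ eq → Finₚ.suc-injective (inj (there u∈) (there v∈) eq))

    injectiveOn⇒surjective : (χ : Fin s → Fin k) (p : Subset s) → ∣ p ∣ ≡ k → InjectiveOn p χ → ∀ c → ∃[ v ] (v ∈ˢ p × χ v ≡ c)
    injectiveOn⇒surjective {k = k} χ p size inj c =
      ∈-image⁻ χ p (subst (c ∈ˢ_) (sym (∣p∣≡n⇒p≡⊤ (trans (∣image∣≡ χ p inj) size))) ∈⊤)

    exists-∉ : (p : Subset n) → ∣ p ∣ < n → ∃[ x ] x ∉ˢ p
    exists-∉ {n = suc n} (outside ∷ p) _ = zero , λ ()
    exists-∉ {n = suc n} (inside ∷ p) (s≤s lt) with x , x∉ ← exists-∉ p lt = suc x , λ { (there q) → x∉ q }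

    toSet : Vec (Fin n) k → Subset n
    toSet []      = ⊥
    toSet (x ∷ v) = ⁅ x ⁆ ∪ toSet v

    ∈-toSet⁺ : (v : Vec (Fin n) k) (c : Fin k) → lookup v c ∈ˢ toSet v
    ∈-toSet⁺ (x ∷ v) zero    = p⊆p∪q (toSet v) (x∈⁅x⁆ x)
    ∈-toSet⁺ (x ∷ v) (suc c) = q⊆p∪q ⁅ x ⁆ _ (∈-toSet⁺ v c)

    ∈-toSet⁻ : (v : Vec (Fin n) k) {j : Fin n} → j ∈ˢ toSet v → ∃[ c ] lookup v c ≡ j
    ∈-toSet⁻ [] j∈ = ⊥-elim (∉⊥ j∈)
    ∈-toSet⁻ (x ∷ v) j∈ with x∈p∪q⁻ ⁅ x ⁆ (toSet v) j∈
    ... | inj₁ q = zero , sym (x∈⁅y⁆⇒x≡y _ q)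
    ... | inj₂ q with c , eq ← ∈-toSet⁻ v q = suc c , eq

    Distinct : Vec (Fin n) k → Set
    Distinct v = ∀ {c d} → lookup v c ≡ lookup v d → c ≡ d

    ∣toSet∣≤ : (v : Vec (Fin n) k) → ∣ toSet v ∣ ≤ k
    ∣toSet∣≤ {n = n} [] = ≤-reflexive (∣⊥∣≡0 n)
    ∣toSet∣≤ (x ∷ v) = ≤-trans (∣⁅x⁆∪p∣≤ x (toSet v)) (s≤s (∣toSet∣≤ v))

    ∣toSet∣≡ : (v : Vec (Fin n) k) → Distinct v → ∣ toSet v ∣ ≡ k
    ∣toSet∣≡ {n = n} [] _ = ∣⊥∣≡0 n
    ∣toSet∣≡ (x ∷ v) d = trans (∣⁅x⁆∪p∣≡ fresh) (cong suc (∣toSet∣≡ v (Finₚ.suc-injective ∘ d)))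
      where
      fresh : x ∉ˢ toSet v
      fresh x∈ with c , eq ← ∈-toSet⁻ v x∈ with () ← d {suc c} {zero} eq

    removeAt-⊆ : (v : Vec (Fin n) (suc k)) (c : Fin (suc k)) {d : Fin k} → ∃[ c′ ] (¬ c′ ≡ c × lookup (removeAt v c) d ≡ lookup v c′)
    removeAt-⊆ (x ∷ v) zero {d} = suc d , (λ ()) , refl
    removeAt-⊆ {k = suc k} (x ∷ v@(_ ∷ _)) (suc c) {zero} = zero , (λ ()) , refl
    removeAt-⊆ {k = suc k} (x ∷ v@(_ ∷ _)) (suc c) {suc d} with c′ , ne , eq ← removeAt-⊆ v c {d} =
      suc c′ , ne ∘ Finₚ.suc-injective , eq

    lookup-∉-removeAt : (v : Vec (Fin n) (suc k)) (c : Fin (suc k)) → Distinct v → lookup v c ∉ˢ toSet (removeAt v c)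
    lookup-∉-removeAt v c dist j∈ with d , eq ← ∈-toSet⁻ (removeAt v c) j∈
      with c′ , ne , eq′ ← removeAt-⊆ v c {d} = ne (dist (trans (sym eq′) eq))

    toSet-removeAt : (v : Vec (Fin n) (suc k)) (c : Fin (suc k)) → toSet v ≡ ⁅ lookup v c ⁆ ∪ toSet (removeAt v c)
    toSet-removeAt v c = ⊆-antisym to from
      where
      to : ∀ {j} → j ∈ˢ toSet v → j ∈ˢ ⁅ lookup v c ⁆ ∪ toSet (removeAt v c)
      to j∈ with d , refl ← ∈-toSet⁻ v j∈ with c Finₚ.≟ d
      ... | yes refl = p⊆p∪q _ (x∈⁅x⁆ _)
      ... | no ne = q⊆p∪q ⁅ lookup v c ⁆ _ (subst (_∈ˢ _) (removeAt-punchOut v ne) (∈-toSet⁺ (removeAt v c) _))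
      from : ∀ {j} → j ∈ˢ ⁅ lookup v c ⁆ ∪ toSet (removeAt v c) → j ∈ˢ toSet v
      from j∈ with x∈p∪q⁻ ⁅ lookup v c ⁆ _ j∈
      ... | inj₁ q = subst (_∈ˢ toSet v) (sym (x∈⁅y⁆⇒x≡y _ q)) (∈-toSet⁺ v c)
      ... | inj₂ q with d , refl ← ∈-toSet⁻ (removeAt v c) q
        with c′ , _ , eq ← removeAt-⊆ v c {d} = subst (_∈ˢ toSet v) (sym eq) (∈-toSet⁺ v c′)

    Distinct-removeAt : (v : Vec (Fin n) (suc k)) (c : Fin (suc k)) → Distinct v → ∣ toSet (removeAt v c) ∣ ≡ k
    Distinct-removeAt v c dist = suc-injective (begin
      suc ∣ toSet (removeAt v c) ∣              ≡⟨ ∣⁅x⁆∪p∣≡ (lookup-∉-removeAt v c dist) ⟨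
      ∣ ⁅ lookup v c ⁆ ∪ toSet (removeAt v c) ∣ ≡⟨ cong ∣_∣ (toSet-removeAt v c) ⟨
      ∣ toSet v ∣                               ≡⟨ ∣toSet∣≡ v dist ⟩
      suc _ ∎)
      where open ≡-Reasoning

    elements : (p : Subset n) → Vec (Fin n) ∣ p ∣
    elements []            = []
    elements (inside ∷ p)  = zero ∷ Vec.map suc (elements p)
    elements (outside ∷ p) = Vec.map suc (elements p)

    ∈-elements : (p : Subset n) (c : Fin ∣ p ∣) → lookup (elements p) c ∈ˢ p
    ∈-elements (inside ∷ p)  zero    = here
    ∈-elements (inside ∷ p)  (suc c) = subst (_∈ˢ inside ∷ p) (sym (lookup-map c suc (elements p))) (there (∈-elements p c))
    ∈-elements (outside ∷ p) c       = subst (_∈ˢ outside ∷ p) (sym (lookup-map c suc (elements p))) (there (∈-elements p c))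

    elements-complete : {p : Subset n} {j : Fin n} → j ∈ˢ p → ∃[ c ] lookup (elements p) c ≡ j
    elements-complete {p = inside ∷ p}  here       = zero , refl
    elements-complete {p = inside ∷ p}  (there j∈) with c , eq ← elements-complete j∈ =
      suc c , trans (lookup-map c suc (elements p)) (cong suc eq)
    elements-complete {p = outside ∷ p} (there j∈) with c , eq ← elements-complete j∈ =
      c , trans (lookup-map c suc (elements p)) (cong suc eq)

    elements-distinct : (p : Subset n) → Distinct (elements p)
    elements-distinct (inside ∷ p) {zero}  {zero}  eq = refl
    elements-distinct (inside ∷ p) {zero}  {suc d} eq with () ← trans eq (lookup-map d suc (elements p))
    elements-distinct (inside ∷ p) {suc c} {zero}  eq with () ← trans (sym eq) (lookup-map c suc (elements p))
    elements-distinct (inside ∷ p) {suc c} {suc d} eq = cong suc (elements-distinct p (Finₚ.suc-injective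
      (trans (sym (lookup-map c suc (elements p))) (trans eq (lookup-map d suc (elements p))))))
    elements-distinct (outside ∷ p) {c} {d} eq = elements-distinct p (Finₚ.suc-injective
      (trans (sym (lookup-map c suc (elements p))) (trans eq (lookup-map d suc (elements p)))))

    enumerate : (p : Subset n) → ∣ p ∣ ≡ k →
      ∃[ v ] (Distinct {n} {k} v × toSet v ≡ p)
    enumerate p refl = elements p , elements-distinct p , ⊆-antisym
      (λ j∈ → let c , eq = ∈-toSet⁻ (elements p) j∈ in subst (_∈ˢ p) eq (∈-elements p c))
      (λ j∈ → let c , eq = elements-complete j∈ in subst (_∈ˢ toSet (elements p)) eq (∈-toSet⁺ (elements p) c))

    vecsIn : Subset n → (j : ℕ) → List (Vec (Fin n) j)
    vecsIn p = vecsOver (Vec.toList (elements p))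

    length-vecsIn : (p : Subset n) (j : ℕ) → length (vecsIn p j) ≡ ∣ p ∣ ^ j
    length-vecsIn p j = trans (length-vecsOver _ j) (cong (_^ j) (Vecₚ.length-toList (elements p)))

    ∈-toList : {m : ℕ} (v : Vec A m) (c : Fin m) → lookup v c ∈ Vec.toList v
    ∈-toList (x ∷ v) zero    = here refl
    ∈-toList (x ∷ v) (suc c) = there (∈-toList v c)

    ∈-vecsIn : {p : Subset n} {j : ℕ} (v : Vec (Fin n) j) → (∀ c → lookup v c ∈ˢ p) → v ∈ vecsIn p j
    ∈-vecsIn {p = p} v h = ∈-vecsOver v (λ c → let d , eq = elements-complete (h c) in subst (_∈ _) eq (∈-toList (elements p) d))

    length-unique-vecs-in : (p : Subset n) {j : ℕ} (vs : List (Vec (Fin n) j)) → Unique vs →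
      (∀ {v} → v ∈ vs → ∀ c → lookup v c ∈ˢ p) → length vs ≤ ∣ p ∣ ^ j
    length-unique-vecs-in p {j} vs u h =
      ≤-trans (length≤-of-⊆ u (λ {v} v∈ → ∈-vecsIn v (h v∈))) (≤-reflexive (length-vecsIn p j))

    Unique-subsetsOfSize : ∀ n j → Unique (subsetsOfSize n j)
    Unique-subsetsOfSize zero    zero    = [] ∷ []
    Unique-subsetsOfSize zero    (suc j) = []
    Unique-subsetsOfSize (suc n) zero    = [] ∷ []
    Unique-subsetsOfSize (suc n) (suc j) =
      Uniqueₚ.++⁺ (Uniqueₚ.map⁺ (proj₂ ∘ ∷-injective) (Unique-subsetsOfSize n j))
                  (Uniqueₚ.map⁺ (proj₂ ∘ ∷-injective) (Unique-subsetsOfSize n (suc j))) disjoint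
      where
      disjoint : ∀ {p} → ¬ (p ∈ map (inside ∷_) (subsetsOfSize n j) × p ∈ map (outside ∷_) (subsetsOfSize n (suc j)))
      disjoint (p∈ , p∈′) with _ , _ , refl ← ∈-map⁻ _ p∈ with _ , _ , () ← ∈-map⁻ _ p∈′

    ∣p∣-of-∈-subsetsOfSize : ∀ n j {p : Subset n} → p ∈ subsetsOfSize n j → ∣ p ∣ ≡ j
    ∣p∣-of-∈-subsetsOfSize zero    zero    (here refl) = refl
    ∣p∣-of-∈-subsetsOfSize (suc n) zero    (here refl) = ∣⊥∣≡0 (suc n)
    ∣p∣-of-∈-subsetsOfSize (suc n) (suc j) p∈ with ∈-++⁻ (map (inside ∷_) (subsetsOfSize n j)) p∈
    ... | inj₁ q with _ , r , refl ← ∈-map⁻ _ q = cong suc (∣p∣-of-∈-subsetsOfSize n j r)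
    ... | inj₂ q with _ , r , refl ← ∈-map⁻ _ q = ∣p∣-of-∈-subsetsOfSize n (suc j) r

    Unique-vecsOver : {xs : List A} → Unique xs → ∀ j → Unique (vecsOver xs j)
    Unique-vecsOver u zero    = [] ∷ []
    Unique-vecsOver u (suc j) = Uniqueₚ.cartesianProductWith⁺ _∷_ ∷-injective u (Unique-vecsOver u j)

  open SubsetsAndTuples public

  -- Peeling and random colourings

  -- A reason r groups the elements by `key r` and condemns the members of groups of size at most
  -- `q r`. The type of keys depends on r because projections to different sets of positions have
  -- different lengths.
  module Peeling {A R : Set} (K : R → Set) (eqK : (r : R) → DecidableEquality (K r)) (eqR : DecidableEquality R)
    (key : (r : R) → A → K r) (rs : List R) (q : R → ℕ) where


    withKey : (r : R) → K r → List A → List A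
    withKey r κ = filter (λ y → eqK r (key r y) κ)

    degree : (r : R) → K r → List A → ℕ
    degree r κ xs = length (withKey r κ xs)

    removedFor : R → List (A × R) → List (A × R)
    removedFor r = filter (λ z → eqR (proj₂ z) r)

    removedWithKey : (r : R) → K r → List (A × R) → List (A × R)
    removedWithKey r κ zs = filter (λ z → eqK r (key r (proj₁ z)) κ) (removedFor r zs)

    record Peeled (xs : List A) : Set where
      field
        core    : List A
        removed : List (A × R)
        perm    : xs ↭ core ++ map proj₁ removed
        stable  : ∀ {x r} → x ∈ core → r ∈ rs → q r < degree r (key r x) core
        light   : ∀ r κ → length (removedWithKey r κ removed) ≤ q r
        reasons : All (λ z → proj₂ z ∈ rs) removed

      removed≤degree : ∀ r κ → length (removedWithKey r κ removed) ≤ degree r κ xs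
      removed≤degree r κ = begin
        length (removedWithKey r κ removed)
          ≤⟨ filter-swap-≤ _ (λ z → eqR (proj₂ z) r) removed ⟩
        length (filter (λ z → eqK r (key r (proj₁ z)) κ) removed)
          ≡⟨ length-filter-map (λ y → eqK r (key r y) κ) proj₁ removed ⟨
        degree r κ (map proj₁ removed)
          ≤⟨ m≤n+m _ _ ⟩
        degree r κ core + degree r κ (map proj₁ removed)
          ≡⟨ length-++ (withKey r κ core) ⟨
        length (withKey r κ core ++ withKey r κ (map proj₁ removed))
          ≡⟨ cong length (Listₚ.filter-++ _ core _) ⟨
        degree r κ (core ++ map proj₁ removed)
          ≡⟨ ↭-length (filter-↭ _ perm) ⟨
        degree r κ xs ∎
        where
        open ≤-Reasoning
        import Data.List.Properties as Listₚ

      length-split : length xs ≡ length core + length removed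
      length-split = trans (↭-length perm) (trans (length-++ core) (cong (length core +_) (length-map proj₁ removed)))

      ∈-core : ∀ {x} → x ∈ core → x ∈ xs
      ∈-core x∈ = ∈-resp-↭ (↭-sym perm) (∈-++⁺ˡ x∈)

      ∈-removed : ∀ {z} → z ∈ removed → proj₁ z ∈ xs
      ∈-removed z∈ = ∈-resp-↭ (↭-sym perm) (∈-++⁺ʳ core (∈-map⁺ proj₁ z∈))

      Unique-core++removed : Unique xs → Unique (core ++ map proj₁ removed)
      Unique-core++removed = Permₚ.Unique-resp-↭ (setoid A) (↭⇒↭ₛ perm)

      Unique-core : Unique xs → Unique core
      Unique-core u = ++⁻ˡ core (Unique-core++removed u)
        where
        ++⁻ˡ : (as : List A) {bs : List A} → Unique (as ++ bs) → Unique as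
        ++⁻ˡ []       _        = []
        ++⁻ˡ (a ∷ as) (p ∷ ps) = Allₚ.++⁻ˡ as p ∷ ++⁻ˡ as ps

      Unique-removed : Unique xs → Unique (map proj₁ removed)
      Unique-removed u = ++⁻ʳ core (Unique-core++removed u)
        where
        ++⁻ʳ : (as : List A) {bs : List A} → Unique (as ++ bs) → Unique bs
        ++⁻ʳ []       us       = us
        ++⁻ʳ (a ∷ as) (_ ∷ ps) = ++⁻ʳ as ps

      length-removedFor : ∀ r (ks : List (K r)) → (∀ {x} → x ∈ xs → key r x ∈ ks) →
        length (removedFor r removed) ≤ q r * length ks
      length-removedFor r ks h = length≤-by-fibres (λ z → key r (proj₁ z)) (removedFor r removed) ks (q r)
        (λ z∈ → h (∈-removed (proj₁ (∈-filter⁻ (λ z → eqR (proj₂ z) r) z∈)))) (λ {κ} _ → light r κ)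
        where open Fibres (eqK r)

    opaque
      peel : ∀ xs → Peeled xs
      peel xs = go (length xs) xs ≤-refl
        where
        go : ∀ m xs → length xs ≤ m → Peeled xs
        go m xs len with any? (λ x → any? (λ r → degree r (key r x) xs ≤? q r) rs) xs
        ... | no ¬bad = record
          { core = xs ; removed = []
          ; perm = subst (xs ↭_) (sym (Listₚ.++-identityʳ xs)) ↭-refl
          ; stable = λ x∈ r∈ → ≰⇒> (λ le → ¬bad (Any.map (λ { refl → Any.map (λ { refl → le }) r∈ }) x∈))
          ; light = λ _ _ → z≤n
          ; reasons = [] }
          where
          import Data.List.Properties as Listₚ
        ... | yes bad with x , x∈ , badx ← find bad with r , r∈ , le ← find badx with ∈-∃++ x∈
        go zero    .(ys ++ x ∷ zs) len | yes bad | ys , zs , refl =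
          ⊥-elim (1+n≰n (≤-trans (≤-trans (s≤s z≤n) (≤-reflexive (sym (↭-length (shift x ys zs))))) len))
        go (suc m) .(ys ++ x ∷ zs) len | yes bad | ys , zs , refl = record
          { core = core
          ; removed = (x , r) ∷ removed
          ; perm = ↭-trans (shift x ys zs) (↭-trans (prep x perm) (↭-sym (shift x core (map proj₁ removed))))
          ; stable = stable
          ; light = light′
          ; reasons = r∈ ∷ reasons }
          where
          open Peeled (go m (ys ++ zs) (≤-pred (≤-trans (≤-reflexive (sym (↭-length (shift x ys zs)))) len)))
          -- When the first element is removed for a given reason and key, its group has size at
          -- most `q r`. Whatever is removed later for the same reason and key was still present at
          -- that moment and belongs to that group.
          light′ : ∀ r′ κ → length (removedWithKey r′ κ ((x , r) ∷ removed)) ≤ q r′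
          light′ r′ κ with eqR r r′
          ... | no _ = light r′ κ
          ... | yes refl with eqK r (key r x) κ in eq
          ...   | no _ = light r κ
          ...   | yes refl = begin
            suc (length (removedWithKey r (key r x) removed)) ≤⟨ s≤s (removed≤degree r (key r x)) ⟩
            suc (degree r (key r x) (ys ++ zs))               ≡⟨ cong length (filter-accept (λ y → eqK r (key r y) (key r x)) refl) ⟨
            degree r (key r x) (x ∷ ys ++ zs)                 ≡⟨ ↭-length (filter-↭ _ (shift x ys zs)) ⟨
            degree r (key r x) (ys ++ x ∷ zs)                 ≤⟨ le ⟩
            q r                                               ∎
            where
            open ≤-Reasoning
            open import Data.List.Properties using (filter-accept)

  module _ {A : Set} {n c : ℕ} (Q : A → Subset n) (col : A → Fin n → Fin c) where


    Consistent : Vec (Fin c) n → A → Set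
    Consistent cls z = ∀ v → v ∈ˢ Q z → lookup cls v ≡ col z v

    consistent? : ∀ cls z → Dec (Consistent cls z)
    consistent? cls z = Finₚ.all? (λ v → (v ∈? Q z) →-dec (lookup cls v Finₚ.≟ col z v))

    -- A uniformly random colouring meets the at most m demands of an item with probability at least c⁻ᵐ.
    colouring-exists : (m : ℕ) (zs : List A) → 0 < c → (∀ {z} → z ∈ zs → ∣ Q z ∣ ≤ m) →
      ∃[ cls ] length zs ≤ c ^ m * length (filter (consistent? cls) zs)
    colouring-exists m zs 0<c small = let cls , _ , le = exists-≥-average g (length zs) cs nonempty average in cls , le
      where
      cs : List (Vec (Fin c) n)
      cs = allVecs c n
      g : Vec (Fin c) n → ℕ
      g cls = c ^ m * length (filter (consistent? cls) zs)
      nonempty : 0 < length cs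
      nonempty = subst (0 <_) (sym (length-allVecs c n)) (m^n>0 c {{>-nonZero 0<c}} n)
      -- Forcing the demands of z makes any colouring consistent with z. The forced colouring and
      -- the old colours on `Q z` determine the old colouring, so the map is at most c^m to one.
      override : A → Vec (Fin c) n → Vec (Fin c) n
      override z cls = tabulate (λ v → ifDec (v ∈? Q z) (col z v) (lookup cls v))
      lookup-override : ∀ z cls v → lookup (override z cls) v ≡ ifDec (v ∈? Q z) (col z v) (lookup cls v)
      lookup-override z cls v = lookup∘tabulate _ v
      override-consistent : ∀ z cls → Consistent (override z cls) z
      override-consistent z cls v v∈ = trans (lookup-override z cls v) (ifDec-yes (v ∈? Q z) v∈)
      override-injective : ∀ z cls cls′ → override z cls ≡ override z cls′ → proj (Q z) cls ≡ proj (Q z) cls′ → cls ≡ cls′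
      override-injective z cls cls′ eq eq′ = vec-ext same
        where
        same : ∀ v → lookup cls v ≡ lookup cls′ v
        same v with v ∈? Q z
        ... | yes v∈ = proj-≡⇒ (Q z) cls cls′ eq′ v∈
        ... | no  v∉ = begin
          lookup cls v                ≡⟨ ifDec-no (v ∈? Q z) v∉ ⟨
          ifDec (v ∈? Q z) _ _        ≡⟨ lookup-override z cls v ⟨
          lookup (override z cls) v   ≡⟨ cong (λ w → lookup w v) eq ⟩
          lookup (override z cls′) v  ≡⟨ lookup-override z cls′ v ⟩
          ifDec (v ∈? Q z) _ _        ≡⟨ ifDec-no (v ∈? Q z) v∉ ⟩
          lookup cls′ v               ∎
          where open ≡-Reasoning
      instance
        c≢0 : NonZero c
        c≢0 = >-nonZero 0<c
      many : ∀ {z} → z ∈ zs → length cs ≤ c ^ m * length (filter (λ cls → consistent? cls z) cs)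
      many {z} z∈ = length≤-by-fibres (override z) cs (filter (λ cls → consistent? cls z) cs) (c ^ m)
        (λ {cls} _ → ∈-filter⁺ _ (∈-allVecs (override z cls)) (override-consistent z cls))
        (λ {w} _ → begin
          length (fibre (override z) w cs) ≤⟨ length≤-of-injection (proj (Q z)) {ys = allVecs c ∣ Q z ∣}
                                                (Uniqueₚ.filter⁺ _ (Unique-vecsOver (Uniqueₚ.allFin⁺ c) n))
                                                (λ {cls} {cls′} p p′ → override-injective z cls cls′
                                                  (trans (proj₂ (∈-fibre⁻ _ cs p)) (sym (proj₂ (∈-fibre⁻ _ cs p′)))))
                                                (λ _ → ∈-allVecs _) ⟩
          length (allVecs c ∣ Q z ∣)       ≡⟨ length-allVecs c ∣ Q z ∣ ⟩
          c ^ ∣ Q z ∣                      ≤⟨ ^-monoʳ-≤ c (small z∈) ⟩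
          c ^ m                            ∎)
        where
        open Fibres (Vecₚ.≡-dec Finₚ._≟_)
        open ≤-Reasoning
      average : length zs * length cs ≤ sum (map g cs)
      average = begin
        length zs * length cs
          ≡⟨ *-comm (length zs) (length cs) ⟩
        length cs * length zs
          ≤⟨ sum-map-≥ _ (length cs) zs many ⟩
        sum (map (λ z → c ^ m * length (filter (λ cls → consistent? cls z) cs)) zs)
          ≡⟨ sum-map-* (c ^ m) _ zs ⟩
        c ^ m * sum (map (λ z → length (filter (λ cls → consistent? cls z) cs)) zs)
          ≡⟨ cong (c ^ m *_) (double-counting (λ z cls → consistent? cls z) zs cs) ⟩
        c ^ m * sum (map (λ cls → length (filter (consistent? cls) zs)) cs)
          ≡⟨ sum-map-* (c ^ m) _ cs ⟨
        sum (map g cs) ∎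
        where open ≤-Reasoning

  -- Rainbow colourings of hypertrees

  ∈-V⁺ : {s : ℕ} {L : List (Subset s)} {E : Subset s} {v : Fin s} → E ∈ L → v ∈ˢ E → v ∈ˢ V L
  ∈-V⁺ {L = E ∷ L} (here refl) v∈ = p⊆p∪q (V L) v∈
  ∈-V⁺ {L = E ∷ L} (there E∈)  v∈ = q⊆p∪q E (V L) (∈-V⁺ E∈ v∈)

  ∈-V⁻ : {s : ℕ} (L : List (Subset s)) {v : Fin s} → v ∈ˢ V L → ∃[ E ] (E ∈ L × v ∈ˢ E)
  ∈-V⁻ [] v∈ = ⊥-elim (∉⊥ v∈)
  ∈-V⁻ (E ∷ L) v∈ with x∈p∪q⁻ E (V L) v∈
  ... | inj₁ q = E , here refl , q
  ... | inj₂ q with F , F∈ , v∈F ← ∈-V⁻ L q = F , there F∈ , v∈F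

  -- The partial colouring `p` is used in three ways: empty; colour zero on a cross-cut; two colours
  -- on the chosen pairs of degree-one vertices. In every edge a prescribed colour must go to its
  -- owner and to no other vertex.
  module Colouring {s k′ : ℕ} (p : Fin s → Maybe (Fin (suc k′))) (Prescribed : Fin (suc k′) → Set)
    (prescribed : ∀ {v c} → p v ≡ just c → Prescribed c) where

    k : ℕ
    k = suc k′

    record PrescribedOn (E : Subset s) : Set where
      field
        unique : ∀ {u v c} → u ∈ˢ E → v ∈ˢ E → p u ≡ just c → p v ≡ just c → u ≡ v
        onto   : ∀ {c} → Prescribed c → ∃[ v ] (v ∈ˢ E × p v ≡ just c)

    record RainbowOn (χ : Fin s → Fin k) (E : Subset s) : Set where
      field
        injective : InjectiveOn E χ
        respects  : ∀ {v c} → v ∈ˢ E → p v ≡ just c → χ v ≡ c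

    -- The owner of this colour in E also receives it, and χ is injective on E.
    rainbow-converse : ∀ {χ E} → PrescribedOn E → RainbowOn χ E → ∀ {v} → v ∈ˢ E → Prescribed (χ v) → p v ≡ just (χ v)
    rainbow-converse pre rb {v} v∈ pc with w , w∈ , eq ← PrescribedOn.onto pre pc =
      subst (λ u → p u ≡ just _) (RainbowOn.injective rb w∈ v∈ (RainbowOn.respects rb w∈ eq)) eq

    module Completion (E : Subset s) (size : ∣ E ∣ ≤ k) (pre : PrescribedOn E) (χ₀ : Fin s → Fin k) (A₀ : Subset s) where

      -- A is the part of E coloured so far and A₀ the part inherited from earlier edges. The
      -- invariant `converse` keeps prescribed colours free for their owners.
      record State (χ : Fin s → Fin k) (A : Subset s) : Set where
        field
          A⊆E       : ∀ {v} → v ∈ˢ A → v ∈ˢ E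
          A₀⊆A      : ∀ {v} → v ∈ˢ A₀ → v ∈ˢ A
          injective : InjectiveOn A χ
          respects  : ∀ {v c} → v ∈ˢ A → p v ≡ just c → χ v ≡ c
          converse  : ∀ {v} → v ∈ˢ A → Prescribed (χ v) → p v ≡ just (χ v)
          unchanged : ∀ {v} → v ∈ˢ A₀ ⊎ v ∉ˢ E → χ v ≡ χ₀ v

      assign : ∀ {χ A} → State χ A → ∀ {v} → v ∈ˢ E → v ∉ˢ A → (c : Fin k) → c ∉ˢ image χ A →
        (∀ {c′} → p v ≡ just c′ → c ≡ c′) → (Prescribed c → p v ≡ just c) →
        ∃[ χ′ ] State χ′ (⁅ v ⁆ ∪ A)
      assign {χ} {A} st {v} v∈E v∉A c c∉ resp conv = χ′ , record
        { A⊆E = λ u∈ → case u∈ (λ { refl → v∈E }) A⊆E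
        ; A₀⊆A = λ u∈ → q⊆p∪q ⁅ v ⁆ A (A₀⊆A u∈)
        ; injective = λ {u} {w} u∈ w∈ → case u∈
            (λ { refl → case w∈ (λ { refl _ → refl })
                   (λ w∈A eq → ⊥-elim (c∉ (subst (_∈ˢ image χ A) (sym (trans (sym new) (trans eq (old w∈A)))) (∈-image⁺ χ w∈A)))) })
            (λ u∈A → case w∈
               (λ { refl eq → ⊥-elim (c∉ (subst (_∈ˢ image χ A) (trans (sym (old u∈A)) (trans eq new)) (∈-image⁺ χ u∈A))) })
               (λ w∈A eq → injective u∈A w∈A (trans (sym (old u∈A)) (trans eq (old w∈A)))))
        ; respects = λ u∈ → case u∈ (λ { refl eq → trans new (resp eq) }) (λ u∈A eq → trans (old u∈A) (respects u∈A eq))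
        ; converse = λ {u} u∈ → case u∈
            (λ { refl pr → trans (conv (subst Prescribed new pr)) (cong just (sym new)) })
            (λ u∈A pr → trans (converse u∈A (subst Prescribed (old u∈A) pr)) (cong just (sym (old u∈A))))
        ; unchanged = λ {u} h → trans (ifDec-no (u Finₚ.≟ v) (away h)) (unchanged h) }
        where
        open State st
        χ′ : Fin s → Fin k
        χ′ u = ifDec (u Finₚ.≟ v) c (χ u)
        new : χ′ v ≡ c
        new = ifDec-yes (v Finₚ.≟ v) refl
        old : ∀ {u} → u ∈ˢ A → χ′ u ≡ χ u
        old {u} u∈ = ifDec-no (u Finₚ.≟ v) (λ { refl → v∉A u∈ })
        case : ∀ {u} {X : Set} → u ∈ˢ ⁅ v ⁆ ∪ A → (u ≡ v → X) → (u ∈ˢ A → X) → X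
        case {u} u∈ f g with x∈p∪q⁻ ⁅ v ⁆ A u∈
        ... | inj₁ q = f (x∈⁅y⁆⇒x≡y v q)
        ... | inj₂ q = g q
        away : ∀ {u} → u ∈ˢ A₀ ⊎ u ∉ˢ E → ¬ u ≡ v
        away (inj₁ u∈) refl = v∉A (A₀⊆A u∈)
        away (inj₂ u∉) refl = u∉ v∈E

      assignPrescribed : ∀ {χ A} → State χ A → (vs : List (Fin s)) →
        ∃[ χ′ ] ∃[ A′ ] (State χ′ A′ × (∀ {v} → v ∈ˢ A → v ∈ˢ A′) ×
                         (∀ {v c} → v ∈ vs → v ∈ˢ E → p v ≡ just c → v ∈ˢ A′))
      assignPrescribed {χ} {A} st [] = χ , A , st , id , λ ()
      assignPrescribed {χ} {A} st (v ∷ vs) with v ∈? E | v ∈? A | p v in eq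
      ... | no v∉ | _ | _ with χ′ , A′ , st′ , sub , done ← assignPrescribed st vs =
        χ′ , A′ , st′ , sub , λ { (here refl) v∈ _ → ⊥-elim (v∉ v∈) ; (there u∈) → done u∈ }
      ... | yes _ | yes v∈A | _ with χ′ , A′ , st′ , sub , done ← assignPrescribed st vs =
        χ′ , A′ , st′ , sub , λ { (here refl) _ _ → sub v∈A ; (there u∈) → done u∈ }
      ... | yes _ | no _ | nothing with χ′ , A′ , st′ , sub , done ← assignPrescribed st vs =
        χ′ , A′ , st′ , sub , λ { (here refl) _ e → ⊥-elim (absurd (trans (sym eq) e)) ; (there u∈) → done u∈ }
        where
        absurd : ∀ {c : Fin k} → ¬ nothing ≡ just c
        absurd ()
      ... | yes v∈E | no v∉A | just c
        with χ₁ , st₁ ← assign st v∈E v∉A c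
               -- A vertex already using c would own c by `converse`, hence be v itself, which is
               -- not yet coloured.
               (λ c∈ → let u , u∈ , e = ∈-image⁻ χ A c∈
                           pu = State.converse st u∈ (subst Prescribed (sym e) (prescribed eq))
                       in v∉A (subst (_∈ˢ A) (PrescribedOn.unique pre (State.A⊆E st u∈) v∈E (trans pu (cong just e)) eq) u∈))
               (λ e → just-injective (trans (sym eq) e)) (λ _ → eq)
        with χ′ , A′ , st′ , sub , done ← assignPrescribed st₁ vs =
        χ′ , A′ , st′ , sub ∘ q⊆p∪q ⁅ v ⁆ A
        , λ { (here refl) _ _ → sub (p⊆p∪q A (x∈⁅x⁆ v)) ; (there u∈) → done u∈ }

      assignRest : ∀ {χ A} → State χ A → (∀ {v c} → v ∈ˢ E → p v ≡ just c → v ∈ˢ A) → (vs : List (Fin s)) →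
        ∃[ χ′ ] ∃[ A′ ] (State χ′ A′ × (∀ {v} → v ∈ˢ A → v ∈ˢ A′) × (∀ {v} → v ∈ vs → v ∈ˢ E → v ∈ˢ A′))
      assignRest {χ} {A} st all [] = χ , A , st , id , λ ()
      assignRest {χ} {A} st all (v ∷ vs) with v ∈? E | v ∈? A
      ... | no v∉ | _ with χ′ , A′ , st′ , sub , done ← assignRest st all vs =
        χ′ , A′ , st′ , sub , λ { (here refl) v∈ → ⊥-elim (v∉ v∈) ; (there u∈) → done u∈ }
      ... | yes _ | yes v∈A with χ′ , A′ , st′ , sub , done ← assignRest st all vs =
        χ′ , A′ , st′ , sub , λ { (here refl) _ → sub v∈A ; (there u∈) → done u∈ }
      ... | yes v∈E | no v∉A
        with c , c∉ ← exists-∉ (image χ A)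
               (<-≤-trans (≤-<-trans (∣image∣≤ χ A) (p⊂q⇒∣p∣<∣q∣ (State.A⊆E st , v , v∈E , v∉A))) size)
        with χ₁ , st₁ ← assign st v∈E v∉A c c∉ (λ e → ⊥-elim (v∉A (all v∈E e)))
               -- A prescribed colour has an owner in E, and all owners are coloured by now, so a
               -- colour that is still free is not prescribed.
               (λ pc → let w , w∈ , e = PrescribedOn.onto pre pc
                       in ⊥-elim (c∉ (subst (_∈ˢ image χ A) (State.respects st (all w∈ e) e) (∈-image⁺ χ (all w∈ e)))))
        with χ′ , A′ , st′ , sub , done ← assignRest st₁ (λ w∈ e → q⊆p∪q ⁅ v ⁆ A (all w∈ e)) vs =
        χ′ , A′ , st′ , sub ∘ q⊆p∪q ⁅ v ⁆ A
        , λ { (here refl) _ → sub (p⊆p∪q A (x∈⁅x⁆ v)) ; (there u∈) → done u∈ }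

      complete : State χ₀ A₀ → ∃[ χ ] (RainbowOn χ E × (∀ {v} → v ∈ˢ A₀ ⊎ v ∉ˢ E → χ v ≡ χ₀ v))
      complete st
        with _ , _ , st₁ , _ , done₁ ← assignPrescribed st (allFin s)
        with χ , _ , st₂ , _ , done₂ ← assignRest st₁ (λ v∈ e → done₁ (∈-allFin _) v∈ e) (allFin s) =
        χ , record { injective = λ u∈ v∈ → State.injective st₂ (done₂ (∈-allFin _) u∈) (done₂ (∈-allFin _) v∈)
                   ; respects = λ v∈ → State.respects st₂ (done₂ (∈-allFin _) v∈) }
          , State.unchanged st₂

    -- Induction along the hypertree. The vertices of the new edge E that already have a colour all
    -- lie in one earlier edge F, so they have distinct colours and respect `p`; the remaining
    -- vertices of E can be completed freely without touching older edges.
    colouring : ∀ {L} → IsHypertree L → (∀ {E} → E ∈ L → ∣ E ∣ ≡ k) → (∀ {E} → E ∈ L → PrescribedOn E) →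
      ∃[ χ ] (∀ {E} → E ∈ L → RainbowOn χ E)
    colouring (single E) size pre =
      let χ , rb , _ = Completion.complete E (≤-reflexive (size (here refl))) (pre (here refl)) (λ _ → zero) ⊥ record
            { A⊆E = ⊥-elim ∘ ∉⊥ ; A₀⊆A = id ; injective = λ u∈ → ⊥-elim (∉⊥ u∈)
            ; respects = λ u∈ → ⊥-elim (∉⊥ u∈) ; converse = λ u∈ → ⊥-elim (∉⊥ u∈) ; unchanged = λ _ → refl }
      in χ , λ { (here refl) → rb }
    colouring (step L L′ E perm tree (F , F∈ , meet)) size pre
      with χ₀ , rb₀ ← colouring tree (size ∘ ∈-resp-↭ (↭-sym perm) ∘ there) (pre ∘ ∈-resp-↭ (↭-sym perm) ∘ there) = result
      where
      E∈ : E ∈ L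
      E∈ = ∈-resp-↭ (↭-sym perm) (here refl)
      open Completion E (≤-reflexive (size E∈)) (pre E∈) χ₀ (E ∩ F)
      inF : ∀ {v} → v ∈ˢ E ∩ F → v ∈ˢ F
      inF = p∩q⊆q E F
      result : ∃[ χ ] (∀ {E} → E ∈ L → RainbowOn χ E)
      result with χ , rb , same ← complete record
                    { A⊆E = p∩q⊆p E F ; A₀⊆A = id
                    ; injective = λ u∈ v∈ → RainbowOn.injective (rb₀ F∈) (inF u∈) (inF v∈)
                    ; respects = λ v∈ → RainbowOn.respects (rb₀ F∈) (inF v∈)
                    ; converse = λ v∈ → rainbow-converse (pre (∈-resp-↭ (↭-sym perm) (there F∈))) (rb₀ F∈) (inF v∈)
                    ; unchanged = λ _ → refl } = χ , extended
        where
        extended : ∀ {E′} → E′ ∈ L → RainbowOn χ E′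
        extended {E′} E′∈ with ∈-resp-↭ perm E′∈
        ... | here refl  = rb
        ... | there E′∈′ = record
          { injective = λ u∈ v∈ eq → RainbowOn.injective (rb₀ E′∈′) u∈ v∈ (trans (sym (old u∈)) (trans eq (old v∈)))
          ; respects = λ v∈ e → trans (old v∈) (RainbowOn.respects (rb₀ E′∈′) v∈ e) }
          where
          old : ∀ {v} → v ∈ˢ E′ → χ v ≡ χ₀ v
          old {v} v∈ with v ∈? E
          ... | no v∉ = same (inj₂ v∉)
          ... | yes v∈E = same (inj₁ (subst (v ∈ˢ_) meet (x∈p∩q⁺ (v∈E , ∈-V⁺ E′∈′ v∈))))

  -- Greedy embedding

  ∣p∪q∣+∣p∩q∣ : {s : ℕ} (p q : Subset s) → ∣ p ∪ q ∣ + ∣ p ∩ q ∣ ≡ ∣ p ∣ + ∣ q ∣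
  ∣p∪q∣+∣p∩q∣ [] [] = refl
  ∣p∪q∣+∣p∩q∣ (inside ∷ p)  (inside ∷ q)  =
    cong suc (trans (+-suc _ _) (trans (cong suc (∣p∪q∣+∣p∩q∣ p q)) (sym (+-suc _ _))))
  ∣p∪q∣+∣p∩q∣ (inside ∷ p)  (outside ∷ q) = cong suc (∣p∪q∣+∣p∩q∣ p q)
  ∣p∪q∣+∣p∩q∣ (outside ∷ p) (inside ∷ q)  = trans (cong suc (∣p∪q∣+∣p∩q∣ p q)) (sym (+-suc _ _))
  ∣p∪q∣+∣p∩q∣ (outside ∷ p) (outside ∷ q) = ∣p∪q∣+∣p∩q∣ p q

  -- The induction step of the embedding count. Here nʲ stands for n^|E ∩ V(L)|; the first
  -- hypothesis is inclusion and exclusion in the exponents, and nʲ cancels against the loss caused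
  -- by the vertices of E that are already placed.
  growth-arithmetic : ∀ X Xˡ nᵛ′ nʲ nᵛ nᵏ Φ Kˡ nᵏˡ K Ψ .{{_ : NonZero nʲ}} → nᵛ′ * nʲ ≡ nᵏ * nᵛ →
    Xˡ * nᵛ ≤ Φ * Kˡ * nᵏˡ → X * Φ ≤ K * nʲ * Ψ → X * Xˡ * nᵛ′ ≤ Ψ * (K * Kˡ) * (nᵏ * nᵏˡ)
  growth-arithmetic X Xˡ nᵛ′ nʲ nᵛ nᵏ Φ Kˡ nᵏˡ K Ψ eq h₁ h₂ = *-cancelʳ-≤ _ _ nʲ (begin
    X * Xˡ * nᵛ′ * nʲ              ≡⟨ *-assoc (X * Xˡ) nᵛ′ nʲ ⟩
    X * Xˡ * (nᵛ′ * nʲ)            ≡⟨ cong (X * Xˡ *_) eq ⟩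
    X * Xˡ * (nᵏ * nᵛ)             ≡⟨ e₁ X Xˡ nᵏ nᵛ ⟩
    X * nᵏ * (Xˡ * nᵛ)             ≤⟨ *-monoʳ-≤ (X * nᵏ) h₁ ⟩
    X * nᵏ * (Φ * Kˡ * nᵏˡ)        ≡⟨ e₂ X nᵏ Φ Kˡ nᵏˡ ⟩
    X * Φ * (Kˡ * (nᵏ * nᵏˡ))      ≤⟨ *-monoˡ-≤ (Kˡ * (nᵏ * nᵏˡ)) h₂ ⟩
    K * nʲ * Ψ * (Kˡ * (nᵏ * nᵏˡ)) ≡⟨ e₃ K nʲ Ψ Kˡ (nᵏ * nᵏˡ) ⟩
    Ψ * (K * Kˡ) * (nᵏ * nᵏˡ) * nʲ ∎)
    where
    open ≤-Reasoning
    e₁ : ∀ a b c d → a * b * (c * d) ≡ a * c * (b * d)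
    e₁ = solve-∀
    e₂ : ∀ a b c d e → a * b * (c * d * e) ≡ a * c * (d * (b * e))
    e₂ = solve-∀
    e₃ : ∀ a b c d e → a * b * c * (d * e) ≡ c * (a * d) * e * b
    e₃ = solve-∀

  -- All that the greedy embedding has to know about a core. `Place E e` allows the tuple e to serve
  -- as the edge E, the vertex of colour c going to entry c. Admissible tuples may depend on the
  -- edge, as they do with centres, and `transfer` changes the edge without moving common vertices.
  -- The list U has length s because it will hold all entries of a partial embedding.
  record Placements {s k : ℕ} (n : ℕ) (H : List (Subset s)) (χ : Fin s → Fin k) (X K : ℕ) : Set₁ where
    field
      Place     : Subset s → Vec (Fin n) k → Set
      distinct  : ∀ {E e} → E ∈ H → Place E e → Distinct e
      inhabited : ∀ {E} → E ∈ H → ∃[ e ] Place E e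
      transfer  : ∀ {E F f} → E ∈ H → F ∈ H → ¬ E ≡ F → Place F f →
                  ∃[ e ] (Place E e × (∀ {v} → v ∈ˢ E → v ∈ˢ F → lookup f (χ v) ≡ lookup e (χ v)))
      -- Private colours are those of degree-one vertices; the other two fields say how a newly placed vertex
      -- differs from the earlier ones: by explicit avoidance for the Avoiding colours, by separation otherwise.
      Private   : Fin k → Set
      private-≡ : ∀ {E F v} → E ∈ H → F ∈ H → v ∈ˢ E → v ∈ˢ F → Private (χ v) → E ≡ F
      Avoiding  : Fin k → Set
      avoiding? : Decidable Avoiding
      separated : ∀ {E F e f v w} → E ∈ H → F ∈ H → Place E e → Place F f → v ∈ˢ E → w ∈ˢ F → ¬ v ≡ w →
                  ¬ Avoiding (χ v) → ¬ lookup e (χ v) ≡ lookup f (χ w)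
      extend    : ∀ {E e} → E ∈ H → Place E e → (P : Subset k) → (∀ {c} → c ∈ˢ P → ¬ Private c) →
                  (U : List (Fin n)) → length U ≡ s →
                  ∃[ es ] (Unique es ×
                           All (λ e′ → Place E e′ × (∀ {c} → c ∈ˢ P → lookup e′ c ≡ lookup e c) ×
                                       (∀ {c} → c ∉ˢ P → Avoiding c → lookup e′ c ∉ U)) es ×
                           X ≤ K * n ^ ∣ P ∣ * length es)

  module Embedding {s k n X K : ℕ} {H : List (Subset s)} {χ : Fin s → Fin k}
    (rainbow : ∀ {E} → E ∈ H → InjectiveOn E χ) (size : ∀ {E} → E ∈ H → ∣ E ∣ ≡ k)
    (placements : Placements n H χ X K) (default : Fin n) where

    open Placements placements

    -- The field `off` fixes the entries of vertices not yet placed, so that different vectors are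
    -- different embeddings of L and restriction recovers the earlier vector exactly.
    record Partial (L : List (Subset s)) (φ : Vec (Fin n) s) : Set where
      field
        off       : ∀ {v} → v ∉ˢ V L → lookup φ v ≡ default
        injective : InjectiveOn (V L) (lookup φ)
        placed    : ∀ {E} → E ∈ L → ∃[ e ] (Place E e × (∀ {v} → v ∈ˢ E → lookup φ v ≡ lookup e (χ v)))

    restrict : List (Subset s) → Vec (Fin n) s → Vec (Fin n) s
    restrict L ψ = tabulate (λ v → ifDec (v ∈? V L) (lookup ψ v) default)

    glue : List (Subset s) → Subset s → Vec (Fin n) s → Vec (Fin n) k → Vec (Fin n) s
    glue L E φ e = tabulate (λ v → ifDec (v ∈? V L) (lookup φ v) (ifDec (v ∈? E) (lookup e (χ v)) default))

    module Step (L : List (Subset s)) (E : Subset s) (L⊆H : ∀ {F} → F ∈ L → F ∈ H) (E∈H : E ∈ H) (E∉L : E ∉ L)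
      (anchor : ∀ {φ} → Partial L φ →
         ∃[ e ] (Place E e × (∀ {v} → v ∈ˢ E → v ∈ˢ V L → lookup φ v ≡ lookup e (χ v)))) where

      P : Subset k
      P = image χ (E ∩ V L)

      -- A vertex of E with a private colour lies in no other edge, so it cannot have been placed
      -- before E.
      P-public : ∀ {c} → c ∈ˢ P → ¬ Private c
      P-public c∈ pr
        with v , v∈ , refl ← ∈-image⁻ χ (E ∩ V L) c∈
        with v∈E , v∈V ← x∈p∩q⁻ E (V L) v∈
        with F , F∈ , v∈F ← ∈-V⁻ L v∈V = E∉L (subst (_∈ L) (sym (private-≡ E∈H (L⊆H F∈) v∈E v∈F pr)) F∈)

      module _ {φ : Vec (Fin n) s} (part : Partial L φ) (e : Vec (Fin n) k) (e∈ : Place E e)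
        (agree : ∀ {v} → v ∈ˢ E → v ∈ˢ V L → lookup φ v ≡ lookup e (χ v))
        (avoid : ∀ {c} → c ∉ˢ P → Avoiding c → lookup e c ∉ Vec.toList φ) where

        open Partial part

        glue-old : ∀ {v} → v ∈ˢ V L → lookup (glue L E φ e) v ≡ lookup φ v
        glue-old {v} v∈ = trans (lookup∘tabulate _ v) (ifDec-yes (v ∈? V L) v∈)

        glue-E : ∀ {v} → v ∈ˢ E → lookup (glue L E φ e) v ≡ lookup e (χ v)
        glue-E {v} v∈ with v ∈? V L
        ... | yes q = trans (glue-old q) (agree v∈ q)
        ... | no ¬q = trans (lookup∘tabulate _ v) (trans (ifDec-no (v ∈? V L) ¬q) (ifDec-yes (v ∈? E) v∈))

        glue-off : ∀ {v} → v ∉ˢ V (E ∷ L) → lookup (glue L E φ e) v ≡ default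
        glue-off {v} v∉ = trans (lookup∘tabulate _ v)
          (trans (ifDec-no (v ∈? V L) (v∉ ∘ q⊆p∪q E (V L))) (ifDec-no (v ∈? E) (v∉ ∘ p⊆p∪q (V L))))

        glue-fresh : ∀ {v w} → v ∈ˢ E → v ∉ˢ V L → w ∈ˢ V L → ¬ lookup e (χ v) ≡ lookup φ w
        glue-fresh {v} {w} v∈E v∉V w∈V eq with avoiding? (χ v)
        ... | yes av = avoid χv∉P av (subst (_∈ Vec.toList φ) (sym eq) (∈-toList φ w))
          where
          -- A placed vertex of E with the colour of v would be v, since E is rainbow.
          χv∉P : χ v ∉ˢ P
          χv∉P c∈ with u , u∈ , eq′ ← ∈-image⁻ χ (E ∩ V L) c∈ with u∈E , u∈V ← x∈p∩q⁻ E (V L) u∈ =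
            v∉V (subst (_∈ˢ V L) (rainbow E∈H u∈E v∈E eq′) u∈V)
        ... | no ¬av
          with F , F∈ , w∈F ← ∈-V⁻ L w∈V
          with f , f∈ , φ≡f ← placed F∈ =
          separated E∈H (L⊆H F∈) e∈ f∈ v∈E w∈F (λ { refl → v∉V w∈V }) ¬av (trans eq (φ≡f w∈F))

        glue-partial : Partial (E ∷ L) (glue L E φ e)
        glue-partial = record { off = glue-off ; injective = inj ; placed = pl }
          where
          split : ∀ {v} → v ∈ˢ V (E ∷ L) → v ∈ˢ V L ⊎ (v ∈ˢ E × v ∉ˢ V L)
          split {v} v∈ with v ∈? V L
          ... | yes q = inj₁ q
          ... | no ¬q with x∈p∪q⁻ E (V L) v∈
          ...   | inj₁ r = inj₂ (r , ¬q)
          ...   | inj₂ r = ⊥-elim (¬q r)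
          inj : InjectiveOn (V (E ∷ L)) (lookup (glue L E φ e))
          inj {u} {v} u∈ v∈ eq with split u∈ | split v∈
          ... | inj₁ p | inj₁ q = injective p q (trans (sym (glue-old p)) (trans eq (glue-old q)))
          ... | inj₁ p | inj₂ (q , q′) = ⊥-elim (glue-fresh q q′ p (trans (sym (glue-E q)) (trans (sym eq) (glue-old p))))
          ... | inj₂ (p , p′) | inj₁ q = ⊥-elim (glue-fresh p p′ q (trans (sym (glue-E p)) (trans eq (glue-old q))))
          ... | inj₂ (p , _) | inj₂ (q , _) =
            rainbow E∈H p q (distinct E∈H e∈ (trans (sym (glue-E p)) (trans eq (glue-E q))))
          pl : ∀ {F} → F ∈ E ∷ L → ∃[ f ] (Place F f × (∀ {v} → v ∈ˢ F → lookup (glue L E φ e) v ≡ lookup f (χ v)))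
          pl (here refl) = e , e∈ , glue-E
          pl (there F∈) with f , f∈ , eq ← placed F∈ = f , f∈ , λ v∈ → trans (glue-old (∈-V⁺ F∈ v∈)) (eq v∈)

        restrict-glue : restrict L (glue L E φ e) ≡ φ
        restrict-glue = vec-ext same
          where
          same : ∀ v → lookup (restrict L (glue L E φ e)) v ≡ lookup φ v
          same v with v ∈? V L
          ... | yes q = trans (lookup∘tabulate _ v) (trans (ifDec-yes (v ∈? V L) q) (glue-old q))
          ... | no ¬q = trans (lookup∘tabulate _ v) (trans (ifDec-no (v ∈? V L) ¬q) (sym (off ¬q)))

      extensions : ∀ φ → Partial L φ →
        ∃[ ψs ] (Unique ψs × All (λ ψ → Partial (E ∷ L) ψ × restrict L ψ ≡ φ) ψs × X ≤ K * n ^ ∣ E ∩ V L ∣ * length ψs)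
      extensions φ part
        with e₀ , e₀∈ , agree₀ ← anchor part
        with es , u , good , bound ← extend E∈H e₀∈ P P-public (Vec.toList φ) (Vecₚ.length-toList φ) =
        map (glue L E φ) es
        , Unique-map-on (glue L E φ) glue-inj u
        , Allₚ.map⁺ (All.map (λ { {e} (e∈ , eq , av) → glue-partial part e e∈ (agree e eq) av , restrict-glue part e e∈ (agree e eq) av }) good)
        , ≤-trans bound (*-mono-≤ (*-monoʳ-≤ K (^-monoʳ-≤ n {{Finₚ.nonZeroIndex default}} (∣image∣≤ χ (E ∩ V L))))
                                 (≤-reflexive (sym (length-map (glue L E φ) es))))
        where
        agree : ∀ e → (∀ {c} → c ∈ˢ P → lookup e c ≡ lookup e₀ c) → ∀ {v} → v ∈ˢ E → v ∈ˢ V L → lookup φ v ≡ lookup e (χ v)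
        agree e eq v∈E v∈V = trans (agree₀ v∈E v∈V) (sym (eq (∈-image⁺ χ (x∈p∩q⁺ (v∈E , v∈V)))))
        glue-inj : ∀ {e e′} → e ∈ es → e′ ∈ es → glue L E φ e ≡ glue L E φ e′ → e ≡ e′
        glue-inj {e} {e′} p p′ eq = vec-ext same
          where
          same : ∀ c → lookup e c ≡ lookup e′ c
          same c with v , v∈ , refl ← injectiveOn⇒surjective χ E (size E∈H) (rainbow E∈H) c
                 with e∈ , h , av ← All.lookup good p | e′∈ , h′ , av′ ← All.lookup good p′ =
            trans (sym (glue-E part e e∈ (agree e h) av v∈))
                  (trans (cong (λ w → lookup w v) eq) (glue-E part e′ e′∈ (agree e′ h′) av′ v∈))

      grow : (Φ : List (Vec (Fin n) s)) → Unique Φ → All (Partial L) Φ →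
        X ^ length L * n ^ ∣ V L ∣ ≤ length Φ * K ^ length L * n ^ (k * length L) →
        ∃[ Ψ ] (Unique Ψ × All (Partial (E ∷ L)) Ψ ×
                X ^ length (E ∷ L) * n ^ ∣ V (E ∷ L) ∣ ≤ length Ψ * K ^ length (E ∷ L) * n ^ (k * length (E ∷ L)))
      grow Φ u good bound
        with Ψ , u′ , good′ , bound′ ← Unique-bind (restrict L) X (K * n ^ ∣ E ∩ V L ∣) extensions Φ u good =
        Ψ , u′ , All.map proj₁ good′
        , subst (λ z → _ ≤ length Ψ * K ^ suc (length L) * z) (sym nᵏ)
            (growth-arithmetic X (X ^ length L) _ (n ^ ∣ E ∩ V L ∣) (n ^ ∣ V L ∣) (n ^ k) (length Φ)
              (K ^ length L) (n ^ (k * length L)) K (length Ψ) {{m^n≢0 n ∣ E ∩ V L ∣ {{Finₚ.nonZeroIndex default}}}} nᵛ bound bound′)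
        where
        nᵏ : n ^ (k * suc (length L)) ≡ n ^ k * n ^ (k * length L)
        nᵏ = trans (cong (n ^_) (*-suc k (length L))) (^-distribˡ-+-* n k (k * length L))
        nᵛ : n ^ ∣ V (E ∷ L) ∣ * n ^ ∣ E ∩ V L ∣ ≡ n ^ k * n ^ ∣ V L ∣
        nᵛ = trans (sym (^-distribˡ-+-* n ∣ V (E ∷ L) ∣ ∣ E ∩ V L ∣))
                   (trans (cong (n ^_) (trans (∣p∪q∣+∣p∩q∣ E (V L)) (cong (_+ ∣ V L ∣) (size E∈H))))
                          (^-distribˡ-+-* n k ∣ V L ∣))

    -- With denominators cleared, the number of embeddings is at least (X / (K n^k))^|L| n^|V(L)|:
    -- up to the constant, what a random family of X tuples would give.
    Embeddings : List (Subset s) → Set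
    Embeddings L = ∃[ Φ ] (Unique Φ × All (Partial L) Φ ×
      X ^ length L * n ^ ∣ V L ∣ ≤ length Φ * K ^ length L * n ^ (k * length L))

    Embeddings-resp-↭ : ∀ {L L′} → L ↭ L′ → Embeddings L → Embeddings L′
    Embeddings-resp-↭ {L} {L′} perm (Φ , u , good , bound) =
      Φ , u , All.map (λ part → let open Partial part in record
        { off = λ v∉ → off (v∉ ∘ to)
        ; injective = λ p q → injective (from p) (from q)
        ; placed = λ E∈ → placed (∈-resp-↭ (↭-sym perm) E∈) }) good
      , subst₂ (λ a b → X ^ a * n ^ b ≤ length Φ * K ^ a * n ^ (k * a)) (↭-length perm) (cong ∣_∣ (⊆-antisym to from)) bound
      where
      to : ∀ {v} → v ∈ˢ V L → v ∈ˢ V L′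
      to v∈ with F , F∈ , q ← ∈-V⁻ L v∈ = ∈-V⁺ (∈-resp-↭ perm F∈) q
      from : ∀ {v} → v ∈ˢ V L′ → v ∈ˢ V L
      from v∈ with F , F∈ , q ← ∈-V⁻ L′ v∈ = ∈-V⁺ (∈-resp-↭ (↭-sym perm) F∈) q

    embeddings : ∀ {L} → IsHypertree L → (∀ {E} → E ∈ L → E ∈ H) → Unique L → Embeddings L
    embeddings (single E) L⊆H _ =
      Step.grow [] E (λ ()) (L⊆H (here refl)) (λ ())
        (λ _ → let e , e∈ = inhabited (L⊆H (here refl)) in e , e∈ , λ _ v∈ → ⊥-elim (∉⊥ v∈))
        (φ₀ ∷ []) ([] ∷ [])
        (record { off = λ {v} _ → Vecₚ.lookup-replicate v default ; injective = λ p → ⊥-elim (∉⊥ p) ; placed = λ () } ∷ [])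
        (≤-reflexive (cong (λ a → 1 * n ^ a) (trans (∣⊥∣≡0 s) (sym (*-zeroʳ k)))))
      where
      φ₀ : Vec (Fin n) s
      φ₀ = Vec.replicate s default
    embeddings (step L L′ E perm tree (F , F∈ , meet)) L⊆H u
      with Φ , uΦ , good , bound ← embeddings tree (L⊆H ∘ ∈-resp-↭ (↭-sym perm) ∘ there)
             (AllPairs.tail (Permₚ.Unique-resp-↭ (setoid _) (↭⇒↭ₛ perm) u)) =
      Embeddings-resp-↭ (↭-sym perm)
        (Step.grow L′ E L′⊆H (L⊆H E∈) E∉ anchor Φ uΦ good bound)
      where
      E∈ : E ∈ L
      E∈ = ∈-resp-↭ (↭-sym perm) (here refl)
      L′⊆H : ∀ {F} → F ∈ L′ → F ∈ H
      L′⊆H = L⊆H ∘ ∈-resp-↭ (↭-sym perm) ∘ there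
      E∉ : E ∉ L′
      E∉ = Uniqueₚ.Unique[x∷xs]⇒x∉xs (Permₚ.Unique-resp-↭ (setoid _) (↭⇒↭ₛ perm) u)
      anchor : ∀ {φ} → Partial L′ φ → ∃[ e ] (Place E e × (∀ {v} → v ∈ˢ E → v ∈ˢ V L′ → lookup φ v ≡ lookup e (χ v)))
      anchor part
        with f , f∈ , φ≡f ← Partial.placed part F∈
        with e , e∈ , f≡e ← transfer (L⊆H E∈) (L′⊆H F∈) (λ { refl → E∉ F∈ }) f∈ =
        -- By the hypertree condition the placed vertices of E all lie in F, so agreement with f is
        -- agreement with φ.
        e , e∈ , λ v∈E v∈V → let v∈F = p∩q⊆q E F (subst (_ ∈ˢ_) meet (x∈p∩q⁺ (v∈E , v∈V)))
                             in trans (φ≡f v∈F) (f≡e v∈E v∈F)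

  -- Embeddings are grouped by their vertex sets, at most s^s to a group, and one is kept from each.
  -- Every vertex of H lies in an edge, so the edges of a copy determine its vertex set and the kept
  -- copies have different edge sets.
  copies-of-embeddings : {s n : ℕ} (H : List (Subset s)) (F : List (Subset n)) →
    (∀ (v : Fin s) → ∃[ E ] (E ∈ H × v ∈ˢ E)) → (Φ : List (Vec (Fin n) s)) → Unique Φ →
    All (λ φ → Distinct φ × (∀ {E} → E ∈ H → image (lookup φ) E ∈ F)) Φ →
    ∃[ Cs ] (CopiesList H F Cs × length Φ ≤ s ^ s * length Cs)
  copies-of-embeddings {s} {n} H F covering Φ u good
    with Ψ , Ψ⊆Φ , ap , cov ← Fibres.representatives (Vecₚ.≡-dec Boolₚ._≟_) (λ φ → image (lookup φ) ⊤) Φ =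
    map copy Ψ
    , (Allₚ.map⁺ (All.tabulate (λ {φ} φ∈ → isCopy φ (All.lookup good (Ψ⊆Φ φ∈)))) , AllPairsₚ.map⁺ (AllPairs.map (λ {φ} {ψ} → differ φ ψ) ap))
    , (begin
        length Φ                         ≤⟨ length≤-by-fibres vertices Φ (map vertices Ψ) (s ^ s) cov fibre-bound ⟩
        s ^ s * length (map vertices Ψ)  ≡⟨ cong (s ^ s *_) (trans (length-map vertices Ψ) (sym (length-map copy Ψ))) ⟩
        s ^ s * length (map copy Ψ)      ∎)
    where
    open ≤-Reasoning
    import Data.List.Relation.Unary.AllPairs.Properties as AllPairsₚ
    open Fibres (Vecₚ.≡-dec {n = n} Boolₚ._≟_)
    vertices : Vec (Fin n) s → Subset n
    vertices φ = image (lookup φ) ⊤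
    copy : Vec (Fin n) s → List (Subset n)
    copy φ = map (image (lookup φ)) H
    isCopy : ∀ φ → Distinct φ × (∀ {E} → E ∈ H → image (lookup φ) E ∈ F) → IsCopy H F (copy φ)
    isCopy φ (dist , inF) =
      Allₚ.map⁺ (All.tabulate inF) , lookup φ , dist , λ e → mk⇔ (to e) (from e)
      where
      to : ∀ e → e ∈ copy φ → ∃[ E ] (E ∈ H × IsImage (lookup φ) E e)
      to e e∈ with E , E∈ , refl ← ∈-map⁻ (image (lookup φ)) e∈ =
        E , E∈ , λ j → mk⇔ (∈-image⁻ (lookup φ) E) (λ { (v , v∈ , refl) → ∈-image⁺ (lookup φ) v∈ })
      from : ∀ e → ∃[ E ] (E ∈ H × IsImage (lookup φ) E e) → e ∈ copy φ
      from e (E , E∈ , im) = subst (_∈ copy φ) (⊆-antisym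
        (λ j∈ → let v , v∈ , eq = ∈-image⁻ (lookup φ) E j∈ in Equivalence.from (im _) (v , v∈ , eq))
        (λ {j} j∈ → let v , v∈ , eq = Equivalence.to (im j) j∈ in subst (_∈ˢ image (lookup φ) E) eq (∈-image⁺ (lookup φ) v∈)))
        (∈-map⁺ (image (lookup φ)) E∈)
    within : ∀ φ ψ → SameEdgeSet (copy φ) (copy ψ) → ∀ {j} → j ∈ˢ vertices φ → j ∈ˢ vertices ψ
    within φ ψ same j∈
      with v , _ , refl ← ∈-image⁻ (lookup φ) ⊤ j∈
      with E , E∈ , v∈E ← covering v
      with E′ , _ , eq ← ∈-map⁻ (image (lookup ψ)) (Equivalence.to (same _) (∈-map⁺ (image (lookup φ)) E∈))
      with w , _ , eq′ ← ∈-image⁻ (lookup ψ) E′ (subst (lookup φ v ∈ˢ_) eq (∈-image⁺ (lookup φ) v∈E))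
      = subst (_∈ˢ vertices ψ) eq′ (∈-image⁺ (lookup ψ) ∈⊤)
    differ : ∀ φ ψ → ¬ vertices φ ≡ vertices ψ → ¬ SameEdgeSet (copy φ) (copy ψ)
    differ φ ψ ne same = ne (⊆-antisym (within φ ψ same)
      (within ψ φ (λ e → mk⇔ (Equivalence.from (same e)) (Equivalence.to (same e)))))
    fibre-bound : ∀ {y} → y ∈ map vertices Ψ → length (fibre vertices y Φ) ≤ s ^ s
    fibre-bound y∈ with φ , _ , refl ← ∈-map⁻ vertices y∈ = begin
      length (fibre vertices (vertices φ) Φ)
        ≤⟨ length-unique-vecs-in (vertices φ) _ (Uniqueₚ.filter⁺ _ u)
             (λ {ψ} ψ∈ c → subst (lookup ψ c ∈ˢ_) (proj₂ (∈-fibre⁻ vertices Φ ψ∈)) (∈-image⁺ (lookup ψ) ∈⊤)) ⟩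
      ∣ vertices φ ∣ ^ s
        ≤⟨ ^-monoˡ-≤ s (≤-trans (∣image∣≤ (lookup φ) ⊤) (≤-reflexive (∣⊤∣≡n s))) ⟩
      s ^ s ∎

  -- The multiplicity bound of the theorem with denominators cleared: for |F| = a·C(n,k−1) and X = |F| it says
  -- that the number of copies is at least a constant times aᵗ nˢ⁻ᵗ.
  record Copies {s n : ℕ} (k X K : ℕ) (H : List (Subset s)) (F : List (Subset n)) : Set where
    constructor copies
    field
      list  : List (List (Subset n))
      valid : CopiesList H F list
      many  : X ^ length H * n ^ s ≤ K * length list * n ^ (k * length H)

  module _ {s k n X K : ℕ} {H : List (Subset s)} {χ : Fin s → Fin k} {F : List (Subset n)}
    (tree : IsKTree k s H) (rainbow : ∀ {E} → E ∈ H → InjectiveOn E χ) (default : Fin n) (pl : Placements n H χ X K)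
    (inF : ∀ {E e} → E ∈ H → Placements.Place pl E e → toSet e ∈ F) where

    open IsKTree tree
    open KGraphOn kgraph
    open Embedding rainbow (λ E∈ → All.lookup uniform E∈) pl default

    private
      ∈-V : ∀ v → v ∈ˢ V H
      ∈-V v with E , E∈ , v∈ ← covering v = ∈-V⁺ E∈ v∈

      image∈ : ∀ {φ} → Partial H φ → ∀ {E} → E ∈ H → image (lookup φ) E ∈ F
      image∈ {φ} part {E} E∈ with e , e∈ , eq ← Partial.placed part E∈ = subst (_∈ F) (⊆-antisym to from) (inF E∈ e∈)
        where
        to : ∀ {j} → j ∈ˢ toSet e → j ∈ˢ image (lookup φ) E
        to j∈ with c , refl ← ∈-toSet⁻ e j∈
              with v , v∈ , refl ← injectiveOn⇒surjective χ E (All.lookup uniform E∈) (rainbow E∈) c =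
          subst (_∈ˢ image (lookup φ) E) (eq v∈) (∈-image⁺ (lookup φ) v∈)
        from : ∀ {j} → j ∈ˢ image (lookup φ) E → j ∈ˢ toSet e
        from j∈ with v , v∈ , refl ← ∈-image⁻ (lookup φ) E j∈ = subst (_∈ˢ toSet e) (sym (eq v∈)) (∈-toSet⁺ e (χ v))

    copies-of-placements : Copies k X (s ^ s * K ^ length H) H F
    copies-of-placements
      with Φ , u , good , bound ← embeddings hypertree id distinct
      with Cs , valid , enough ← copies-of-embeddings H F covering Φ u
             (All.map (λ part → (λ {u} {v} → Partial.injective part (∈-V u) (∈-V v)) , λ {E} → image∈ part) good)
      = copies Cs valid (begin
        X ^ length H * n ^ s                                    ≡⟨ cong (λ a → X ^ length H * n ^ a) ∣V∣≡s ⟨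
        X ^ length H * n ^ ∣ V H ∣                              ≤⟨ bound ⟩
        length Φ * K ^ length H * n ^ (k * length H)            ≤⟨ *-monoˡ-≤ _ (*-monoˡ-≤ _ enough) ⟩
        s ^ s * length Cs * K ^ length H * n ^ (k * length H)   ≡⟨ cong (_* n ^ (k * length H)) (swap (s ^ s) (length Cs) (K ^ length H)) ⟩
        s ^ s * K ^ length H * length Cs * n ^ (k * length H)   ∎)
      where
      open ≤-Reasoning
      swap : ∀ a b c → a * b * c ≡ a * c * b
      swap = solve-∀
      ∣V∣≡s : ∣ V H ∣ ≡ s
      ∣V∣≡s = trans (cong ∣_∣ (⊆-antisym (λ _ → ∈⊤) (λ {v} _ → ∈-V v))) (∣⊤∣≡n s)

  -- Tuples avoiding a given set of vertices

  module Avoidance {n k′ : ℕ} (T : List (Vec (Fin n) (suc k′))) (uT : Unique T)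
    (P : Subset (suc k′)) (e₀ : Vec (Fin n) (suc k′)) (U : List (Fin n)) where

    private
      Tuple : Set
      Tuple = Vec (Fin n) (suc k′)

    _∈U? : (x : Fin n) → Dec (x ∈ U)
    x ∈U? = any? (x Finₚ.≟_) U

    agreeing : List Tuple
    agreeing = filter (λ e → Vecₚ.≡-dec Finₚ._≟_ (proj P e) (proj P e₀)) T

    avoiding : List (Fin (suc k′)) → List Tuple
    avoiding []       = agreeing
    avoiding (c ∷ cs) = filter (λ e → ¬? (lookup e c ∈U?)) (avoiding cs)

    hitting : Fin (suc k′) → List (Fin (suc k′)) → List Tuple
    hitting c cs = filter (λ e → lookup e c ∈U?) (avoiding cs)

    Unique-avoiding : ∀ cs → Unique (avoiding cs)
    Unique-avoiding []       = Uniqueₚ.filter⁺ _ uT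
    Unique-avoiding (c ∷ cs) = Uniqueₚ.filter⁺ _ (Unique-avoiding cs)

    ∈-agreeing⁻ : ∀ {e} → e ∈ agreeing → e ∈ T × proj P e ≡ proj P e₀
    ∈-agreeing⁻ = ∈-filter⁻ (λ e → Vecₚ.≡-dec Finₚ._≟_ (proj P e) (proj P e₀))

    ∈-avoiding⁻ : ∀ cs {e} → e ∈ avoiding cs → e ∈ agreeing × (∀ {c} → c ∈ cs → lookup e c ∉ U)
    ∈-avoiding⁻ []       e∈ = e∈ , λ ()
    ∈-avoiding⁻ (c ∷ cs) {e} e∈
      with e∈′ , ∉c ← ∈-filter⁻ (λ e → ¬? (lookup e c ∈U?)) {xs = avoiding cs} e∈
      with q , r ← ∈-avoiding⁻ cs e∈′ = q , λ { (here refl) → ∉c ; (there c∈) → r c∈ }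

    ∈-avoiding⁺ : ∀ cs {e} → e ∈ agreeing → (∀ {c} → c ∈ cs → lookup e c ∉ U) → e ∈ avoiding cs
    ∈-avoiding⁺ []       e∈ _ = e∈
    ∈-avoiding⁺ (c ∷ cs) e∈ h = ∈-filter⁺ _ (∈-avoiding⁺ cs e∈ (h ∘ there)) (h (here refl))

    hitting+avoiding : ∀ c cs → length (avoiding cs) ≡ length (hitting c cs) + length (avoiding (c ∷ cs))
    hitting+avoiding c cs = length-filter-split (λ e → lookup e c ∈U?) (avoiding cs)

    open Fibres (Vecₚ.≡-dec {n = k′} (Finₚ._≟_ {n}))

    along : Fin (suc k′) → Tuple → List Tuple
    along c e = fibre (λ e → removeAt e c) (removeAt e c) T

    private
      length≤∣U∣ : ∀ c r (D : List Tuple) → Unique D → (∀ {e} → e ∈ D → removeAt e c ≡ r × lookup e c ∈ U) → length D ≤ length U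
      length≤∣U∣ c r D u h = length≤-of-injection (λ e → lookup e c) u
        (λ {e} {e′} p p′ eq → removeAt-lookup-≡⇒ e e′ c (trans (proj₁ (h p)) (sym (proj₁ (h p′)))) eq) (proj₂ ∘ h)

      -- Tuples that agree away from c are told apart by entry c, so at most |U| of them have that
      -- entry in U.
      escape : ∀ c e → length U < length (along c e) → ∃[ e′ ] (e′ ∈ T × removeAt e′ c ≡ removeAt e c × lookup e′ c ∉ U)
      escape c e heavy with any? (λ e′ → ¬? (lookup e′ c ∈U?)) (along c e)
      ... | yes p with e′ , e′∈ , ∉U ← find p with q , r ← ∈-fibre⁻ (λ e → removeAt e c) T e′∈ = e′ , q , r , ∉U
      ... | no ¬p = ⊥-elim (<⇒≱ heavy (length≤∣U∣ c (removeAt e c) (along c e) (Uniqueₚ.filter⁺ _ uT) inside-U))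
        where
        inside-U : ∀ {e′} → e′ ∈ along c e → removeAt e′ c ≡ removeAt e c × lookup e′ c ∈ U
        inside-U {e′} e′∈ = proj₂ (∈-fibre⁻ (λ e → removeAt e c) T e′∈)
                          , decidable-stable (lookup e′ c ∈U?) (λ ∉U → ¬p (lose e′∈ ∉U))

    -- If every coordinate in cs can be changed in more than |U| ways, then moving the coordinates that lie in U
    -- out of U, one at a time, is at most (|U|+1)-to-one.
    avoiding-by-replacement : ∀ cs → (∀ {c} → c ∈ cs → c ∉ˢ P) →
      (∀ {c e} → c ∈ cs → e ∈ T → length U < length (along c e)) →
      length agreeing ≤ suc (length U) ^ length cs * length (avoiding cs)
    avoiding-by-replacement [] _ _ = ≤-reflexive (sym (*-identityˡ _))
    avoiding-by-replacement (c ∷ cs) free heavy = begin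
      length agreeing
        ≤⟨ avoiding-by-replacement cs (free ∘ there) (heavy ∘ there) ⟩
      m ^ length cs * length (avoiding cs)
        ≡⟨ cong (m ^ length cs *_) (hitting+avoiding c cs) ⟩
      m ^ length cs * (length (hitting c cs) + length (avoiding (c ∷ cs)))
        ≤⟨ *-monoʳ-≤ (m ^ length cs) (+-monoˡ-≤ _ few) ⟩
      m ^ length cs * (length U * length (avoiding (c ∷ cs)) + length (avoiding (c ∷ cs)))
        ≡⟨ regroup (m ^ length cs) (length U) (length (avoiding (c ∷ cs))) ⟩
      m * m ^ length cs * length (avoiding (c ∷ cs)) ∎
      where
      open ≤-Reasoning
      m = suc (length U)
      regroup : ∀ a b x → a * (b * x + x) ≡ suc b * a * x
      regroup = solve-∀
      key : Tuple → Vec (Fin n) k′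
      key e = removeAt e c
      hit⁻ : ∀ {e} → e ∈ hitting c cs → e ∈ avoiding cs × lookup e c ∈ U
      hit⁻ = ∈-filter⁻ (λ e → lookup e c ∈U?)
      moved : ∀ {e} → e ∈ hitting c cs → key e ∈ map key (avoiding (c ∷ cs))
      moved {e} e∈
        with e∈ag , av ← ∈-avoiding⁻ cs (proj₁ (hit⁻ e∈))
        with e∈T , agr ← ∈-agreeing⁻ e∈ag
        with e′ , e′∈ , eq , ∉U ← escape c e (heavy (here refl) e∈T) =
        subst (_∈ map key (avoiding (c ∷ cs))) eq (∈-map⁺ key (∈-avoiding⁺ (c ∷ cs)
          (∈-filter⁺ _ e′∈ (trans (⇒proj-≡ P e′ e (λ d∈ → removeAt-≡⇒ e′ e eq (λ { refl → free (here refl) d∈ }))) agr))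
          (λ { (here refl) → ∉U ; (there d∈) → avoid′ d∈ })))
        where
        avoid′ : ∀ {d} → d ∈ cs → lookup e′ d ∉ U
        avoid′ {d} d∈ with c Finₚ.≟ d
        ... | yes refl = ∉U
        ... | no ne = subst (_∉ U) (sym (removeAt-≡⇒ e′ e eq ne)) (av d∈)
      few : length (hitting c cs) ≤ length U * length (avoiding (c ∷ cs))
      few = subst (λ l → length (hitting c cs) ≤ length U * l) (length-map key (avoiding (c ∷ cs)))
        (length≤-by-fibres key (hitting c cs) (map key (avoiding (c ∷ cs))) (length U) moved
          (λ {r} _ → length≤∣U∣ c r _ (Uniqueₚ.filter⁺ _ (Uniqueₚ.filter⁺ _ (Unique-avoiding cs)))
            (λ e∈ → let q , eq = ∈-fibre⁻ key (hitting c cs) e∈ in eq , proj₂ (hit⁻ q))))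

    -- A union bound: each position of cs and each vertex of U spoil at most b tuples. It replaces
    -- the moving argument when a position may have only boundedly many alternatives.
    avoiding-by-subtraction : (b : ℕ) → ∀ cs →
      (∀ {c u} → c ∈ cs → length (filter (λ e → lookup e c Finₚ.≟ u) agreeing) ≤ b) →
      length agreeing ≤ length (avoiding cs) + length cs * (b * length U)
    avoiding-by-subtraction b [] _ = ≤-reflexive (sym (+-identityʳ _))
    avoiding-by-subtraction b (c ∷ cs) few = begin
      length agreeing
        ≤⟨ avoiding-by-subtraction b cs (few ∘ there) ⟩
      length (avoiding cs) + length cs * (b * length U)
        ≡⟨ cong (_+ length cs * (b * length U)) (hitting+avoiding c cs) ⟩
      length (hitting c cs) + length (avoiding (c ∷ cs)) + length cs * (b * length U)
        ≤⟨ +-monoˡ-≤ _ (+-monoˡ-≤ _ hits) ⟩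
      b * length U + length (avoiding (c ∷ cs)) + length cs * (b * length U)
        ≡⟨ regroup (b * length U) (length (avoiding (c ∷ cs))) (length cs * (b * length U)) ⟩
      length (avoiding (c ∷ cs)) + (b * length U + length cs * (b * length U)) ∎
      where
      open ≤-Reasoning
      regroup : ∀ x y z → x + y + z ≡ y + (x + z)
      regroup = solve-∀
      hits : length (hitting c cs) ≤ b * length U
      hits = Fibres.length≤-by-fibres Finₚ._≟_ (λ e → lookup e c) (hitting c cs) U b
        (λ e∈ → proj₂ (∈-filter⁻ (λ e → lookup e c ∈U?) {xs = avoiding cs} e∈))
        (λ {u} _ → ≤-trans (length≤-of-⊆ (Uniqueₚ.filter⁺ _ (Uniqueₚ.filter⁺ _ (Unique-avoiding cs)))
          (λ e∈ → let p , eq = ∈-filter⁻ (λ e → lookup e c Finₚ.≟ u) {xs = hitting c cs} e∈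
                      q , _  = ∈-filter⁻ (λ e → lookup e c ∈U?) {xs = avoiding cs} p
                  in ∈-filter⁺ (λ e → lookup e c Finₚ.≟ u) (proj₁ (∈-avoiding⁻ cs q)) eq)) (few (here refl)))

    module _ {Av : Fin (suc k′) → Set} (Av? : Decidable Av) where

      private
        free? : Decidable (λ c → c ∉ˢ P × Av c)
        free? c = ¬? (c ∈? P) ×-dec Av? c

      free : List (Fin (suc k′))
      free = filter free? (allFin (suc k′))

      length-free : length free ≤ suc k′
      length-free = ≤-trans (length-filter free? (allFin (suc k′))) (≤-reflexive (length-tabulate {n = suc k′} id))

      ∈-free⁺ : ∀ {c} → c ∉ˢ P → Av c → c ∈ free
      ∈-free⁺ c∉ av = ∈-filter⁺ free? (∈-allFin _) (c∉ , av)

      ∈-free⁻ : ∀ {c} → c ∈ free → c ∉ˢ P × Av c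
      ∈-free⁻ c∈ = proj₂ (∈-filter⁻ free? {xs = allFin (suc k′)} c∈)

  -- The three kinds of core

  Tuples : ℕ → ℕ → Set
  Tuples n k = List (Vec (Fin n) k)

  agree? : {n k : ℕ} (P : Subset k) (e₀ : Vec (Fin n) k) → Decidable (λ e → proj P e ≡ proj P e₀)
  agree? P e₀ e = Vecₚ.≡-dec Finₚ._≟_ (proj P e) (proj P e₀)

  agreeAway? : {n k : ℕ} (c : Fin (suc k)) (e₀ : Vec (Fin n) (suc k)) → Decidable (λ e → removeAt e c ≡ removeAt e₀ c)
  agreeAway? c e₀ e = Vecₚ.≡-dec Finₚ._≟_ (removeAt e c) (removeAt e₀ c)

  module _ {n k′ s X K : ℕ} (T : Tuples n (suc k′)) (uT : Unique T) {Av : Fin (suc k′) → Set} (Av? : Decidable Av)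
    (degree : ∀ {e} → e ∈ T → ∀ P → X ≤ K * n ^ ∣ P ∣ * length (filter (agree? P e) T))
    (heavy : ∀ {e} → e ∈ T → ∀ {c} → Av c → s < length (filter (agreeAway? c e) T)) where

    -- The degree hypothesis supplies tuples agreeing with e on P. Moving at most k positions off U,
    -- which needs more than s alternatives each, costs a factor of at most (s + 1)^k.
    extend-by-replacement : ∀ {e} → e ∈ T → (P : Subset (suc k′)) (U : List (Fin n)) → length U ≡ s →
      ∃[ es ] (Unique es ×
               All (λ e′ → e′ ∈ T × (∀ {c} → c ∈ˢ P → lookup e′ c ≡ lookup e c) × (∀ {c} → c ∉ˢ P → Av c → lookup e′ c ∉ U)) es ×
               X ≤ K * suc s ^ suc k′ * n ^ ∣ P ∣ * length es)
    extend-by-replacement {e} e∈ P U refl =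
      avoiding cs , Unique-avoiding cs
      , All.tabulate (λ {e′} e′∈ → let q , av = ∈-avoiding⁻ cs e′∈
                                       e′∈T , eq = ∈-agreeing⁻ q
                                   in e′∈T , proj-≡⇒ P e′ e eq , λ c∉ a → av (∈-free⁺ Av? c∉ a))
      , (begin
          X                                                     ≤⟨ degree e∈ P ⟩
          K * n ^ ∣ P ∣ * length agreeing                       ≤⟨ *-monoʳ-≤ (K * n ^ ∣ P ∣) many ⟩
          K * n ^ ∣ P ∣ * (suc s ^ length cs * length (avoiding cs))
            ≤⟨ *-monoʳ-≤ (K * n ^ ∣ P ∣) (*-monoˡ-≤ (length (avoiding cs)) (^-monoʳ-≤ (suc s) (length-free Av?))) ⟩
          K * n ^ ∣ P ∣ * (suc s ^ suc k′ * length (avoiding cs))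
            ≡⟨ regroup K (n ^ ∣ P ∣) (suc s ^ suc k′) (length (avoiding cs)) ⟩
          K * suc s ^ suc k′ * n ^ ∣ P ∣ * length (avoiding cs) ∎)
      where
      open ≤-Reasoning
      open Avoidance T uT P e U
      cs : List (Fin (suc k′))
      cs = free Av?
      many : length agreeing ≤ suc (length U) ^ length cs * length (avoiding cs)
      many = avoiding-by-replacement cs (proj₁ ∘ ∈-free⁻ Av?) (λ c∈ e∈ → heavy e∈ (proj₂ (∈-free⁻ Av? c∈)))
      regroup : ∀ a b c d → a * b * (c * d) ≡ a * c * b * d
      regroup = solve-∀

  module _ {k′ s : ℕ} {H : List (Subset s)} (tree : IsKTree (suc k′) s H) where

    open IsKTree tree
    open KGraphOn kgraph

    private
      module C = Colouring {s} {k′} (λ _ → nothing) (λ _ → Empty.⊥) (λ ())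

    -- Here no position is special: every tuple of T may serve as every edge, and all new vertices
    -- are moved off U.
    copies-of-heavy-core : {n X K : ℕ} {F : List (Subset n)} (T : Tuples n (suc k′)) → Unique T → (e₀ : Vec (Fin n) (suc k′)) → e₀ ∈ T →
      (∀ {e} → e ∈ T → Distinct e × toSet e ∈ F) →
      (∀ {e} → e ∈ T → ∀ P → X ≤ K * n ^ ∣ P ∣ * length (filter (agree? P e) T)) →
      (∀ {e} → e ∈ T → ∀ c → s < length (filter (agreeAway? c e) T)) →
      Copies (suc k′) X (s ^ s * (K * suc s ^ suc k′) ^ length H) H F
    copies-of-heavy-core {n} {X} {K} T uT e₀ e₀∈ good degree heavy
      with χ , rb ← C.colouring hypertree (λ E∈ → All.lookup uniform E∈)
                      (λ _ → record { unique = λ _ _ () ; onto = λ () }) =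
      copies-of-placements tree (λ E∈ → C.RainbowOn.injective (rb E∈)) (Vec.head e₀) placements (λ _ e∈ → proj₂ (good e∈))
      where
      placements : Placements n H χ X (K * suc s ^ suc k′)
      placements = record
        { Place = λ _ e → e ∈ T
        ; distinct = λ _ e∈ → proj₁ (good e∈)
        ; inhabited = λ _ → e₀ , e₀∈
        ; transfer = λ {_} {_} {f} _ _ _ f∈ → f , f∈ , λ _ _ → refl
        ; Private = λ _ → Empty.⊥
        ; private-≡ = λ _ _ _ _ ()
        ; Avoiding = λ _ → Unit.⊤
        ; avoiding? = λ _ → yes Unit.tt
        ; separated = λ _ _ _ _ _ _ _ ¬av → ⊥-elim (¬av Unit.tt)
        ; extend = λ _ e∈ P _ U len → extend-by-replacement {K = K} T uT (λ _ → yes Unit.tt) degree (λ e∈ {c} _ → heavy e∈ c) e∈ P U len }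

  ∣p∣≡1⇒nonempty : {m : ℕ} (p : Subset m) → ∣ p ∣ ≡ 1 → ∃[ x ] x ∈ˢ p
  ∣p∣≡1⇒nonempty (inside ∷ p)  _  = zero , here
  ∣p∣≡1⇒nonempty (outside ∷ p) eq with x , x∈ ← ∣p∣≡1⇒nonempty p eq = suc x , there x∈

  ∣p∣≡1⇒unique : {m : ℕ} (p : Subset m) → ∣ p ∣ ≡ 1 → ∀ {x y} → x ∈ˢ p → y ∈ˢ p → x ≡ y
  ∣p∣≡1⇒unique p eq {x} {y} x∈ y∈ with x Finₚ.≟ y
  ... | yes e = e
  ... | no ne = ⊥-elim (1+n≰n (begin
    2                   ≡⟨ cong suc (∣⁅x⁆∣≡1 y) ⟨
    suc ∣ ⁅ y ⁆ ∣       ≡⟨ ∣⁅x⁆∪p∣≡ (x≢y⇒x∉⁅y⁆ ne) ⟨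
    ∣ ⁅ x ⁆ ∪ ⁅ y ⁆ ∣   ≤⟨ p⊆q⇒∣p∣≤∣q∣ sub ⟩
    ∣ p ∣               ≡⟨ eq ⟩
    1                   ∎))
    where
    open ≤-Reasoning
    sub : ∀ {z} → z ∈ˢ ⁅ x ⁆ ∪ ⁅ y ⁆ → z ∈ˢ p
    sub z∈ with x∈p∪q⁻ ⁅ x ⁆ ⁅ y ⁆ z∈
    ... | inj₁ q = subst (_∈ˢ p) (sym (x∈⁅y⁆⇒x≡y x q)) x∈
    ... | inj₂ q = subst (_∈ˢ p) (sym (x∈⁅y⁆⇒x≡y y q)) y∈

  hypertree-nonempty : {m : ℕ} {L : List (Subset m)} → IsHypertree L → ∃[ E ] E ∈ L
  hypertree-nonempty (single E) = E , here refl
  hypertree-nonempty (step L L′ E perm _ _) = E , ∈-resp-↭ (↭-sym perm) (here refl)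

  crossCut-nonempty : {m : ℕ} {L : List (Subset m)} (S : Subset m) → IsHypertree L → IsCrossCut L S → 0 < ∣ S ∣
  crossCut-nonempty S tree cut with E , E∈ ← hypertree-nonempty tree =
    ≤-trans (≤-reflexive (sym (All.lookup cut E∈))) (∣p∩q∣≤∣p∣ S E)

  -- An item (b , x) is a (k−1)-tuple b together with a list x of centres; the i-th of the corresponding edges is
  -- the set of entries of arm i.
  Item : ℕ → ℕ → ℕ → Set
  Item n k′ σ = Vec (Fin n) k′ × Vec (Fin n) σ

  arm : {n k′ σ : ℕ} → Fin σ → Item n k′ σ → Vec (Fin n) (suc k′)
  arm i (b , x) = lookup x i ∷ b

  module _ {k′ s σ : ℕ} {H : List (Subset s)} (tree : IsKTree (suc k′) s H)
    (S : Subset s) (crossCut : IsCrossCut H S) (∣S∣≡σ : ∣ S ∣ ≡ σ) where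

    open IsKTree tree
    open KGraphOn kgraph

    private
      sv : Vec (Fin s) σ
      sv = proj₁ (enumerate S ∣S∣≡σ)

      toSet-sv : toSet sv ≡ S
      toSet-sv = proj₂ (proj₂ (enumerate S ∣S∣≡σ))

      sv∈S : ∀ i → lookup sv i ∈ˢ S
      sv∈S i = subst (lookup sv i ∈ˢ_) toSet-sv (∈-toSet⁺ sv i)

      sv-onto : ∀ {v} → v ∈ˢ S → ∃[ i ] lookup sv i ≡ v
      sv-onto v∈ = ∈-toSet⁻ sv (subst (_ ∈ˢ_) (sym toSet-sv) v∈)

      sv-injective : ∀ {i j} → lookup sv i ≡ lookup sv j → i ≡ j
      sv-injective = proj₁ (proj₂ (enumerate S ∣S∣≡σ))

      -- An arm carries its centre at position zero, so this colour goes to the cross-cut.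
      p : Fin s → Maybe (Fin (suc k′))
      p v = ifDec (v ∈? S) (just zero) nothing

      p-S : ∀ {v} → v ∈ˢ S → p v ≡ just zero
      p-S {v} v∈ = ifDec-yes (v ∈? S) v∈

      p-just : ∀ {v c} → p v ≡ just c → v ∈ˢ S × c ≡ zero
      p-just {v} eq with v ∈? S
      p-just refl | yes v∈ = v∈ , refl
      p-just () | no _

      module C = Colouring {s} {k′} p (_≡ zero) (proj₂ ∘ p-just)

      meets-once : ∀ {E} → E ∈ H → ∀ {u v} → u ∈ˢ E → v ∈ˢ E → u ∈ˢ S → v ∈ˢ S → u ≡ v
      meets-once {E} E∈ u∈ v∈ u∈S v∈S =
        ∣p∣≡1⇒unique (S ∩ E) (All.lookup crossCut E∈) (x∈p∩q⁺ (u∈S , u∈)) (x∈p∩q⁺ (v∈S , v∈))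

      meets : ∀ {E} → E ∈ H → ∃[ v ] (v ∈ˢ E × v ∈ˢ S)
      meets {E} E∈ with v , v∈ ← ∣p∣≡1⇒nonempty (S ∩ E) (All.lookup crossCut E∈)
                   with v∈S , v∈E ← x∈p∩q⁻ S E v∈ = v , v∈E , v∈S

      prescribedOn : ∀ {E} → E ∈ H → C.PrescribedOn E
      prescribedOn E∈ = record
        { unique = λ u∈ v∈ eq eq′ → meets-once E∈ u∈ v∈ (proj₁ (p-just eq)) (proj₁ (p-just eq′))
        ; onto = λ { refl → let v , v∈E , v∈S = meets E∈ in v , v∈E , p-S v∈S } }

    module _ {n X K : ℕ} {F : List (Subset n)} (Z : List (Item n k′ σ)) (uZ : Unique Z) (z₀ : Item n k′ σ) (z₀∈ : z₀ ∈ Z)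
      (determined : ∀ {z z′} → z ∈ Z → z′ ∈ Z → proj₁ z ≡ proj₁ z′ → z ≡ z′)
      (good : ∀ {z} → z ∈ Z → ∀ i → Distinct (arm i z) × toSet (arm i z) ∈ F)
      (cls : Vec (Fin (suc σ)) n)
      (base-class : ∀ {z} → z ∈ Z → ∀ c → lookup cls (lookup (proj₁ z) c) ≡ zero)
      (centre-class : ∀ {z} → z ∈ Z → ∀ i → lookup cls (lookup (proj₂ z) i) ≡ suc i)
      (degree : ∀ {z} → z ∈ Z → ∀ i P → X ≤ K * n ^ ∣ P ∣ * length (filter (agree? P (arm i z) ∘ arm i) Z))
      (heavy : ∀ {z} → z ∈ Z → ∀ i c → s < length (filter (agreeAway? (suc c) (arm i z) ∘ arm i) Z)) where

      private
        -- The cross-cut is numbered by `sv`, and its i-th vertex goes to an i-th centre only. The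
        -- number of the arm used for E is therefore dictated by the cross-cut vertex of E.
        Place : Subset s → Vec (Fin n) (suc k′) → Set
        Place E e = ∃[ i ] (lookup sv i ∈ˢ E × ∃[ z ] (z ∈ Z × e ≡ arm i z))

        T : Fin σ → Tuples n (suc k′)
        T i = map (arm i) Z

        uT : ∀ i → Unique (T i)
        uT i = Unique-map-on (arm i) (λ z∈ z′∈ eq → determined z∈ z′∈ (proj₂ (∷-injective eq))) uZ

        degreeT : ∀ i {e} → e ∈ T i → ∀ P → X ≤ K * n ^ ∣ P ∣ * length (filter (agree? P e) (T i))
        degreeT i e∈ P with z , z∈ , refl ← ∈-map⁻ (arm i) e∈ =
          subst (λ l → X ≤ K * n ^ ∣ P ∣ * l) (sym (length-filter-map (agree? P (arm i z)) (arm i) Z)) (degree z∈ i P)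

        heavyT : ∀ i {e} → e ∈ T i → ∀ {c} → ¬ c ≡ zero → s < length (filter (agreeAway? c e) (T i))
        heavyT i e∈ {zero} c≢0 = ⊥-elim (c≢0 refl)
        heavyT i e∈ {suc c} _ with z , z∈ , refl ← ∈-map⁻ (arm i) e∈ =
          subst (s <_) (sym (length-filter-map (agreeAway? (suc c) (arm i z)) (arm i) Z)) (heavy z∈ i c)

      copies-of-centred-core : Copies (suc k′) X (s ^ s * (K * suc s ^ suc k′) ^ length H) H F
      copies-of-centred-core
        with χ , rb ← C.colouring hypertree (λ E∈ → All.lookup uniform E∈) prescribedOn =
        copies-of-placements tree (λ E∈ → C.RainbowOn.injective (rb E∈)) default placements
          (λ { _ (i , _ , z , z∈ , refl) → proj₂ (good z∈ i) })
        where
        χ0⇒S : ∀ {E v} → E ∈ H → v ∈ˢ E → χ v ≡ zero → v ∈ˢ S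
        χ0⇒S E∈ v∈ eq = proj₁ (p-just (C.rainbow-converse (prescribedOn E∈) (rb E∈) v∈ eq))
        index : ∀ {E} → E ∈ H → ∃[ i ] lookup sv i ∈ˢ E
        index E∈ with v , v∈E , v∈S ← meets E∈ with i , refl ← sv-onto v∈S = i , v∈E
        default : Fin n
        default with E , E∈ ← hypertree-nonempty hypertree = Vec.head (arm (proj₁ (index E∈)) z₀)
        -- The same item serves E through another arm. Its base is shared, which settles the common
        -- vertices of nonzero colour; a common vertex of colour zero is the cross-cut vertex of
        -- both edges, and then the two arms are the same.
        transfer : ∀ {E G f} → E ∈ H → G ∈ H → ¬ E ≡ G → Place G f →
          ∃[ e ] (Place E e × (∀ {v} → v ∈ˢ E → v ∈ˢ G → lookup f (χ v) ≡ lookup e (χ v)))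
        transfer E∈ G∈ _ (i , si∈ , z , z∈ , refl) with j , sj∈ ← index E∈ =
          arm j z , (j , sj∈ , z , z∈ , refl) , agree
          where
          agree : ∀ {v} → v ∈ˢ _ → v ∈ˢ _ → lookup (arm i z) (χ v) ≡ lookup (arm j z) (χ v)
          agree {v} v∈E v∈G with χ v in eq
          ... | suc c = refl
          ... | zero = cong (lookup (proj₂ z)) (sv-injective
            (trans (meets-once G∈ si∈ v∈G (sv∈S i) v∈S) (meets-once E∈ v∈E sj∈ v∈S (sv∈S j))))
            where
            v∈S : v ∈ˢ S
            v∈S = χ0⇒S E∈ v∈E eq
        -- Classes replace avoidance for centres: base entries have class zero and i-th centres
        -- class i + 1. If two centres coincide, their numbers agree, and so do the cross-cut
        -- vertices placed there.
        separated : ∀ {E G e f v w} → E ∈ H → G ∈ H → Place E e → Place G f → v ∈ˢ E → w ∈ˢ G → ¬ v ≡ w →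
          ¬ ¬ χ v ≡ zero → ¬ lookup e (χ v) ≡ lookup f (χ w)
        separated {v = v} {w} E∈ G∈ (i , si∈ , z , z∈ , refl) (j , sj∈ , z′ , z′∈ , refl) v∈ w∈ v≢w ¬¬0 same
          with χ v in eqv | χ w in eqw
        ... | suc c | _ = ¬¬0 λ ()
        ... | zero | suc c = absurd (trans (sym (centre-class z∈ i)) (trans (cong (lookup cls) same) (base-class z′∈ c)))
          where
          absurd : ¬ suc i ≡ zero
          absurd ()
        ... | zero | zero = v≢w (trans (meets-once E∈ v∈ si∈ (χ0⇒S E∈ v∈ eqv) (sv∈S i))
          (trans (cong (lookup sv) i≡j) (meets-once G∈ sj∈ w∈ (sv∈S j) (χ0⇒S G∈ w∈ eqw))))
          where
          i≡j : i ≡ j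
          i≡j = Finₚ.suc-injective (trans (sym (centre-class z∈ i)) (trans (cong (lookup cls) same) (centre-class z′∈ j)))
        placements : Placements n H χ X (K * suc s ^ suc k′)
        placements = record
          { Place = Place
          ; distinct = λ { _ (i , _ , z , z∈ , refl) → proj₁ (good z∈ i) }
          ; inhabited = λ E∈ → let i , si∈ = index E∈ in arm i z₀ , i , si∈ , z₀ , z₀∈ , refl
          ; transfer = transfer
          ; Private = λ _ → Empty.⊥
          ; private-≡ = λ _ _ _ _ ()
          ; Avoiding = λ c → ¬ c ≡ zero
          ; avoiding? = λ c → ¬? (c Finₚ.≟ zero)
          ; separated = separated
          ; extend = extend }
          where
          extend : ∀ {E e} → E ∈ H → Place E e → (P : Subset (suc k′)) → (∀ {c} → c ∈ˢ P → ¬ Empty.⊥) →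
            (U : List (Fin n)) → length U ≡ s →
            ∃[ es ] (Unique es ×
                     All (λ e′ → Place E e′ × (∀ {c} → c ∈ˢ P → lookup e′ c ≡ lookup e c) ×
                                 (∀ {c} → c ∉ˢ P → ¬ c ≡ zero → lookup e′ c ∉ U)) es ×
                     X ≤ K * suc s ^ suc k′ * n ^ ∣ P ∣ * length es)
          extend E∈ (i , si∈ , z , z∈ , refl) P _ U len
            with es , u , all , bound ← extend-by-replacement {K = K} (T i) (uT i) (λ c → ¬? (c Finₚ.≟ zero))
                   (degreeT i) (heavyT i) (∈-map⁺ (arm i) z∈) P U len =
            es , u , All.map (λ { (e∈ , rest) → (let z , z∈ , eq = ∈-map⁻ (arm i) e∈ in i , si∈ , z , z∈ , eq) , rest }) all , bound

  Unique-lookup-injective : {A : Set} {xs : List A} → Unique xs → ∀ i j → Data.List.lookup xs i ≡ Data.List.lookup xs j → i ≡ j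
  Unique-lookup-injective (_ ∷ _) zero zero _ = refl
  Unique-lookup-injective {xs = _ ∷ xs} (x∉ ∷ _) zero (suc j) eq = ⊥-elim (All.lookup x∉ (∈-lookup j) eq)
  Unique-lookup-injective {xs = _ ∷ xs} (x∉ ∷ _) (suc i) zero eq = ⊥-elim (All.lookup x∉ (∈-lookup i) (sym eq))
  Unique-lookup-injective (_ ∷ u) (suc i) (suc j) eq = cong suc (Unique-lookup-injective u i j eq)

  -- Exactly two degree-one vertices of each edge are marked, one with each Boolean; further ones
  -- stay unmarked. The vertices marked `true` are distinct for distinct edges, whence `t≤s`, which
  -- makes the exponent s ∸ t a genuine difference.
  record PrivatePairs {s : ℕ} (H : List (Subset s)) : Set where
    field
      mark     : Fin s → Maybe Bool
      degree-1 : ∀ {E F v b} → E ∈ H → F ∈ H → v ∈ˢ E → v ∈ˢ F → mark v ≡ just b → E ≡ F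
      unique   : ∀ {E u v b} → E ∈ H → u ∈ˢ E → v ∈ˢ E → mark u ≡ just b → mark v ≡ just b → u ≡ v
      onto     : ∀ {E} → E ∈ H → ∀ b → ∃[ v ] (v ∈ˢ E × mark v ≡ just b)
      t≤s      : length H ≤ s

  private-pairs : {s : ℕ} {H : List (Subset s)} → Unique H → TwoContractible H → PrivatePairs H
  private-pairs {s} {H} uH tc = record
    { mark = mark ; degree-1 = degree-1 ; unique = unique ; onto = onto ; t≤s = Finₚ.injective⇒≤ vertex-injective }
    where
    t : ℕ
    t = length H
    edge : Fin t → Subset s
    edge = Data.List.lookup H
    vertex : Bool → Fin t → Fin s
    vertex true  i = proj₁ (All.lookup tc (∈-lookup {xs = H} i))
    vertex false i = proj₁ (proj₂ (All.lookup tc (∈-lookup {xs = H} i)))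
    vertex∈ : ∀ b i → vertex b i ∈ˢ edge i
    vertex∈ true  i = let _ , _ , _ , u∈ , _ = All.lookup tc (∈-lookup {xs = H} i) in u∈
    vertex∈ false i = let _ , _ , _ , _ , w∈ , _ = All.lookup tc (∈-lookup {xs = H} i) in w∈
    vertex-degree : ∀ b i → Degree1 H (vertex b i)
    vertex-degree true  i = let _ , _ , _ , _ , _ , d , _ = All.lookup tc (∈-lookup {xs = H} i) in d
    vertex-degree false i = let _ , _ , _ , _ , _ , _ , d = All.lookup tc (∈-lookup {xs = H} i) in d
    only : ∀ b i {E F} → E ∈ H → F ∈ H → vertex b i ∈ˢ E → vertex b i ∈ˢ F → E ≡ F
    only b i E∈ F∈ p q with _ , _ , h ← vertex-degree b i = trans (h _ E∈ p) (sym (h _ F∈ q))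
    same-index : ∀ b b′ i j {E} → E ∈ H → vertex b i ∈ˢ E → vertex b′ j ∈ˢ E → i ≡ j
    same-index b b′ i j E∈ p q = Unique-lookup-injective uH i j
      (trans (only b i (∈-lookup i) E∈ (vertex∈ b i) p) (only b′ j E∈ (∈-lookup j) q (vertex∈ b′ j)))
    vertex-injective : ∀ {i j} → vertex true i ≡ vertex true j → i ≡ j
    vertex-injective {i} {j} eq =
      same-index true true i j (∈-lookup i) (vertex∈ true i) (subst (_∈ˢ edge i) eq (vertex∈ true i))
    first? : ∀ v → Dec (∃[ i ] v ≡ vertex true i)
    first? v = Finₚ.any? (λ i → v Finₚ.≟ vertex true i)
    second? : ∀ v → Dec (∃[ i ] v ≡ vertex false i)
    second? v = Finₚ.any? (λ i → v Finₚ.≟ vertex false i)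
    mark : Fin s → Maybe Bool
    mark v = ifDec (first? v) (just true) (ifDec (second? v) (just false) nothing)
    marked : ∀ {v b} → mark v ≡ just b → ∃[ i ] v ≡ vertex b i
    marked {v} eq with first? v
    marked refl | yes p = p
    ... | no _ with second? v
    marked refl | no _ | yes p = p
    marked () | no _ | no _
    degree-1 : ∀ {E F v b} → E ∈ H → F ∈ H → v ∈ˢ E → v ∈ˢ F → mark v ≡ just b → E ≡ F
    degree-1 {b = b} E∈ F∈ p q eq with i , refl ← marked eq = only b i E∈ F∈ p q
    unique : ∀ {E u v b} → E ∈ H → u ∈ˢ E → v ∈ˢ E → mark u ≡ just b → mark v ≡ just b → u ≡ v
    unique {b = b} E∈ p q eq eq′ with i , refl ← marked eq | j , refl ← marked eq′ =
      cong (vertex b) (same-index b b i j E∈ p q)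
    onto : ∀ {E} → E ∈ H → ∀ b → ∃[ v ] (v ∈ˢ E × mark v ≡ just b)
    onto {E} E∈ b = vertex b i , subst (vertex b i ∈ˢ_) (sym edge-i) (vertex∈ b i) , marks b
      where
      i : Fin t
      i = Any.index E∈
      edge-i : E ≡ edge i
      edge-i = lookup-index E∈
      marks : ∀ b → mark (vertex b i) ≡ just b
      marks true  = ifDec-yes (first? (vertex true i)) (i , refl)
      marks false = trans (ifDec-no (first? (vertex false i)) not-first) (ifDec-yes (second? (vertex false i)) (i , refl))
        where
        not-first : ¬ (∃[ j ] vertex false i ≡ vertex true j)
        not-first (j , eq) with refl ← same-index false true i j (∈-lookup i) (vertex∈ false i)
                                         (subst (_∈ˢ edge i) eq (vertex∈ false i)) =
          let _ , _ , u≢w , _ = All.lookup tc (∈-lookup {xs = H} i) in u≢w (sym eq)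

  ∣⁅a⁆∪⁅c⁆∪P∣≡ : {k : ℕ} {P : Subset k} {a c : Fin k} → ¬ a ≡ c → a ∉ˢ P → c ∉ˢ P →
    ∣ ⁅ a ⁆ ∪ (⁅ c ⁆ ∪ P) ∣ ≡ 2 + ∣ P ∣
  ∣⁅a⁆∪⁅c⁆∪P∣≡ {P = P} {a} {c} a≢c a∉ c∉ = trans (∣⁅x⁆∪p∣≡ fresh) (cong suc (∣⁅x⁆∪p∣≡ c∉))
    where
    fresh : a ∉ˢ ⁅ c ⁆ ∪ P
    fresh a∈ with x∈p∪q⁻ ⁅ c ⁆ P a∈
    ... | inj₁ q = a≢c (x∈⁅y⁆⇒x≡y c q)
    ... | inj₂ q = a∉ q

  module _ {n k″ : ℕ} (T : Tuples n (2 + k″)) (uT : Unique T) (b : ℕ) (a : Fin (2 + k″))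
    (sparse : ∀ e → length (filter (agreeAway? a e) T) ≤ b) where

    private
      k : ℕ
      k = 2 + k″

    -- Entries on P and at c are fixed, and the entries off a determine the tuple up to b choices.
    -- This leaves k - 2 - |P| free positions, one fewer than agreement on P alone, and that missing
    -- factor n makes the tuples through a given vertex negligible.
    sparse-degree : (P : Subset k) (e₀ : Vec (Fin n) k) (c : Fin k) (u : Fin n) → ¬ a ≡ c → a ∉ˢ P → c ∉ˢ P →
      length (filter (λ e → lookup e c Finₚ.≟ u) (filter (agree? P e₀) T)) ≤ b * n ^ (k″ ∸ ∣ P ∣)
    sparse-degree P e₀ c u a≢c a∉ c∉ = begin
      length D                    ≤⟨ length≤-by-fibres (proj Q) D (allVecs n ∣ Q ∣) b (λ _ → ∈-allVecs _) fibre-bound ⟩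
      b * length (allVecs n ∣ Q ∣) ≡⟨ cong (b *_) (length-allVecs n ∣ Q ∣) ⟩
      b * n ^ ∣ Q ∣               ≡⟨ cong (λ x → b * n ^ x) ∣Q∣ ⟩
      b * n ^ (k″ ∸ ∣ P ∣)        ∎
      where
      open ≤-Reasoning
      Q : Subset k
      Q = ∁ (⁅ a ⁆ ∪ (⁅ c ⁆ ∪ P))
      ∣Q∣ : ∣ Q ∣ ≡ k″ ∸ ∣ P ∣
      ∣Q∣ = trans (∣∁p∣≡n∸∣p∣ (⁅ a ⁆ ∪ (⁅ c ⁆ ∪ P))) (cong (k ∸_) (∣⁅a⁆∪⁅c⁆∪P∣≡ a≢c a∉ c∉))
      D : Tuples n k
      D = filter (λ e → lookup e c Finₚ.≟ u) (filter (agree? P e₀) T)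
      open Fibres (Vecₚ.≡-dec {n = ∣ Q ∣} (Finₚ._≟_ {n}))
      D⁻ : ∀ {e} → e ∈ D → e ∈ T × proj P e ≡ proj P e₀ × lookup e c ≡ u
      D⁻ e∈ with p , eq ← ∈-filter⁻ (λ e → lookup e c Finₚ.≟ u) {xs = filter (agree? P e₀) T} e∈
            with q , eq′ ← ∈-filter⁻ (agree? P e₀) {xs = T} p = q , eq′ , eq
      fibre-bound : ∀ {y} → y ∈ allVecs n ∣ Q ∣ → length (fibre (proj Q) y D) ≤ b
      fibre-bound {y} _ with fibre (proj Q) y D in eq
      ... | [] = z≤n
      ... | e₁ ∷ es = ≤-trans (length≤-of-⊆ (subst Unique eq (Uniqueₚ.filter⁺ _ (Uniqueₚ.filter⁺ _ (Uniqueₚ.filter⁺ _ uT)))) sub) (sparse e₁)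
        where
        back : ∀ {e} → e ∈ e₁ ∷ es → e ∈ D × proj Q e ≡ y
        back e∈ = ∈-fibre⁻ (proj Q) D (subst (_ ∈_) (sym eq) e∈)
        sub : ∀ {e} → e ∈ e₁ ∷ es → e ∈ filter (agreeAway? a e₁) T
        sub {e} e∈
          with p , q ← back e∈ | p₁ , q₁ ← back (here refl)
          with e∈T , r , t ← D⁻ p | _ , r₁ , t₁ ← D⁻ p₁ =
          ∈-filter⁺ (agreeAway? a e₁) e∈T (⇒removeAt-≡ e e₁ a same)
          where
          same : ∀ {d} → ¬ a ≡ d → lookup e d ≡ lookup e₁ d
          same {d} a≢d with d ∈? P
          ... | yes d∈ = proj-≡⇒ P e e₁ (trans r (sym r₁)) d∈
          ... | no d∉ with c Finₚ.≟ d
          ...   | yes refl = trans t (sym t₁)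
          ...   | no c≢d = proj-≡⇒ Q e e₁ (trans q (sym q₁)) (x∉p⇒x∈∁p out)
            where
            out : d ∉ˢ ⁅ a ⁆ ∪ (⁅ c ⁆ ∪ P)
            out d∈ with x∈p∪q⁻ ⁅ a ⁆ _ d∈
            ... | inj₁ x = a≢d (sym (x∈⁅y⁆⇒x≡y a x))
            ... | inj₂ x with x∈p∪q⁻ ⁅ c ⁆ P x
            ...   | inj₁ y = c≢d (sym (x∈⁅y⁆⇒x≡y c y))
            ...   | inj₂ y = d∉ y

  module _ {k″ s : ℕ} {H : List (Subset s)} (tree : IsKTree (2 + k″) s H) (pairs : PrivatePairs H) (c₀ : Fin (suc k″)) where

    open IsKTree tree
    open KGraphOn kgraph
    open PrivatePairs pairs

    private
      k : ℕ
      k = 2 + k″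

      colour : Bool → Fin k
      colour true  = zero
      colour false = suc c₀

      colour-injective : ∀ b b′ → colour b ≡ colour b′ → b ≡ b′
      colour-injective true  true  _ = refl
      colour-injective false false _ = refl

      p : Fin s → Maybe (Fin k)
      p v = Maybe.map colour (mark v)

      Marked : Fin k → Set
      Marked c = ∃[ b ] c ≡ colour b

      p-just : ∀ {v c} → p v ≡ just c → ∃[ b ] (mark v ≡ just b × c ≡ colour b)
      p-just {v} eq with mark v
      p-just refl | just b = b , refl , refl

      p-marked : ∀ {v c} → p v ≡ just c → Marked c
      p-marked eq with b , _ , c≡ ← p-just eq = b , c≡

      module C = Colouring {s} {suc k″} p Marked p-marked

      prescribedOn : ∀ {E} → E ∈ H → C.PrescribedOn E
      prescribedOn E∈ = record
        { unique = λ u∈ v∈ eq eq′ → let b , m , c≡ = p-just eq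
                                        b′ , m′ , c≡′ = p-just eq′
                                    in unique E∈ u∈ v∈ m (trans m′ (cong just (colour-injective b′ b (trans (sym c≡′) c≡))))
        ; onto = λ { (b , refl) → let v , v∈ , m = onto E∈ b in v , v∈ , cong (Maybe.map colour) m } }

    module _ {n X K b : ℕ} {F : List (Subset n)} (T : Tuples n k) (uT : Unique T) (e₀ : Vec (Fin n) k) (e₀∈ : e₀ ∈ T)
      (good : ∀ {e} → e ∈ T → Distinct e × toSet e ∈ F)
      (degree : ∀ {e} → e ∈ T → ∀ P → X ≤ K * n ^ ∣ P ∣ * length (filter (agree? P e) T))
      (sparse : ∀ β e → length (filter (agreeAway? (colour β) e) T) ≤ b)
      (large : 2 * (K * (k * (b * s)) * n ^ k″) ≤ X) where

      private
        extend : ∀ {e} → e ∈ T → (P : Subset k) → (∀ {c} → c ∈ˢ P → ¬ Marked c) → (U : List (Fin n)) → length U ≡ s →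
          ∃[ es ] (Unique es ×
                   All (λ e′ → e′ ∈ T × (∀ {c} → c ∈ˢ P → lookup e′ c ≡ lookup e c) × (∀ {c} → c ∉ˢ P → Unit.⊤ → lookup e′ c ∉ U)) es ×
                   X ≤ 2 * K * n ^ ∣ P ∣ * length es)
        extend {e} e∈ P unmarked U refl =
          avoiding cs , Unique-avoiding cs
          , All.tabulate (λ {e′} e′∈ → let q , av = ∈-avoiding⁻ cs e′∈
                                           e′∈T , eq = ∈-agreeing⁻ q
                                       in e′∈T , proj-≡⇒ P e′ e eq , λ c∉ a → av (∈-free⁺ (λ _ → yes Unit.tt) c∉ a))
          -- The degree bound is taken twice so that the spoiled tuples, which cost at most X by
          -- `large`, can be cancelled against one copy.
          , +-cancelˡ-≤ X _ _ (begin
              X + X                                                              ≤⟨ +-mono-≤ (degree e∈ P) (degree e∈ P) ⟩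
              K * N * length agreeing + K * N * length agreeing                  ≡⟨ double (K * N) (length agreeing) ⟩
              2 * (K * N * length agreeing)                                      ≤⟨ *-monoʳ-≤ 2 (*-monoʳ-≤ (K * N) many) ⟩
              2 * (K * N * (length (avoiding cs) + k * (b * M * s)))             ≡⟨ regroup K N (length (avoiding cs)) k b M s ⟩
              2 * (K * (k * (b * s)) * (N * M)) + 2 * K * N * length (avoiding cs)
                ≡⟨ cong (λ x → 2 * (K * (k * (b * s)) * x) + 2 * K * N * length (avoiding cs)) N*M ⟩
              2 * (K * (k * (b * s)) * n ^ k″) + 2 * K * N * length (avoiding cs) ≤⟨ +-monoˡ-≤ _ large ⟩
              X + 2 * K * N * length (avoiding cs)                               ∎)
          where
          open ≤-Reasoning
          open Avoidance T uT P e U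
          cs : List (Fin k)
          cs = free (λ _ → yes Unit.tt)
          N M : ℕ
          N = n ^ ∣ P ∣
          M = n ^ (k″ ∸ ∣ P ∣)
          colour∉ : ∀ β → colour β ∉ˢ P
          colour∉ β c∈ = unmarked c∈ (β , refl)
          few : ∀ {c u} → c ∈ cs → length (filter (λ e → lookup e c Finₚ.≟ u) agreeing) ≤ b * M
          -- The sparse direction must differ from the position c being fixed: position zero needs
          -- the second direction, all others use the first. This is why each edge must offer two
          -- sparse directions.
          few {zero} {u} c∈ = sparse-degree T uT b (suc c₀) (sparse false) P e zero u (λ ()) (colour∉ false) (colour∉ true)
          few {suc c} {u} c∈ = sparse-degree T uT b zero (sparse true) P e (suc c) u (λ ()) (colour∉ true)
                                 (proj₁ (∈-free⁻ (λ _ → yes Unit.tt) c∈))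
          many : length agreeing ≤ length (avoiding cs) + k * (b * M * s)
          many = ≤-trans (avoiding-by-subtraction (b * M) cs few)
                   (+-monoʳ-≤ (length (avoiding cs)) (*-monoˡ-≤ (b * M * s) (length-free (λ _ → yes Unit.tt))))
          -- The positions of the two private vertices are never in P.
          ∣P∣≤k″ : ∣ P ∣ ≤ k″
          ∣P∣≤k″ = ≤-pred (≤-pred (subst (_≤ k) (∣⁅a⁆∪⁅c⁆∪P∣≡ {a = zero} {suc c₀} (λ ()) (colour∉ true) (colour∉ false)) (∣p∣≤n (⁅ zero ⁆ ∪ (⁅ suc c₀ ⁆ ∪ P)))))
          N*M : N * M ≡ n ^ k″
          N*M = trans (sym (^-distribˡ-+-* n ∣ P ∣ (k″ ∸ ∣ P ∣))) (cong (n ^_) (m+[n∸m]≡n ∣P∣≤k″))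
          double : ∀ x y → x * y + x * y ≡ 2 * (x * y)
          double = solve-∀
          regroup : ∀ K N l k b M s → 2 * (K * N * (l + k * (b * M * s))) ≡ 2 * (K * (k * (b * s)) * (N * M)) + 2 * K * N * l
          regroup = solve-∀

      copies-of-sparse-core : Copies k X (s ^ s * (2 * K) ^ length H) H F
      copies-of-sparse-core
        with χ , rb ← C.colouring hypertree (λ E∈ → All.lookup uniform E∈) prescribedOn =
        copies-of-placements tree (λ E∈ → C.RainbowOn.injective (rb E∈)) (Vec.head e₀) placements (λ _ e∈ → proj₂ (good e∈))
        where
        placements : Placements n H χ X (2 * K)
        placements = record
          { Place = λ _ e → e ∈ T
          ; distinct = λ _ e∈ → proj₁ (good e∈)
          ; inhabited = λ _ → e₀ , e₀∈
          ; transfer = λ {_} {_} {f} _ _ _ f∈ → f , f∈ , λ _ _ → refl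
          ; Private = Marked
          ; private-≡ = λ E∈ F∈ v∈E v∈F pr →
              let _ , m , _ = p-just (C.rainbow-converse (prescribedOn E∈) (rb E∈) v∈E pr) in degree-1 E∈ F∈ v∈E v∈F m
          ; Avoiding = λ _ → Unit.⊤
          ; avoiding? = λ _ → yes Unit.tt
          ; separated = λ _ _ _ _ _ _ _ ¬av → ⊥-elim (¬av Unit.tt)
          ; extend = λ _ → extend }

  -- Pruning by low and light reasons

  -- This is 2^k, the number of low reasons for each arm.
  R₀ : ℕ → ℕ
  R₀ k = length (allSubsets k)

  R₀≢0 : ∀ k → NonZero (R₀ k)
  R₀≢0 k = subst NonZero (sym (length-vecsOver (inside ∷ outside ∷ []) k)) (m^n≢0 2 k)

  LightReason : ℕ → ℕ → Set
  LightReason m k = Fin m × Fin k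

  eqL : {m k : ℕ} → DecidableEquality (LightReason m k)
  eqL = Productₚ.≡-dec Finₚ._≟_ Finₚ._≟_

  lightReasons : {k : ℕ} (m : ℕ) → List (Fin k) → List (LightReason m k)
  lightReasons m lights = cartesianProduct (allFin m) lights

  -- A tuple is removed as low when, for some set P of positions, few tuples agree with it on P, and as light when at
  -- most s tuples agree with it outside one position c. Low removals are negligible; light ones need not be.
  record Pruned {n k′ m : ℕ} {A : Set} (arms : Fin m → A → Vec (Fin n) (suc k′))
    (lights : List (Fin (suc k′))) (s K : ℕ) (xs : List A) : Set where
    field
      core                : List A
      ∈-core              : ∀ {x} → x ∈ core → x ∈ xs
      Unique-core         : Unique core
      core-degree         : ∀ {x} → x ∈ core → ∀ i P →
                            length xs ≤ K * n ^ ∣ P ∣ * length (filter (agree? P (arms i x) ∘ arms i) core)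
      core-heavy          : ∀ {x} → x ∈ core → ∀ i {c} → c ∈ lights →
                            s < length (filter (agreeAway? c (arms i x) ∘ arms i) core)
      removedLight        : List (A × LightReason m (suc k′))
      ∈-removedLight      : ∀ {x r} → (x , r) ∈ removedLight → x ∈ xs × proj₂ r ∈ lights
      Unique-removedLight : Unique (map proj₁ removedLight)
      removedLight-sparse : ∀ i c (κ : Vec (Fin n) k′) →
                            length (filter (λ z → Vecₚ.≡-dec Finₚ._≟_ (removeAt (arms i (proj₁ z)) c) κ)
                                           (filter (λ z → eqL (proj₂ z) (i , c)) removedLight)) ≤ s
      pruning-bound       : K * length xs ≤ K * (length core + length removedLight) + m * R₀ (suc k′) * length xs

  module Pruning {n k′ m : ℕ} {A : Set} (arms : Fin m → A → Vec (Fin n) (suc k′))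
    (lights : List (Fin (suc k′))) (s K : ℕ) {{_ : NonZero K}} {{_ : NonZero n}} (xs : List A) (u : Unique xs) where

    private
      k : ℕ
      k = suc k′

    private
      X Y : ℕ
      X = length xs
      Y = X / K

      m<1+m/n*n : ∀ a b .{{_ : NonZero b}} → a < suc (a / b) * b
      m<1+m/n*n a b = begin-strict
        a                      ≡⟨ m≡m%n+[m/n]*n a b ⟩
        a % b + a / b * b      <⟨ +-monoˡ-< (a / b * b) (m%n<n a b) ⟩
        b + a / b * b          ∎
        where open ≤-Reasoning

      -- The largest threshold for which the n^|P| keys together account for at most Y ≤ X / K
      -- removals. A surviving degree is at least `suc (quot P)`, and rounding up in both divisions
      -- gives X ≤ K n^|P| times that degree.
      quot : Subset k → ℕ
      quot P = (Y / n ^ ∣ P ∣) {{m^n≢0 n ∣ P ∣}}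

      quot*n≤ : ∀ P → quot P * n ^ ∣ P ∣ ≤ Y
      quot*n≤ P = m/n*n≤m Y (n ^ ∣ P ∣) {{m^n≢0 n ∣ P ∣}}

      <quot*n : ∀ P → Y < suc (quot P) * n ^ ∣ P ∣
      <quot*n P = m<1+m/n*n Y (n ^ ∣ P ∣) {{m^n≢0 n ∣ P ∣}}

      Low : Set
      Low = Fin m × Subset k

      lows : List Low
      lows = cartesianProduct (allFin m) (allSubsets k)

      Key : Low ⊎ LightReason m k → Set
      Key (inj₁ (_ , P)) = Vec (Fin n) ∣ P ∣
      Key (inj₂ _)       = Vec (Fin n) k′

      eqKey : ∀ r → DecidableEquality (Key r)
      eqKey (inj₁ _) = Vecₚ.≡-dec Finₚ._≟_
      eqKey (inj₂ _) = Vecₚ.≡-dec Finₚ._≟_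

      key : ∀ r → A → Key r
      key (inj₁ (i , P)) x = proj P (arms i x)
      key (inj₂ (i , c)) x = removeAt (arms i x) c

      eqR : DecidableEquality (Low ⊎ LightReason m k)
      eqR = Sumₚ.≡-dec (Productₚ.≡-dec Finₚ._≟_ (Vecₚ.≡-dec Boolₚ._≟_)) eqL

      threshold : Low ⊎ LightReason m k → ℕ
      threshold (inj₁ (_ , P)) = quot P
      threshold (inj₂ _)       = s

      open Peeling Key eqKey eqR key (map inj₁ lows ++ map inj₂ (lightReasons m lights)) threshold
      open Peeled (peel xs)

    core-degree : ∀ {x} → x ∈ core → ∀ i P → X ≤ K * n ^ ∣ P ∣ * length (filter (agree? P (arms i x) ∘ arms i) core)
    core-degree {x} x∈ i P = begin
      X                                 ≤⟨ <⇒≤ (≤-trans (m<1+m/n*n X K) (≤-reflexive (*-comm (suc Y) K))) ⟩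
      K * suc Y                         ≤⟨ *-monoʳ-≤ K (<quot*n P) ⟩
      K * (suc (quot P) * n ^ ∣ P ∣) ≤⟨ *-monoʳ-≤ K (*-monoˡ-≤ (n ^ ∣ P ∣) big) ⟩
      K * (d * n ^ ∣ P ∣)               ≡⟨ regroup K d (n ^ ∣ P ∣) ⟩
      K * n ^ ∣ P ∣ * d                 ∎
      where
      open ≤-Reasoning
      d : ℕ
      d = length (filter (agree? P (arms i x) ∘ arms i) core)
      big : quot P < d
      big = stable x∈ (∈-++⁺ˡ (∈-map⁺ inj₁ (∈-cartesianProduct⁺ (∈-allFin i) (∈-allSubsets P))))
      regroup : ∀ a b c → a * (b * c) ≡ a * c * b
      regroup = solve-∀

    core-heavy : ∀ {x} → x ∈ core → ∀ i {c} → c ∈ lights → s < length (filter (agreeAway? c (arms i x) ∘ arms i) core)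
    core-heavy x∈ i c∈ =
      stable x∈ (∈-++⁺ʳ (map inj₁ lows) (∈-map⁺ inj₂ (∈-cartesianProduct⁺ (∈-allFin i) c∈)))

    private
      lightPart : List (A × (Low ⊎ LightReason m k)) → List (A × LightReason m k)
      lightPart []                  = []
      lightPart ((x , inj₁ _) ∷ zs) = lightPart zs
      lightPart ((x , inj₂ r) ∷ zs) = (x , r) ∷ lightPart zs

      lowPart : List (A × (Low ⊎ LightReason m k)) → List (A × (Low ⊎ LightReason m k))
      lowPart []                  = []
      lowPart ((x , inj₁ r) ∷ zs) = (x , inj₁ r) ∷ lowPart zs
      lowPart ((x , inj₂ _) ∷ zs) = lowPart zs

      length-parts : ∀ zs → length zs ≡ length (lightPart zs) + length (lowPart zs)
      length-parts []                  = refl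
      length-parts ((x , inj₁ _) ∷ zs) = trans (cong suc (length-parts zs)) (sym (+-suc _ _))
      length-parts ((x , inj₂ _) ∷ zs) = cong suc (length-parts zs)

      ∈-lightPart : ∀ zs {x r} → (x , r) ∈ lightPart zs → (x , inj₂ r) ∈ zs
      ∈-lightPart ((x , inj₁ _) ∷ zs) p           = there (∈-lightPart zs p)
      ∈-lightPart ((x , inj₂ r) ∷ zs) (here refl) = here refl
      ∈-lightPart ((x , inj₂ r) ∷ zs) (there p)   = there (∈-lightPart zs p)

      ∈-lowPart : ∀ zs {z} → z ∈ lowPart zs → z ∈ zs × ∃[ r ] proj₂ z ≡ inj₁ r
      ∈-lowPart ((x , inj₁ r) ∷ zs) (here refl) = here refl , r , refl
      ∈-lowPart ((x , inj₁ r) ∷ zs) (there p)   = let q , e = ∈-lowPart zs p in there q , e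
      ∈-lowPart ((x , inj₂ r) ∷ zs) p           = let q , e = ∈-lowPart zs p in there q , e

      Unique-lightPart : ∀ zs → Unique (map proj₁ zs) → Unique (map proj₁ (lightPart zs))
      Unique-lightPart [] [] = []
      Unique-lightPart ((x , inj₁ _) ∷ zs) (_ ∷ u) = Unique-lightPart zs u
      Unique-lightPart ((x , inj₂ r) ∷ zs) (x∉ ∷ u) =
        Allₚ.map⁺ (All.tabulate (λ {z} z∈ eq → All.lookup x∉ (∈-map⁺ proj₁ (∈-lightPart zs z∈)) eq)) ∷ Unique-lightPart zs u

      lowPart-removedFor : ∀ r zs → length (filter (λ z → eqR (proj₂ z) r) (lowPart zs)) ≤ length (removedFor r zs)
      lowPart-removedFor r [] = z≤n
      lowPart-removedFor r ((x , inj₁ r′) ∷ zs) with eqR (inj₁ r′) r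
      ... | yes _ = s≤s (lowPart-removedFor r zs)
      ... | no  _ = lowPart-removedFor r zs
      lowPart-removedFor r ((x , inj₂ r′) ∷ zs) with eqR (inj₂ r′) r
      ... | yes _ = m≤n⇒m≤1+n (lowPart-removedFor r zs)
      ... | no  _ = lowPart-removedFor r zs

    removedLight : List (A × LightReason m k)
    removedLight = lightPart removed

    ∈-removedLight : ∀ {x r} → (x , r) ∈ removedLight → x ∈ xs × proj₂ r ∈ lights
    ∈-removedLight {x} {r} z∈ = ∈-removed z∈′ , light-reason (All.lookup reasons z∈′)
      where
      z∈′ : (x , inj₂ r) ∈ removed
      z∈′ = ∈-lightPart removed z∈
      light-reason : inj₂ r ∈ map inj₁ lows ++ map inj₂ (lightReasons m lights) → proj₂ r ∈ lights
      light-reason r∈ with ∈-++⁻ (map inj₁ lows) r∈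
      ... | inj₁ p with _ , _ , () ← ∈-map⁻ inj₁ p
      ... | inj₂ p with _ , q , refl ← ∈-map⁻ inj₂ p = proj₂ (∈-cartesianProduct⁻ (allFin m) lights q)

    Unique-removedLight : Unique (map proj₁ removedLight)
    Unique-removedLight = Unique-lightPart removed (Unique-removed u)

    -- The threshold s of light reasons survives as information about what was removed: this is the
    -- bounded multiplicity on which both counts of light removals rest.
    removedLight-sparse : ∀ i c (κ : Vec (Fin n) k′) →
      length (filter (λ z → Vecₚ.≡-dec Finₚ._≟_ (removeAt (arms i (proj₁ z)) c) κ)
                     (filter (λ z → eqL (proj₂ z) (i , c)) removedLight)) ≤ s
    removedLight-sparse i c κ = ≤-trans
      (length≤-of-injection (λ (x , r) → x , inj₂ r)
        (Uniqueₚ.filter⁺ _ (Uniqueₚ.filter⁺ _ (Uniqueₚ.map⁻ Unique-removedLight)))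
        (λ { _ _ refl → refl }) moved)
      (light (inj₂ (i , c)) κ)
      where
      moved : ∀ {z} → z ∈ filter (λ z → Vecₚ.≡-dec Finₚ._≟_ (removeAt (arms i (proj₁ z)) c) κ)
                                 (filter (λ z → eqL (proj₂ z) (i , c)) removedLight) →
              (proj₁ z , inj₂ (proj₂ z)) ∈ removedWithKey (inj₂ (i , c)) κ removed
      moved {x , r} z∈
        with p , eq ← ∈-filter⁻ (λ z → Vecₚ.≡-dec Finₚ._≟_ (removeAt (arms i (proj₁ z)) c) κ)
                        {xs = filter (λ z → eqL (proj₂ z) (i , c)) removedLight} z∈
        with q , refl ← ∈-filter⁻ (λ z → eqL (proj₂ z) (i , c)) {xs = removedLight} p =
        ∈-filter⁺ (λ z → eqKey (inj₂ (i , c)) (key (inj₂ (i , c)) (proj₁ z)) κ)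
          (∈-filter⁺ (λ z → eqR (proj₂ z) (inj₂ (i , c))) (∈-lightPart removed q) refl) eq

    -- Each of the m times 2^k low reasons removes at most X / K elements. All other removals are
    -- light.
    pruning-bound : K * X ≤ K * (length core + length removedLight) + m * R₀ k * X
    pruning-bound = begin
      K * X
        ≡⟨ cong (K *_) (trans length-split (cong (length core +_) (length-parts removed))) ⟩
      K * (length core + (length removedLight + length (lowPart removed)))
        ≡⟨ regroup K (length core) (length removedLight) (length (lowPart removed)) ⟩
      K * (length core + length removedLight) + length (lowPart removed) * K
        ≤⟨ +-monoʳ-≤ _ (*-monoˡ-≤ K low-bound) ⟩
      K * (length core + length removedLight) + Y * (m * R₀ k) * K
        ≡⟨ cong (K * (length core + length removedLight) +_) (regroup′ Y (m * R₀ k) K) ⟩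
      K * (length core + length removedLight) + m * R₀ k * (Y * K)
        ≤⟨ +-monoʳ-≤ _ (*-monoʳ-≤ (m * R₀ k) (m/n*n≤m X K)) ⟩
      K * (length core + length removedLight) + m * R₀ k * X ∎
      where
      open ≤-Reasoning
      regroup : ∀ a b c d → a * (b + (c + d)) ≡ a * (b + c) + d * a
      regroup = solve-∀
      regroup′ : ∀ a b c → a * b * c ≡ b * (a * c)
      regroup′ = solve-∀
      length-lows : length (map inj₁ lows) ≡ m * R₀ k
      length-lows = trans (length-map inj₁ lows)
        (trans (length-cartesianProductWith _,_ (allFin m) (allSubsets k)) (cong (_* R₀ k) (length-tabulate {n = m} id)))
      each : ∀ {r} → r ∈ map inj₁ lows → length (filter (λ z → eqR (proj₂ z) r) (lowPart removed)) ≤ Y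
      each r∈ with (i , P) , _ , refl ← ∈-map⁻ inj₁ r∈ = begin
        length (filter (λ z → eqR (proj₂ z) (inj₁ (i , P))) (lowPart removed)) ≤⟨ lowPart-removedFor (inj₁ (i , P)) removed ⟩
        length (removedFor (inj₁ (i , P)) removed) ≤⟨ length-removedFor (inj₁ (i , P)) (allVecs n ∣ P ∣) (λ _ → ∈-allVecs _) ⟩
        quot P * length (allVecs n ∣ P ∣)   ≡⟨ cong (quot P *_) (length-allVecs n ∣ P ∣) ⟩
        quot P * n ^ ∣ P ∣                  ≤⟨ quot*n≤ P ⟩
        Y                                          ∎
      low-bound : length (lowPart removed) ≤ Y * (m * R₀ k)
      low-bound = subst (λ l → length (lowPart removed) ≤ Y * l) length-lows
        (Fibres.length≤-by-fibres eqR proj₂ (lowPart removed) (map inj₁ lows) Y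
          (λ z∈ → let z∈′ , r , eq = ∈-lowPart removed z∈
                  in low-reason eq (All.lookup reasons z∈′)) each)
        where
        low-reason : ∀ {r r′} → r ≡ inj₁ r′ → r ∈ map inj₁ lows ++ map inj₂ (lightReasons m lights) → r ∈ map inj₁ lows
        low-reason refl r∈ with ∈-++⁻ (map inj₁ lows) r∈
        ... | inj₁ p = p
        ... | inj₂ p with _ , _ , () ← ∈-map⁻ inj₂ p

    prune : Pruned arms lights s K xs
    prune = record
      { core = core ; ∈-core = ∈-core ; Unique-core = Unique-core u
      ; core-degree = core-degree ; core-heavy = core-heavy
      ; removedLight = removedLight ; ∈-removedLight = ∈-removedLight ; Unique-removedLight = Unique-removedLight
      ; removedLight-sparse = removedLight-sparse ; pruning-bound = pruning-bound }

  -- Binomial coefficients against powers, and the arithmetic of the constants.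

  [1+j]*[1+n]C[1+j]≡[1+n]*nCj : ∀ n j → suc j * (suc n C suc j) ≡ suc n * (n C j)
  [1+j]*[1+n]C[1+j]≡[1+n]*nCj zero    zero    = refl
  [1+j]*[1+n]C[1+j]≡[1+n]*nCj zero    (suc j) = *-zeroʳ (2 + j)
  [1+j]*[1+n]C[1+j]≡[1+n]*nCj (suc n) zero    =
    trans (*-identityˡ _) (trans (nC1≡n (2 + n)) (sym (*-identityʳ (2 + n))))
  [1+j]*[1+n]C[1+j]≡[1+n]*nCj (suc n) (suc j) = begin
    (2 + j) * (suc (suc n) C suc (suc j))
      ≡⟨ cong ((2 + j) *_) (nCk+nC[k+1]≡[n+1]C[k+1] (suc n) (suc j)) ⟨
    (2 + j) * (a + b)
      ≡⟨ expand j a b ⟩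
    suc j * a + (2 + j) * b + a
      ≡⟨ cong₂ (λ x y → x + y + a) ([1+j]*[1+n]C[1+j]≡[1+n]*nCj n j) ([1+j]*[1+n]C[1+j]≡[1+n]*nCj n (suc j)) ⟩
    suc n * (n C j) + suc n * (n C suc j) + a
      ≡⟨ cong (_+ a) (*-distribˡ-+ (suc n) (n C j) (n C suc j)) ⟨
    suc n * (n C j + n C suc j) + a
      ≡⟨ cong (λ x → suc n * x + a) (nCk+nC[k+1]≡[n+1]C[k+1] n j) ⟩
    suc n * a + a
      ≡⟨ +-comm (suc n * a) a ⟩
    (2 + n) * a ∎
    where
    open ≡-Reasoning
    a b : ℕ
    a = suc n C suc j
    b = suc n C suc (suc j)
    expand : ∀ j a b → (2 + j) * (a + b) ≡ suc j * a + (2 + j) * b + a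
    expand = solve-∀

  ^-distribʳ-* : ∀ j a b → (a * b) ^ j ≡ a ^ j * b ^ j
  ^-distribʳ-* zero    a b = refl
  ^-distribʳ-* (suc j) a b = trans (cong (a * b *_) (^-distribʳ-* j a b)) (e a b (a ^ j) (b ^ j))
    where
    e : ∀ a b c d → a * b * (c * d) ≡ a * c * (b * d)
    e = solve-∀

  opaque

    -- Induction on j by the absorption identity; replacing n + 1 by 2n in the lower power costs
    -- 2^j.
    n^j≤c*nCj : ∀ j → ∃[ c ] (∀ n → j < n → n ^ j ≤ c * (n C j))
    n^j≤c*nCj zero = 1 , λ n _ → ≤-refl
    n^j≤c*nCj (suc j) with c , h ← n^j≤c*nCj j = 2 ^ j * c * suc j , bound
      where
      open ≤-Reasoning
      bound : ∀ n → suc j < n → n ^ suc j ≤ 2 ^ j * c * suc j * (n C suc j)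
      bound (suc n) (s≤s j<n) = begin
        suc n * suc n ^ j                   ≤⟨ *-monoʳ-≤ (suc n) (^-monoˡ-≤ j (1+n≤2n n (≤-trans (s≤s z≤n) j<n))) ⟩
        suc n * (2 * n) ^ j                 ≡⟨ cong (suc n *_) (^-distribʳ-* j 2 n) ⟩
        suc n * (2 ^ j * n ^ j)             ≤⟨ *-monoʳ-≤ (suc n) (*-monoʳ-≤ (2 ^ j) (h n j<n)) ⟩
        suc n * (2 ^ j * (c * (n C j)))     ≡⟨ e₁ (suc n) (2 ^ j) c (n C j) ⟩
        2 ^ j * c * (suc n * (n C j))       ≡⟨ cong (2 ^ j * c *_) ([1+j]*[1+n]C[1+j]≡[1+n]*nCj n j) ⟨
        2 ^ j * c * (suc j * (suc n C suc j)) ≡⟨ *-assoc (2 ^ j * c) (suc j) (suc n C suc j) ⟨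
        2 ^ j * c * suc j * (suc n C suc j) ∎
        where
        e₁ : ∀ a b c d → a * (b * (c * d)) ≡ b * c * (a * d)
        e₁ = solve-∀
        1+n≤2n : ∀ n → 1 ≤ n → suc n ≤ 2 * n
        1+n≤2n n 1≤n = subst (suc n ≤_) (cong (n +_) (sym (+-identityʳ n))) (+-monoˡ-≤ n 1≤n)

  empty-or-inhabited : {A : Set} (xs : List A) → xs ≡ [] ⊎ ∃[ x ] x ∈ xs
  empty-or-inhabited []       = inj₁ refl
  empty-or-inhabited (x ∷ xs) = inj₂ (x , here refl)

  -- With w = qσ′ + 1, a family of f ≥ (w/q)·N edges all but a 1/2w fraction of which are light exceeds σ′·N by a
  -- constant factor, which forces many bases.
  light-arithmetic : ∀ R q σ′ N M f l b .{{_ : NonZero R}} → let w = suc (q * σ′) in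
    R * (2 * w) * f ≤ R * (2 * w) * l + R * f → l ≤ σ′ * N + M * b → w * N ≤ q * f →
    N ≤ 2 * q * M * b × f ≤ 2 * (σ′ * (2 * q * M) + M) * b
  light-arithmetic R q σ′ N M f l b h₁ h₂ h₃ = N≤ , f≤
    where
    open ≤-Reasoning
    w′ w : ℕ
    w′ = q * σ′
    w = suc w′
    cancelled : suc (2 * w′) * f ≤ 2 * w * l
    cancelled = +-cancelʳ-≤ f _ _ (*-cancelˡ-≤ R (begin
      R * (suc (2 * w′) * f + f) ≡⟨ e R w′ f ⟩
      R * (2 * w) * f            ≤⟨ h₁ ⟩
      R * (2 * w) * l + R * f    ≡⟨ e′ R w l f ⟩
      R * (2 * w * l + f)        ∎))
      where
      e : ∀ R w′ f → R * (suc (2 * w′) * f + f) ≡ R * (2 * suc w′) * f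
      e = solve-∀
      e′ : ∀ R w l f → R * (2 * w) * l + R * f ≡ R * (2 * w * l + f)
      e′ = solve-∀
    N≤ : N ≤ 2 * q * M * b
    N≤ = +-cancelˡ-≤ (2 * w′ * N) _ _ (*-cancelˡ-≤ w (begin
      w * (2 * w′ * N + N)                ≡⟨ e₁ w w′ N ⟩
      suc (2 * w′) * (w * N)              ≤⟨ *-monoʳ-≤ (suc (2 * w′)) h₃ ⟩
      suc (2 * w′) * (q * f)              ≡⟨ e₂ (suc (2 * w′)) q f ⟩
      q * (suc (2 * w′) * f)              ≤⟨ *-monoʳ-≤ q cancelled ⟩
      q * (2 * w * l)                     ≤⟨ *-monoʳ-≤ q (*-monoʳ-≤ (2 * w) h₂) ⟩
      q * (2 * w * (σ′ * N + M * b))      ≡⟨ e₃ q σ′ w N M b ⟩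
      w * (2 * w′ * N + 2 * q * M * b)    ∎))
      where
      e₁ : ∀ w w′ N → w * (2 * w′ * N + N) ≡ suc (2 * w′) * (w * N)
      e₁ = solve-∀
      e₂ : ∀ a b c → a * (b * c) ≡ b * (a * c)
      e₂ = solve-∀
      e₃ : ∀ q σ′ w N M b → q * (2 * w * (σ′ * N + M * b)) ≡ w * (2 * (q * σ′) * N + 2 * q * M * b)
      e₃ = solve-∀
    f≤2l : f ≤ 2 * l
    f≤2l = *-cancelˡ-≤ (suc (2 * w′)) (begin
      suc (2 * w′) * f                   ≤⟨ cancelled ⟩
      2 * w * l                          ≤⟨ m≤m+n (2 * w * l) (2 * w′ * l) ⟩
      2 * w * l + 2 * w′ * l             ≡⟨ e w′ l ⟩
      suc (2 * w′) * (2 * l)             ∎)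
      where
      e : ∀ w′ l → 2 * suc w′ * l + 2 * w′ * l ≡ suc (2 * w′) * (2 * l)
      e = solve-∀
    f≤ : f ≤ 2 * (σ′ * (2 * q * M) + M) * b
    f≤ = begin
      f                                      ≤⟨ f≤2l ⟩
      2 * l                                  ≤⟨ *-monoʳ-≤ 2 h₂ ⟩
      2 * (σ′ * N + M * b)                   ≤⟨ *-monoʳ-≤ 2 (+-monoˡ-≤ (M * b) (*-monoʳ-≤ σ′ N≤)) ⟩
      2 * (σ′ * (2 * q * M * b) + M * b)     ≡⟨ e σ′ q M b ⟩
      2 * (σ′ * (2 * q * M) + M) * b         ∎
      where
      e : ∀ σ′ q M b → 2 * (σ′ * (2 * q * M * b) + M * b) ≡ 2 * (σ′ * (2 * q * M) + M) * b
      e = solve-∀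

  -- Allows every stage to count against the subfamily that it uses, as long as this is a positive
  -- proportion of the previous family.
  Copies-rescale : {s n : ℕ} {k X Y A K : ℕ} {H : List (Subset s)} {F : List (Subset n)} →
    X ≤ A * Y → Copies k Y K H F → Copies k X (A ^ length H * K) H F
  Copies-rescale {s} {n} {k} {X} {Y} {A} {K} {H} X≤ (copies Cs valid bound) = copies Cs valid (begin
    X ^ t * n ^ s                            ≤⟨ *-monoˡ-≤ (n ^ s) (^-monoˡ-≤ t X≤) ⟩
    (A * Y) ^ t * n ^ s                      ≡⟨ cong (_* n ^ s) (^-distribʳ-* t A Y) ⟩
    A ^ t * Y ^ t * n ^ s                    ≡⟨ *-assoc (A ^ t) (Y ^ t) (n ^ s) ⟩
    A ^ t * (Y ^ t * n ^ s)                  ≤⟨ *-monoʳ-≤ (A ^ t) bound ⟩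
    A ^ t * (K * length Cs * n ^ (k * t))    ≡⟨ e (A ^ t) K (length Cs) (n ^ (k * t)) ⟩
    A ^ t * K * length Cs * n ^ (k * t)      ∎)
    where
    open ≤-Reasoning
    t : ℕ
    t = length H
    e : ∀ a b c d → a * (b * c * d) ≡ a * b * c * d
    e = solve-∀

  Copies-weaken : {s n : ℕ} {k X K K′ : ℕ} {H : List (Subset s)} {F : List (Subset n)} →
    K ≤ K′ → Copies k X K H F → Copies k X K′ H F
  Copies-weaken {H = H} K≤ (copies Cs valid bound) =
    copies Cs valid (≤-trans bound (*-monoˡ-≤ _ (*-monoˡ-≤ (length Cs) K≤)))

  -- From edges to centred items

  GoodItem : {n k′ σ : ℕ} → List (Subset n) → Item n k′ σ → Set
  GoodItem F z = Distinct (proj₁ z) × Distinct (proj₂ z) ×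
    (∀ i → lookup (proj₂ z) i ∉ˢ toSet (proj₁ z) × toSet (arm i z) ∈ F)

  arm-distinct : {n k′ σ : ℕ} {F : List (Subset n)} (z : Item n k′ σ) → GoodItem F z → ∀ i → Distinct (arm i z)
  arm-distinct (b , x) (db , _ , h) i {zero}  {zero}  _  = refl
  arm-distinct (b , x) (db , _ , h) i {zero}  {suc d} eq = ⊥-elim (proj₁ (h i) (subst (_∈ˢ toSet b) (sym eq) (∈-toSet⁺ b d)))
  arm-distinct (b , x) (db , _ , h) i {suc c} {zero}  eq = ⊥-elim (proj₁ (h i) (subst (_∈ˢ toSet b) eq (∈-toSet⁺ b c)))
  arm-distinct (b , x) (db , _ , h) i {suc c} {suc d} eq = cong suc (db eq)

  centres-of-base : {n k′ σ : ℕ} {F : List (Subset n)} (B : Subset n) → ∣ B ∣ ≡ k′ → (cs : List (Fin n)) → Unique cs →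
    (∀ {x} → x ∈ cs → x ∉ˢ B × ⁅ x ⁆ ∪ B ∈ F) → σ ≤ length cs →
    ∃[ z ] (toSet (proj₁ z) ≡ B × GoodItem {n} {k′} {σ} F z)
  centres-of-base {n} {k′} {σ} {F} B size cs u good le with b , db , refl ← enumerate B size =
    (b , x) , refl , db , dx , λ i → subst (λ y → y ∉ˢ toSet b × ⁅ y ⁆ ∪ toSet b ∈ F) (sym (lookup∘tabulate _ i)) (good (∈-lookup _))
    where
    x : Vec (Fin n) σ
    x = tabulate (λ i → Data.List.lookup cs (Data.Fin.inject≤ i le))
    dx : Distinct x
    dx {i} {j} eq = Finₚ.inject≤-injective le le i j
      (Unique-lookup-injective u _ _ (trans (sym (lookup∘tabulate _ i)) (trans eq (lookup∘tabulate _ j))))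

  -- The constants K₁, K₂ and K₃ are chosen so that the low-degree removals cost a small enough fraction of the
  -- family for the next counting step to survive.
  K₁ : (k q σ′ : ℕ) → ℕ
  K₁ k q σ′ = R₀ k * (2 * suc (q * σ′))

  -- Bounds the light edges with a given base B: the position removed (k choices), the tuple left by
  -- it with entries in B (at most k′^k′), and at most s edges for these two.
  multiplicity : (k′ s : ℕ) → ℕ
  multiplicity k′ s = s * k′ ^ k′ * (1 * suc k′)

  -- The items have different bases even as sets. The bound on |F| carries the final count back to
  -- F, while the one on `n C suc k″` makes the family large compared with n^(k-2).
  ManyItems : (k″ σ′ M A : ℕ) {n : ℕ} (F : List (Subset n)) → Set
  ManyItems k″ σ′ M A {n} F =
    ∃[ Z ] (Unique (map (toSet ∘ proj₁) Z) × All (GoodItem {n} {suc k″} {suc σ′} F) Z ×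
            n C suc k″ ≤ M * length Z × length F ≤ A * length Z)

  module LightEdges {k″ s σ′ : ℕ} {H : List (Subset s)} (tree : IsKTree (2 + k″) s H) (q : ℕ)
    {n : ℕ} {F : List (Subset n)} (dense : suc (q * σ′) * (n C suc k″) ≤ q * length F)
    (T : Tuples n (2 + k″)) (uF : Unique (map toSet T)) (∣T∣ : length T ≡ length F)
    (good : ∀ {e} → e ∈ T → Distinct e × toSet e ∈ F)
    (pruned : Pruned {m = 1} (λ _ e → e) (allFin (2 + k″)) s (K₁ (2 + k″) q σ′) T) where

    open Pruned pruned

    private
      k k′ σ K M : ℕ
      k = 2 + k″
      k′ = suc k″
      σ = suc σ′
      K = K₁ k q σ′
      M = multiplicity k′ s

      base : Vec (Fin n) k × LightReason 1 k → Subset n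
      base (e , (_ , c)) = toSet (removeAt e c)

      centre : Vec (Fin n) k × LightReason 1 k → Fin n
      centre (e , (_ , c)) = lookup e c

      open Fibres (Vecₚ.≡-dec {n = n} Boolₚ._≟_)

      edges : Subset n → List (Vec (Fin n) k × LightReason 1 k)
      edges B = fibre base B removedLight

      uΛ : Unique removedLight
      uΛ = Uniqueₚ.map⁻ Unique-removedLight

      edges-bound : ∀ {B} → ∣ B ∣ ≡ k′ → length (edges B) ≤ M
      edges-bound {B} size = subst (λ l → length (edges B) ≤ s * k′ ^ k′ * l)
        (trans (length-cartesianProductWith _,_ (allFin 1) (allFin k)) (cong (1 *_) (length-tabulate {n = k} id)))
        (Fibres.length≤-by-fibres eqL proj₂ (edges B) (lightReasons 1 (allFin k)) (s * k′ ^ k′)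
          (λ _ → ∈-cartesianProduct⁺ (∈-allFin _) (∈-allFin _)) (λ {r} _ → for-reason r))
        where
        open ≤-Reasoning
        for-reason : ∀ r → length (filter (λ z → eqL (proj₂ z) r) (edges B)) ≤ s * k′ ^ k′
        for-reason (i , c) = begin
          length D                   ≤⟨ Fibres.length≤-by-fibres (Vecₚ.≡-dec Finₚ._≟_) (λ z → removeAt (proj₁ z) c) D (vecsIn B k′) s inside-B sparse ⟩
          s * length (vecsIn B k′)   ≡⟨ cong (s *_) (trans (length-vecsIn B k′) (cong (_^ k′) size)) ⟩
          s * k′ ^ k′                ∎
          where
          D : List (Vec (Fin n) k × LightReason 1 k)
          D = filter (λ z → eqL (proj₂ z) (i , c)) (edges B)
          D⁻ : ∀ {z} → z ∈ D → z ∈ removedLight × base z ≡ B × proj₂ z ≡ (i , c)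
          D⁻ z∈ with p , eq ← ∈-filter⁻ (λ z → eqL (proj₂ z) (i , c)) {xs = edges B} z∈
                with p′ , eq′ ← ∈-fibre⁻ base removedLight p = p′ , eq′ , eq
          inside-B : ∀ {z} → z ∈ D → removeAt (proj₁ z) c ∈ vecsIn B k′
          inside-B {e , _} z∈ with _ , refl , refl ← D⁻ z∈ = ∈-vecsIn (removeAt e c) (∈-toSet⁺ (removeAt e c))
          sparse : ∀ {κ} → κ ∈ vecsIn B k′ →
            length (filter (λ z → Vecₚ.≡-dec Finₚ._≟_ (removeAt (proj₁ z) c) κ) D) ≤ s
          sparse {κ} _ = ≤-trans
            (length≤-of-⊆ (Uniqueₚ.filter⁺ _ (Uniqueₚ.filter⁺ _ (Uniqueₚ.filter⁺ _ uΛ)))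
              (λ z∈ → let p , eq = ∈-filter⁻ (λ z → Vecₚ.≡-dec Finₚ._≟_ (removeAt (proj₁ z) c) κ) {xs = D} z∈
                          p′ , _ , eq′ = D⁻ p
                      in ∈-filter⁺ _ (∈-filter⁺ _ p′ eq′) eq))
            (removedLight-sparse i c κ)

      many? : Decidable (λ B → suc σ′ ≤ length (edges B))
      many? B = suc σ′ ≤? length (edges B)

      bases : List (Subset n)
      bases = filter many? (subsetsOfSize n k′)

      -- Here the cross-cut number enters: bases with fewer than σ light edges carry at most σ - 1
      -- of them each, hence at most (σ - 1) C(n, k-1) in all. Any excess over this must come from
      -- bases with at least σ.
      light-bound : length removedLight ≤ σ′ * (n C k′) + M * length bases
      light-bound = subst (λ l → length removedLight ≤ σ′ * l + M * length bases) (length-subsetsOfSize n k′)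
        (≤-trans (length≤sum-fibres base removedLight (subsetsOfSize n k′)
                   (λ { {e , (_ , c)} z∈ → ∈-subsetsOfSize _ (Distinct-removeAt e c (proj₁ (good (proj₁ (∈-removedLight z∈))))) }))
                 (sum-map-≤-split many? (λ B → length (edges B)) σ′ M (subsetsOfSize n k′)
                   (λ B∈ → edges-bound (∣p∣-of-∈-subsetsOfSize n k′ B∈)) (λ _ ¬many → ≤-pred (≰⇒> ¬many))))

      in-T : ∀ {B z} → z ∈ edges B → proj₁ z ∈ T
      in-T z∈ = proj₁ (∈-removedLight (proj₁ (∈-fibre⁻ base removedLight z∈)))

      spans : ∀ {B z} → z ∈ edges B → toSet (proj₁ z) ≡ ⁅ centre z ⁆ ∪ B
      spans {B} {e , (i , c)} z∈ =
        trans (toSet-removeAt e c) (cong (⁅ lookup e c ⁆ ∪_) (proj₂ (∈-fibre⁻ base removedLight z∈)))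

      -- Base and centre determine the edge as a set, each edge of F has a single ordering in T, and
      -- each tuple is removed once.
      centre-injective : ∀ {B z z′} → z ∈ edges B → z′ ∈ edges B → centre z ≡ centre z′ → z ≡ z′
      centre-injective {B} p p′ eq = Unique-map⇒injective-on proj₁ Unique-removedLight
        (proj₁ (∈-fibre⁻ base removedLight p)) (proj₁ (∈-fibre⁻ base removedLight p′))
        (Unique-map⇒injective-on toSet uF (in-T p) (in-T p′)
          (trans (spans p) (trans (cong (λ x → ⁅ x ⁆ ∪ B) eq) (sym (spans p′)))))

      centre-good : ∀ {B z} → z ∈ edges B → centre z ∉ˢ B × ⁅ centre z ⁆ ∪ B ∈ F
      centre-good {B} {e , (i , c)} z∈ =
        subst (lookup e c ∉ˢ_) (proj₂ (∈-fibre⁻ base removedLight z∈)) (lookup-∉-removeAt e c (proj₁ (good (in-T z∈))))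
        , subst (_∈ F) (spans z∈) (proj₂ (good (in-T z∈)))

      item-of-base : ∀ {B} → B ∈ bases → ∃[ z ] (toSet (proj₁ z) ≡ B × GoodItem {n} {k′} {σ} F z)
      item-of-base {B} B∈ =
        centres-of-base B (∣p∣-of-∈-subsetsOfSize n k′ (proj₁ B∈′)) (map centre (edges B))
          (Unique-map-on centre centre-injective (Uniqueₚ.filter⁺ _ uΛ)) ok
          (subst (suc σ′ ≤_) (sym (length-map centre (edges B))) (proj₂ B∈′))
        where
        B∈′ : B ∈ subsetsOfSize n k′ × suc σ′ ≤ length (edges B)
        B∈′ = ∈-filter⁻ many? {xs = subsetsOfSize n k′} B∈
        ok : ∀ {x} → x ∈ map centre (edges B) → x ∉ˢ B × ⁅ x ⁆ ∪ B ∈ F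
        ok x∈ = let z , z∈ , eq = ∈-map⁻ centre x∈
                in subst (λ x → x ∉ˢ B × ⁅ x ⁆ ∪ B ∈ F) (sym eq) (centre-good z∈)

    private
      Items : Set
      Items = ManyItems k″ σ′ (2 * q * M) (2 * (σ′ * (2 * q * M) + M)) F

      instance
        R≢0 : NonZero (R₀ k)
        R≢0 = R₀≢0 k

      from-core : ∀ {e₀} → e₀ ∈ core → Copies k (length F) (s ^ s * (K * suc s ^ k) ^ length H) H F
      from-core {e₀} e₀∈ = subst (λ X → Copies k X (s ^ s * (K * suc s ^ k) ^ length H) H F) ∣T∣
        (copies-of-heavy-core tree {K = K} core Unique-core e₀ e₀∈ (λ e∈ → good (∈-core e∈))
          (λ e∈ P → core-degree e∈ zero P) (λ e∈ c → core-heavy e∈ zero (∈-allFin c)))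

      from-empty : core ≡ [] → Items
      from-empty empty =
        let Z , eq , goodZ = choose-preimages (toSet ∘ proj₁) bases item-of-base
        in Z , subst Unique (sym eq) (Uniqueₚ.filter⁺ many? (Unique-subsetsOfSize n k′)) , goodZ
        , subst (λ b → n C k′ ≤ 2 * q * M * b × length F ≤ 2 * (σ′ * (2 * q * M) + M) * b)
            (trans (cong length (sym eq)) (length-map (toSet ∘ proj₁) Z))
            (light-arithmetic (R₀ k) q σ′ (n C k′) M (length F) (length removedLight) (length bases) bound light-bound dense)
        where
        bound : K * length F ≤ K * length removedLight + R₀ k * length F
        bound = subst₂ (λ X c → K * X ≤ K * (c + length removedLight) + R₀ k * X) ∣T∣ (cong length empty)
          (subst (λ r → K * length T ≤ K * (length core + length removedLight) + r * length T) (*-identityˡ (R₀ k)) pruning-bound)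

    copies-or-items : Copies k (length F) (s ^ s * (K * suc s ^ k) ^ length H) H F ⊎ Items
    copies-or-items = Sum.map (from-core ∘ proj₂) from-empty (Sum.swap (empty-or-inhabited core))

  opaque

    light-edges : {k″ s σ′ : ℕ} {H : List (Subset s)} → IsKTree (2 + k″) s H → (q : ℕ) →
      ∃[ K ] ∃[ M ] ∃[ A ] (∀ {n} {{_ : NonZero n}} {F : List (Subset n)} → IsKGraph (2 + k″) n F →
        suc (q * σ′) * (n C suc k″) ≤ q * length F → Copies (2 + k″) (length F) K H F ⊎ ManyItems k″ σ′ M A F)
    light-edges {k″} {s} {σ′} {H} tree q = Kᴵ , M , W , by-pruning
      where
      k Kᴵ M W : ℕ
      k = 2 + k″
      Kᴵ = s ^ s * (K₁ k q σ′ * suc s ^ k) ^ length H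
      M = 2 * q * multiplicity (suc k″) s
      W = 2 * (σ′ * (2 * q * multiplicity (suc k″) s) + multiplicity (suc k″) s)
      by-pruning : ∀ {n} {{_ : NonZero n}} {F : List (Subset n)} → IsKGraph k n F →
        suc (q * σ′) * (n C suc k″) ≤ q * length F → Copies k (length F) Kᴵ H F ⊎ ManyItems k″ σ′ M W F
      by-pruning {n} {F} graph dense =
        LightEdges.copies-or-items tree q dense T uF (trans (sym (length-map toSet T)) (cong length toSet≡)) good
          (Pruning.prune _ _ s (K₁ k q σ′) {{m*n≢0 (R₀ k) (2 * suc (q * σ′)) {{R₀≢0 k}}}} T (Uniqueₚ.map⁻ uF))
        where
        ordered : ∀ {e} → e ∈ F → ∃[ v ] (toSet v ≡ e × Distinct {n} {k} v)
        ordered e∈ with v , d , eq ← enumerate _ (All.lookup (proj₂ graph) e∈) = v , eq , d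
        -- One arbitrary ordering per edge, so that |T| = |F| and no edge is counted at several
        -- orderings.
        chosen : ∃[ T ] (map toSet T ≡ F × All (Distinct {n} {k}) T)
        chosen = choose-preimages toSet F ordered
        T : Tuples n k
        T = proj₁ chosen
        toSet≡ : map toSet T ≡ F
        toSet≡ = proj₁ (proj₂ chosen)
        uF : Unique (map toSet T)
        uF = subst Unique (sym toSet≡) (proj₁ graph)
        good : ∀ {e} → e ∈ T → Distinct e × toSet e ∈ F
        good {e} e∈ = All.lookup (proj₂ (proj₂ chosen)) e∈ , subst (toSet e ∈_) toSet≡ (∈-map⁺ toSet e∈)

  -- An item demands class zero on its base and class i + 1 at its i-th centre. The demands do not
  -- conflict, as centres are distinct and lie outside the base; there are at most k′ + σ of them
  -- and σ + 1 classes.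
  colour-items : {n k′ σ : ℕ} {F : List (Subset n)} (Z₀ : List (Item n k′ σ)) → Unique Z₀ → All (GoodItem F) Z₀ →
    ∃[ cls ] ∃[ Z ] (Unique Z × (∀ {z} → z ∈ Z → z ∈ Z₀) ×
      (∀ {z} → z ∈ Z → ∀ c → lookup cls (lookup (proj₁ z) c) ≡ zero) ×
      (∀ {z} → z ∈ Z → ∀ i → lookup cls (lookup (proj₂ z) i) ≡ suc i) ×
      length Z₀ ≤ suc σ ^ (k′ + σ) * length Z)
  colour-items {n} {k′} {σ} {F} Z₀ u good =
    let cls , bound = colouring-exists vertices colour (k′ + σ) Z₀ (s≤s z≤n) (λ {z} _ → small z)
    in cls , filter (consistent? vertices colour cls) Z₀ , Uniqueₚ.filter⁺ _ u
       , (λ z∈ → proj₁ (back cls z∈)) , base-class cls , centre-class cls , bound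
    where
    vertices : Item n k′ σ → Subset n
    vertices (b , x) = toSet b ∪ toSet x
    index? : (z : Item n k′ σ) (v : Fin n) → Dec (∃[ i ] lookup (proj₂ z) i ≡ v)
    index? z v = Finₚ.any? (λ i → lookup (proj₂ z) i Finₚ.≟ v)
    colour : Item n k′ σ → Fin n → Fin (suc σ)
    colour z v with index? z v
    ... | yes (i , _) = suc i
    ... | no _        = zero
    small : ∀ z → ∣ vertices z ∣ ≤ k′ + σ
    small (b , x) = ≤-trans (m≤m+n _ ∣ toSet b ∩ toSet x ∣)
      (≤-trans (≤-reflexive (∣p∪q∣+∣p∩q∣ (toSet b) (toSet x))) (+-mono-≤ (∣toSet∣≤ b) (∣toSet∣≤ x)))
    back : ∀ cls {z} → z ∈ filter (consistent? vertices colour cls) Z₀ → z ∈ Z₀ × Consistent vertices colour cls z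
    back cls = ∈-filter⁻ (consistent? vertices colour cls)
    base-class : ∀ cls {z} → z ∈ filter (consistent? vertices colour cls) Z₀ → ∀ c → lookup cls (lookup (proj₁ z) c) ≡ zero
    base-class cls {z} z∈ c with z∈₀ , con ← back cls z∈ =
      trans (con _ (p⊆p∪q (toSet (proj₂ z)) (∈-toSet⁺ (proj₁ z) c))) zero-colour
      where
      zero-colour : colour z (lookup (proj₁ z) c) ≡ zero
      zero-colour with index? z (lookup (proj₁ z) c)
      ... | no _ = refl
      ... | yes (i , eq) with _ , _ , h ← All.lookup good z∈₀ =
        ⊥-elim (proj₁ (h i) (subst (_∈ˢ toSet (proj₁ z)) (sym eq) (∈-toSet⁺ (proj₁ z) c)))
    centre-class : ∀ cls {z} → z ∈ filter (consistent? vertices colour cls) Z₀ → ∀ i → lookup cls (lookup (proj₂ z) i) ≡ suc i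
    centre-class cls {z} z∈ i with z∈₀ , con ← back cls z∈ =
      trans (con _ (q⊆p∪q (toSet (proj₁ z)) _ (∈-toSet⁺ (proj₂ z) i))) suc-colour
      where
      suc-colour : colour z (lookup (proj₂ z) i) ≡ suc i
      suc-colour with index? z (lookup (proj₂ z) i)
      ... | no ¬p = ⊥-elim (¬p (i , refl))
      ... | yes (j , eq) with _ , dx , _ ← All.lookup good z∈₀ = cong suc (dx eq)

  K₂ : (k σ : ℕ) → ℕ
  K₂ k σ = σ * R₀ k * 2

  K₃ : (k : ℕ) → ℕ
  K₃ k = R₀ k * 2

  -- The second peeling and families with two sparse directions.

  module SparseFamily {k″ s : ℕ} {H : List (Subset s)} (tree : IsKTree (2 + k″) s H) (pairs : PrivatePairs H)
    {n : ℕ} {F : List (Subset n)} where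

    private
      k K : ℕ
      k = 2 + k″
      K = K₃ k

    module _ (c₀ : Fin (suc k″)) (D : Tuples n k) (0<D : 0 < length D)
      (good : ∀ {e} → e ∈ D → Distinct e × toSet e ∈ F)
      (sparse₀ : ∀ e → length (filter (agreeAway? zero e) D) ≤ suc s)
      (sparse₁ : ∀ e → length (filter (agreeAway? (suc c₀) e) D) ≤ suc s)
      (large : 2 * (K * (k * (suc s * s)) * n ^ k″) ≤ length D)
      (pruned : Pruned {m = 1} (λ _ e → e) [] s K D) where

      private module Pr = Pruned pruned

      private
        instance
          R≢0 : NonZero (R₀ k)
          R≢0 = R₀≢0 k

        no-light : length Pr.removedLight ≡ 0
        no-light with empty-or-inhabited Pr.removedLight
        ... | inj₁ eq = cong length eq
        ... | inj₂ (_ , z∈) with () ← proj₂ (Pr.∈-removedLight z∈)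

        core≢[] : ¬ Pr.core ≡ []
        core≢[] eq = <⇒≱ 0<D (*-cancelˡ-≤ (R₀ k) (+-cancelʳ-≤ (R₀ k * d) _ _ (begin
          R₀ k * d + R₀ k * d
            ≡⟨ e (R₀ k) d ⟩
          K * d
            ≤⟨ Pr.pruning-bound ⟩
          K * (length Pr.core + length Pr.removedLight) + 1 * R₀ k * d
            ≡⟨ cong₂ (λ x y → K * (x + y) + 1 * R₀ k * d) (cong length eq) no-light ⟩
          K * 0 + 1 * R₀ k * d
            ≡⟨ e′ (R₀ k) d ⟩
          R₀ k * 0 + R₀ k * d ∎)))
          where
          open ≤-Reasoning
          d : ℕ
          d = length D
          e : ∀ a b → a * b + a * b ≡ a * 2 * b
          e = solve-∀
          e′ : ∀ a b → a * 2 * 0 + 1 * a * b ≡ a * 0 + a * b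
          e′ = solve-∀

        shrink : ∀ c e → length (filter (agreeAway? c e) Pr.core) ≤ length (filter (agreeAway? c e) D)
        shrink c e = length≤-of-⊆ (Uniqueₚ.filter⁺ _ Pr.Unique-core)
          (λ x∈ → let p , eq = ∈-filter⁻ (agreeAway? c e) {xs = Pr.core} x∈ in ∈-filter⁺ (agreeAway? c e) (Pr.∈-core p) eq)

      -- With no light reasons, and K twice the number of low ones, at most half of D is removed.
      -- The core is thus nonempty, and it inherits both sparse directions as a subfamily of D.
      copies-of-sparse-family : Copies k (length D) (s ^ s * (2 * K) ^ length H) H F
      copies-of-sparse-family with empty-or-inhabited Pr.core
      ... | inj₁ eq = ⊥-elim (core≢[] eq)
      ... | inj₂ (e₀ , e₀∈) =
        copies-of-sparse-core tree pairs c₀ {K = K} {b = suc s} Pr.core Pr.Unique-core e₀ e₀∈ (λ e∈ → good (Pr.∈-core e∈))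
          (λ e∈ P → Pr.core-degree e∈ zero P)
          (λ { true e → ≤-trans (shrink zero e) (sparse₀ e) ; false e → ≤-trans (shrink (suc c₀) e) (sparse₁ e) })
          large

  module CentredItems {k″ s σ′ : ℕ} {H : List (Subset s)} (tree : IsKTree (2 + k″) s H) (pairs : PrivatePairs H)
    (S : Subset s) (crossCut : IsCrossCut H S) (∣S∣≡σ : ∣ S ∣ ≡ suc σ′)
    {n : ℕ} {F : List (Subset n)} where

    private
      k k′ σ K K′ N₂ : ℕ
      k = 2 + k″
      k′ = suc k″
      σ = suc σ′
      K = K₂ k σ
      K′ = K₃ k
      N₂ = σ * k′

    open SparseFamily tree pairs {n} {F} using (copies-of-sparse-family)

    module _ (Z : List (Item n k′ σ)) (0<Z : 0 < length Z)
      (determined : ∀ {z z′} → z ∈ Z → z′ ∈ Z → proj₁ z ≡ proj₁ z′ → z ≡ z′)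
      (good : ∀ {z} → z ∈ Z → ∀ i → Distinct (arm i z) × toSet (arm i z) ∈ F)
      (cls : Vec (Fin (suc σ)) n)
      (base-class : ∀ {z} → z ∈ Z → ∀ c → lookup cls (lookup (proj₁ z) c) ≡ zero)
      (centre-class : ∀ {z} → z ∈ Z → ∀ i → lookup cls (lookup (proj₂ z) i) ≡ suc i)
      (large : 2 * N₂ * (2 * (K′ * (k * (suc s * s)) * n ^ k″)) ≤ length Z)
      (pruned : Pruned {m = σ} arm (map suc (allFin k′)) s K Z)
      (prune-D : ∀ D → Unique D → Pruned {n} {k′} {1} (λ _ e → e) [] s K′ D) where

      private module Pr = Pruned pruned
      open Pruned pruned using (core; removedLight)

      private
        instance
          R≢0 : NonZero (R₀ k)
          R≢0 = R₀≢0 k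
          σR≢0 : NonZero (σ * R₀ k)
          σR≢0 = m*n≢0 σ (R₀ k)

        lights : List (Fin k)
        lights = map suc (allFin k′)

        from-core : ∀ {z₀} → z₀ ∈ core → Copies k (length Z) (s ^ s * (K * suc s ^ k) ^ length H) H F
        from-core {z₀} z₀∈ = copies-of-centred-core tree S crossCut ∣S∣≡σ {K = K} core Pr.Unique-core z₀ z₀∈
          (λ p q → determined (Pr.∈-core p) (Pr.∈-core q)) (λ z∈ → good (Pr.∈-core z∈)) cls
          (λ z∈ → base-class (Pr.∈-core z∈)) (λ z∈ → centre-class (Pr.∈-core z∈))
          Pr.core-degree (λ z∈ i c → Pr.core-heavy z∈ i (∈-map⁺ suc (∈-allFin c)))

        open Fibres (eqL {σ} {k})

        family : LightReason σ k → List (Item n k′ σ × LightReason σ k)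
        family r = fibre proj₂ r removedLight

        -- K is twice the number σ 2^k of low reasons, so these account for at most half of Z.
        mostly-light : core ≡ [] → length Z ≤ 2 * length removedLight
        mostly-light empty = *-cancelˡ-≤ (σ * R₀ k) (+-cancelʳ-≤ (σ * R₀ k * length Z) _ _ (begin
          σ * R₀ k * length Z + σ * R₀ k * length Z
            ≡⟨ e (σ * R₀ k) (length Z) ⟩
          K * length Z
            ≤⟨ Pr.pruning-bound ⟩
          K * (length core + length removedLight) + σ * R₀ k * length Z
            ≡⟨ cong (λ x → K * (x + length removedLight) + σ * R₀ k * length Z) (cong length empty) ⟩
          K * length removedLight + σ * R₀ k * length Z
            ≡⟨ cong (_+ σ * R₀ k * length Z) (*-assoc (σ * R₀ k) 2 (length removedLight)) ⟩
          σ * R₀ k * (2 * length removedLight) + σ * R₀ k * length Z ∎))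
          where
          open ≤-Reasoning
          e : ∀ a b → a * b + a * b ≡ a * 2 * b
          e = solve-∀

        popular-reason : ∃[ r ] (r ∈ (lightReasons σ lights) × length removedLight ≤ N₂ * length (family r))
        popular-reason = let r , r∈ , le = sum-≤-max (λ r → length (family r)) (lightReasons σ lights) nonempty in
          r , r∈ , subst (λ l → length removedLight ≤ l * length (family r)) length-reasons
            (≤-trans (length≤sum-fibres proj₂ removedLight (lightReasons σ lights)
              (λ z∈ → ∈-cartesianProduct⁺ (∈-allFin _) (proj₂ (Pr.∈-removedLight z∈)))) le)
          where
          length-reasons : length (lightReasons σ lights) ≡ N₂
          length-reasons = trans (length-cartesianProductWith _,_ (allFin σ) lights)
            (cong₂ _*_ (length-tabulate {n = σ} id) (trans (length-map suc (allFin k′)) (length-tabulate {n = k′} id)))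
          nonempty : 0 < length (lightReasons σ lights)
          nonempty = subst (0 <_) (sym length-reasons) (s≤s z≤n)

        -- For a fixed light reason, the i-th arms are sparse in two directions: along the centre,
        -- because the base determines the item, and along the position `suc c₀` for which they were
        -- removed. The private vertices will be placed at these two positions.
        module Popular (i : Fin σ) (c₀ : Fin k′) where

          fam : List (Item n k′ σ × LightReason σ k)
          fam = family (i , suc c₀)

          tuple : Item n k′ σ × LightReason σ k → Vec (Fin n) k
          tuple z = arm i (proj₁ z)

          D : Tuples n k
          D = map tuple fam

          fam⁻ : ∀ {z} → z ∈ fam → z ∈ removedLight × proj₁ z ∈ Z
          fam⁻ z∈ = let p , _ = ∈-fibre⁻ proj₂ removedLight z∈ in p , proj₁ (Pr.∈-removedLight p)

          same-base : ∀ {z z′} → z ∈ fam → z′ ∈ fam → proj₁ (proj₁ z) ≡ proj₁ (proj₁ z′) → z ≡ z′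
          same-base p p′ eq = Unique-map⇒injective-on proj₁ Pr.Unique-removedLight (proj₁ (fam⁻ p)) (proj₁ (fam⁻ p′))
            (determined (proj₂ (fam⁻ p)) (proj₂ (fam⁻ p′)) eq)

          uD : Unique D
          uD = Unique-map-on tuple (λ p p′ eq → same-base p p′ (proj₂ (∷-injective eq)))
                 (Uniqueₚ.filter⁺ _ (Uniqueₚ.map⁻ Pr.Unique-removedLight))

          goodD : ∀ {e} → e ∈ D → Distinct e × toSet e ∈ F
          goodD e∈ = let z , z∈ , eq = ∈-map⁻ tuple e∈
                     in subst (λ e → Distinct e × toSet e ∈ F) (sym eq) (good (proj₂ (fam⁻ z∈)) i)

          sparse₀ : ∀ e → length (filter (agreeAway? zero e) D) ≤ suc s
          -- Mapping into a one-element list expresses that at most one tuple of D has a given base.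
          sparse₀ e = ≤-trans (length≤-of-injection (λ _ → Unit.tt) {ys = Unit.tt ∷ []} (Uniqueₚ.filter⁺ _ uD) same (λ _ → here refl))
                              (s≤s z≤n)
            where
            same : ∀ {x y} → x ∈ filter (agreeAway? zero e) D → y ∈ filter (agreeAway? zero e) D → Unit.tt ≡ Unit.tt → x ≡ y
            same p q _ =
              let p′ , ep = ∈-filter⁻ (agreeAway? zero e) {xs = D} p
                  q′ , eq = ∈-filter⁻ (agreeAway? zero e) {xs = D} q
                  z , z∈ , ez = ∈-map⁻ tuple p′
                  w , w∈ , ew = ∈-map⁻ tuple q′
              in trans ez (trans (cong tuple (same-base z∈ w∈
                   (trans (sym (cong (λ v → removeAt v zero) ez)) (trans ep (trans (sym eq) (cong (λ v → removeAt v zero) ew)))))) (sym ew))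

          sparse₁ : ∀ e → length (filter (agreeAway? (suc c₀) e) D) ≤ suc s
          sparse₁ e = ≤-trans (≤-reflexive (length-filter-map (agreeAway? (suc c₀) e) tuple fam))
                              (m≤n⇒m≤1+n (Pr.removedLight-sparse i (suc c₀) (removeAt e (suc c₀))))

          module _ (Z≤ : length Z ≤ 2 * N₂ * length D) where

            0<D : 0 < length D
            0<D with length D
            ... | suc _ = s≤s z≤n
            ... | zero  = ⊥-elim (<⇒≱ 0<Z (≤-trans Z≤ (≤-reflexive (*-zeroʳ (2 * N₂)))))

            copies-of-popular : Copies k (length Z) ((2 * N₂) ^ length H * (s ^ s * (2 * K′) ^ length H)) H F
            copies-of-popular = Copies-rescale {A = 2 * N₂} Z≤
              (copies-of-sparse-family c₀ D 0<D goodD sparse₀ sparse₁ (*-cancelˡ-≤ (2 * N₂) (≤-trans large Z≤))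
                (prune-D D uD))

        from-empty : core ≡ [] → Copies k (length Z) ((2 * N₂) ^ length H * (s ^ s * (2 * K′) ^ length H)) H F
        from-empty empty with (i , c) , r∈ , le ← popular-reason
          with c₀ , _ , refl ← ∈-map⁻ suc (proj₂ (∈-cartesianProduct⁻ (allFin σ) lights r∈)) =
          Popular.copies-of-popular i c₀ (begin
            length Z                                    ≤⟨ mostly-light empty ⟩
            2 * length removedLight                     ≤⟨ *-monoʳ-≤ 2 le ⟩
            2 * (N₂ * length (family (i , suc c₀)))     ≡⟨ *-assoc 2 N₂ _ ⟨
            2 * N₂ * length (family (i , suc c₀))       ≡⟨ cong (2 * N₂ *_) (length-map (Popular.tuple i c₀) (family (i , suc c₀))) ⟨
            2 * N₂ * length (Popular.D i c₀)            ∎)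
          where open ≤-Reasoning

      copies-of-centred-items : Copies k (length Z)
        (s ^ s * (K * suc s ^ k) ^ length H + (2 * N₂) ^ length H * (s ^ s * (2 * K′) ^ length H)) H F
      copies-of-centred-items with empty-or-inhabited core
      ... | inj₂ (_ , z∈) = Copies-weaken (m≤m+n _ _) (from-core z∈)
      ... | inj₁ empty    = Copies-weaken (m≤n+m _ _) (from-empty empty)

  opaque

    -- X is the number of items that survive the colouring. It has to dominate n^(k-2) in case
    -- nothing survives the peeling, since there the tuples meeting U are subtracted.
    centred-items : {k″ s σ′ : ℕ} {H : List (Subset s)} → IsKTree (2 + k″) s H → PrivatePairs H →
      (S : Subset s) → IsCrossCut H S → ∣ S ∣ ≡ suc σ′ →
      ∃[ K ] ∃[ L ] ∃[ c ] (∀ {n} {{_ : NonZero n}} {F : List (Subset n)} (Z₀ : List (Item n (suc k″) (suc σ′))) →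
        Unique (map (toSet ∘ proj₁) Z₀) → All (GoodItem F) Z₀ →
        ∃[ X ] (length Z₀ ≤ c * X × (0 < X → L * n ^ k″ ≤ X → Copies (2 + k″) X K H F)))
    centred-items {k″} {s} {σ′} {H} tree pairs S crossCut ∣S∣≡σ =
      s ^ s * (K₂ k σ * suc s ^ k) ^ length H + (2 * N₂) ^ length H * (s ^ s * (2 * K₃ k) ^ length H)
      , 2 * N₂ * (2 * (K₃ k * (k * (suc s * s))))
      , suc σ ^ (k′ + σ)
      , λ Z₀ uB goodZ →
          let cls , Z , uZ , Z⊆ , base-class , centre-class , Z₀≤ = colour-items Z₀ (Uniqueₚ.map⁻ uB) goodZ
          in length Z , Z₀≤ , λ 0<Z large →
             CentredItems.copies-of-centred-items tree pairs S crossCut ∣S∣≡σ Z 0<Z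
                (λ p p′ eq → Unique-map⇒injective-on (toSet ∘ proj₁) uB (Z⊆ p) (Z⊆ p′) (cong toSet eq))
                (λ {z} z∈ i → let g = All.lookup goodZ (Z⊆ z∈) in (λ {c} {d} → arm-distinct z g i {c} {d}) , proj₂ (proj₂ (proj₂ g) i))
                cls base-class centre-class (≤-trans (≤-reflexive (regroup (2 * N₂) (K₃ k * (k * (suc s * s))) _)) large)
                (Pruning.prune _ _ s (K₂ k σ) {{m*n≢0 (σ * R₀ k) 2 {{m*n≢0 σ (R₀ k) {{_}} {{R₀≢0 k}}}}}} Z uZ)
                (λ D uD → Pruning.prune _ _ s (K₃ k) {{m*n≢0 (R₀ k) 2 {{R₀≢0 k}}}} D uD)
      where
      k k′ σ N₂ : ℕ
      k = 2 + k″
      k′ = suc k″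
      σ = suc σ′
      N₂ = σ * k′
      regroup : ∀ a b x → a * (2 * (b * x)) ≡ a * (2 * b) * x
      regroup = solve-∀

  -- Assembling the count.

  module _ {k″ s σ′ : ℕ} {H : List (Subset s)} (tree : IsKTree (2 + k″) s H) (pairs : PrivatePairs H)
    (S : Subset s) (crossCut : IsCrossCut H S) (∣S∣≡σ : ∣ S ∣ ≡ suc σ′) (q : ℕ) where

    private
      k k′ t : ℕ
      k = 2 + k″
      k′ = suc k″
      t = length H

    opaque

      supersaturation : ∃[ K ] ∃[ n₀ ] (∀ n → n ≥ n₀ → (F : List (Subset n)) → IsKGraph k n F →
        suc (q * σ′) * (n C k′) ≤ q * length F → Copies k (length F) K H F)
      supersaturation
        with c₀ , power≤ ← n^j≤c*nCj k′
        with Kᴵ , M , A , light ← light-edges {σ′ = σ′} tree q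
        with Kᶜ , L , c₁ , centred ← centred-items tree pairs S crossCut ∣S∣≡σ
        = Kᴵ + (A * c₁) ^ t * Kᶜ , suc k′ + suc (c₀ * M * c₁) * L , bound
        where
        open ≤-Reasoning
        G : ℕ
        G = c₀ * M * c₁
        bound : ∀ n → n ≥ suc k′ + suc G * L → (F : List (Subset n)) → IsKGraph k n F →
          suc (q * σ′) * (n C k′) ≤ q * length F → Copies k (length F) (Kᴵ + (A * c₁) ^ t * Kᶜ) H F
        bound n n≥ F graph dense = decide (light graph dense)
          where
          k′<n : k′ < n
          k′<n = ≤-trans (m≤m+n (suc k′) (suc G * L)) n≥
          instance
            n≢0 : NonZero n
            n≢0 = >-nonZero (≤-trans (s≤s z≤n) k′<n)
          decide : Copies k (length F) Kᴵ H F ⊎ ManyItems k″ σ′ M A F →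
            Copies k (length F) (Kᴵ + (A * c₁) ^ t * Kᶜ) H F
          decide (inj₁ cs) = Copies-weaken (m≤m+n Kᴵ _) cs
          decide (inj₂ (Z , uB , good , C≤ , F≤)) with X , Z≤ , cs ← centred Z uB good =
            Copies-weaken (m≤n+m _ Kᴵ) (Copies-rescale {A = A * c₁} F≤X (cs 0<X large))
            where
            F≤X : length F ≤ A * c₁ * X
            F≤X = begin
              length F       ≤⟨ F≤ ⟩
              A * length Z   ≤⟨ *-monoʳ-≤ A Z≤ ⟩
              A * (c₁ * X)   ≡⟨ *-assoc A c₁ X ⟨
              A * c₁ * X     ∎
            power≤X : n ^ k′ ≤ G * X
            power≤X = begin
              n ^ k′                 ≤⟨ power≤ n k′<n ⟩
              c₀ * (n C k′)          ≤⟨ *-monoʳ-≤ c₀ C≤ ⟩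
              c₀ * (M * length Z)    ≤⟨ *-monoʳ-≤ c₀ (*-monoʳ-≤ M Z≤) ⟩
              c₀ * (M * (c₁ * X))    ≡⟨ e c₀ M c₁ X ⟩
              G * X                  ∎
              where
              e : ∀ a b c d → a * (b * (c * d)) ≡ a * b * c * d
              e = solve-∀
            0<X : 0 < X
            0<X = n≢0⇒n>0 (λ { refl → <⇒≱ (m^n>0 n k′) (≤-trans power≤X (≤-reflexive (*-zeroʳ G))) })
            -- X has order at least n^(k-1), one power of n more than required; n ≥ (G + 1) L
            -- absorbs the constants. The successor keeps the factor to be cancelled nonzero.
            large : L * n ^ k″ ≤ X
            large = *-cancelˡ-≤ (suc G) (begin
              suc G * (L * n ^ k″)   ≡⟨ *-assoc (suc G) L (n ^ k″) ⟨
              suc G * L * n ^ k″     ≤⟨ *-monoˡ-≤ (n ^ k″) (≤-trans (m≤n+m (suc G * L) (suc k′)) n≥) ⟩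
              n * n ^ k″             ≤⟨ power≤X ⟩
              G * X                  ≤⟨ *-monoˡ-≤ X (n≤1+n G) ⟩
              suc G * X              ∎)

      -- Splitting n^(kt) as n^t (n^(k-1))^t, the first factor cancels to leave n^(s-t), and the
      -- second becomes a power of the binomial coefficient, so that |F| / C(n, k-1) = a can be read
      -- off.
      supersaturation-binomial : ∃[ K ] ∃[ n₀ ] (∀ n → n ≥ n₀ → (F : List (Subset n)) → IsKGraph k n F →
        suc (q * σ′) * (n C k′) ≤ q * length F →
        NonZero (n C k′) × ∃[ Cs ] (CopiesList H F Cs × length F ^ t * n ^ (s ∸ t) ≤ K * length Cs * (n C k′) ^ t))
      supersaturation-binomial 
        with K , n₀ , h ← supersaturation
        with c₀ , power≤ ← n^j≤c*nCj k′ = K * c₀ ^ t , n₀ + suc k′ , bound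
        where
        open ≤-Reasoning
        bound : ∀ n → n ≥ n₀ + suc k′ → (F : List (Subset n)) → IsKGraph k n F → suc (q * σ′) * (n C k′) ≤ q * length F →
          NonZero (n C k′) ×
          ∃[ Cs ] (CopiesList H F Cs × length F ^ t * n ^ (s ∸ t) ≤ K * c₀ ^ t * length Cs * (n C k′) ^ t)
        bound n n≥ F graph dense with copies Cs valid many ← h n (≤-trans (m≤m+n n₀ (suc k′)) n≥) F graph dense =
          C≢0 , Cs , valid , *-cancelʳ-≤ _ _ (n ^ t) {{m^n≢0 n t}} (begin
            length F ^ t * n ^ (s ∸ t) * n ^ t             ≡⟨ *-assoc (length F ^ t) (n ^ (s ∸ t)) (n ^ t) ⟩
            length F ^ t * (n ^ (s ∸ t) * n ^ t)           ≡⟨ cong (length F ^ t *_) (^-distribˡ-+-* n (s ∸ t) t) ⟨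
            length F ^ t * n ^ (s ∸ t + t)                 ≡⟨ cong (λ x → length F ^ t * n ^ x) (m∸n+n≡m (PrivatePairs.t≤s pairs)) ⟩
            length F ^ t * n ^ s                           ≤⟨ many ⟩
            K * length Cs * n ^ (t + k′ * t)               ≡⟨ cong (K * length Cs *_) (^-distribˡ-+-* n t (k′ * t)) ⟩
            K * length Cs * (n ^ t * n ^ (k′ * t))         ≡⟨ cong (λ x → K * length Cs * (n ^ t * x)) (^-*-assoc n k′ t) ⟨
            K * length Cs * (n ^ t * (n ^ k′) ^ t)         ≤⟨ *-monoʳ-≤ (K * length Cs) (*-monoʳ-≤ (n ^ t) (^-monoˡ-≤ t (power≤ n k′<n))) ⟩
            K * length Cs * (n ^ t * (c₀ * (n C k′)) ^ t)  ≡⟨ cong (λ x → K * length Cs * (n ^ t * x)) (^-distribʳ-* t c₀ (n C k′)) ⟩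
            K * length Cs * (n ^ t * (c₀ ^ t * (n C k′) ^ t)) ≡⟨ e K (length Cs) (n ^ t) (c₀ ^ t) ((n C k′) ^ t) ⟩
            K * c₀ ^ t * length Cs * (n C k′) ^ t * n ^ t  ∎)
          where
          k′<n : k′ < n
          k′<n = ≤-trans (m≤n+m (suc k′) n₀) n≥
          instance
            n≢0 : NonZero n
            n≢0 = >-nonZero (≤-trans (s≤s z≤n) k′<n)
          C≢0 : NonZero (n C k′)
          C≢0 = ≢-nonZero (λ eq → <⇒≱ (m^n>0 n k′)
            (≤-trans (power≤ n k′<n) (≤-reflexive (trans (cong (c₀ *_) eq) (*-zeroʳ c₀)))))
          e : ∀ a b c d x → a * b * (c * (d * x)) ≡ a * d * b * x * c
          e = solve-∀

open import Defs
open import Data.Nat using (ℕ; _≥_; _∸_)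
open import Data.Nat.Combinatorics using (_C_)
open import Data.Fin.Subset using (Subset)
open import Data.List using (List; length)
open import Data.Product using (Σ; ∃; ∃-syntax; _×_)
open import Data.Integer using (+_)
open import Data.Rational using (ℚ; 0ℚ; 1ℚ; _+_; _-_; _*_; _≤_; _<_; _/_)
open import Relation.Binary.PropositionalEquality using (_≡_)
open import Data.Nat using (zero; suc; s≤s)
open import Data.Nat.Properties using (<⇒≢)
open import Data.Rational using (module ℚ)
open import Data.Rational.Properties using (positive⁻¹; normalize-pos)
open import Data.Product using (_,_)
open import Data.Empty using (⊥-elim)
open import Relation.Binary.PropositionalEquality using (sym)

open Combinatorics using (crossCut-nonempty; private-pairs; supersaturation-binomial)

-- Translation between rational and natural bounds.

private
  module RationalBounds where
    open import Data.Nat as ℕ using (ℕ; suc)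
    import Data.Nat.Properties as ℕₚ
    import Data.Integer as ℤ
    import Data.Integer.Properties as ℤₚ
    open import Data.Rational using (module ℚ; -_; toℚᵘ; mkℚ; Positive; positive)
    open import Data.Rational.Unnormalised as ℚᵘ using (ℚᵘ; mkℚᵘ; *≡*; *≤*)
    import Data.Rational.Unnormalised.Properties as ℚᵘₚ
    open import Data.Rational.Properties
    open import Algebra.Bundles using (CommutativeMonoid)
    open import Algebra.Properties.CommutativeSemigroup (CommutativeMonoid.commutativeSemigroup *-1-commutativeMonoid) using (interchange; xy∙z≈xz∙y)
    open import Relation.Binary.PropositionalEquality using (refl; sym; trans; cong; cong₂; subst; subst₂)

    ι : ℕ → ℚ
    ι m = + m / 1

    1/[1+_] : ℕ → ℚ
    1/[1+ d ] = + 1 / suc d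

    ι-+ : ∀ m n → ι (m ℕ.+ n) ≡ ι m + ι n
    ι-+ m n = toℚᵘ-injective (begin-equality
      toℚᵘ (ι (m ℕ.+ n))                    ≃⟨ toℚᵘ-fromℚᵘ (mkℚᵘ (+ (m ℕ.+ n)) 0) ⟩
      mkℚᵘ (+ (m ℕ.+ n)) 0                  ≃⟨ *≡* (cong (ℤ._* + 1) (trans (ℤₚ.pos-+ m n) (sym (cong₂ ℤ._+_ (ℤₚ.*-identityʳ (+ m)) (ℤₚ.*-identityʳ (+ n)))))) ⟩
      mkℚᵘ (+ m) 0 ℚᵘ.+ mkℚᵘ (+ n) 0        ≃⟨ ℚᵘₚ.+-cong (toℚᵘ-fromℚᵘ (mkℚᵘ (+ m) 0)) (toℚᵘ-fromℚᵘ (mkℚᵘ (+ n) 0)) ⟨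
      toℚᵘ (ι m) ℚᵘ.+ toℚᵘ (ι n)            ≃⟨ toℚᵘ-homo-+ (ι m) (ι n) ⟨
      toℚᵘ (ι m + ι n)                      ∎)
      where open ℚᵘₚ.≤-Reasoning

    ι-* : ∀ m n → ι (m ℕ.* n) ≡ ι m * ι n
    ι-* m n = toℚᵘ-injective (begin-equality
      toℚᵘ (ι (m ℕ.* n))                    ≃⟨ toℚᵘ-fromℚᵘ (mkℚᵘ (+ (m ℕ.* n)) 0) ⟩
      mkℚᵘ (+ (m ℕ.* n)) 0                  ≃⟨ *≡* (cong (ℤ._* + 1) (ℤₚ.pos-* m n)) ⟩
      mkℚᵘ (+ m) 0 ℚᵘ.* mkℚᵘ (+ n) 0        ≃⟨ ℚᵘₚ.*-cong (toℚᵘ-fromℚᵘ (mkℚᵘ (+ m) 0)) (toℚᵘ-fromℚᵘ (mkℚᵘ (+ n) 0)) ⟨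
      toℚᵘ (ι m) ℚᵘ.* toℚᵘ (ι n)            ≃⟨ toℚᵘ-homo-* (ι m) (ι n) ⟨
      toℚᵘ (ι m * ι n)                      ∎)
      where open ℚᵘₚ.≤-Reasoning

    ι-^ : ∀ m j → ι (m ℕ.^ j) ≡ ι m ^ℚ j
    ι-^ m ℕ.zero  = refl
    ι-^ m (suc j) = trans (ι-* m (m ℕ.^ j)) (cong (ι m *_) (ι-^ m j))

    ι-mono-≤ : ∀ {m n} → m ℕ.≤ n → ι m ≤ ι n
    ι-mono-≤ {m} {n} le = toℚᵘ-cancel-≤ (begin
      toℚᵘ (ι m)     ≃⟨ toℚᵘ-fromℚᵘ (mkℚᵘ (+ m) 0) ⟩
      mkℚᵘ (+ m) 0   ≤⟨ *≤* (ℤₚ.*-monoʳ-≤-nonNeg (+ 1) (ℤ.+≤+ le)) ⟩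
      mkℚᵘ (+ n) 0   ≃⟨ toℚᵘ-fromℚᵘ (mkℚᵘ (+ n) 0) ⟨
      toℚᵘ (ι n)     ∎)
      where open ℚᵘₚ.≤-Reasoning

    ι-cancel-≤ : ∀ {m n} → ι m ≤ ι n → m ℕ.≤ n
    ι-cancel-≤ {m} {n} le = strip (begin
      mkℚᵘ (+ m) 0   ≃⟨ toℚᵘ-fromℚᵘ (mkℚᵘ (+ m) 0) ⟨
      toℚᵘ (ι m)     ≤⟨ toℚᵘ-mono-≤ le ⟩
      toℚᵘ (ι n)     ≃⟨ toℚᵘ-fromℚᵘ (mkℚᵘ (+ n) 0) ⟩
      mkℚᵘ (+ n) 0   ∎)
      where
      open ℚᵘₚ.≤-Reasoning
      strip : mkℚᵘ (+ m) 0 ℚᵘ.≤ mkℚᵘ (+ n) 0 → m ℕ.≤ n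
      strip (*≤* h) = ℤₚ.drop‿+≤+ (subst₂ ℤ._≤_ (ℤₚ.*-identityʳ (+ m)) (ℤₚ.*-identityʳ (+ n)) h)

    1/[1+d]*[1+d]≡1 : ∀ d → 1/[1+ d ] * ι (suc d) ≡ 1ℚ
    1/[1+d]*[1+d]≡1 d = toℚᵘ-injective (begin-equality
      toℚᵘ (1/[1+ d ] * ι (suc d))              ≃⟨ toℚᵘ-homo-* 1/[1+ d ] (ι (suc d)) ⟩
      toℚᵘ 1/[1+ d ] ℚᵘ.* toℚᵘ (ι (suc d))      ≃⟨ ℚᵘₚ.*-cong (toℚᵘ-fromℚᵘ (mkℚᵘ (+ 1) d)) (toℚᵘ-fromℚᵘ (mkℚᵘ (+ suc d) 0)) ⟩
      mkℚᵘ (+ 1) d ℚᵘ.* mkℚᵘ (+ suc d) 0        ≃⟨ *≡* (cong (+_) (trans (ℕₚ.*-identityʳ _) (trans (ℕₚ.*-identityˡ (suc d)) (sym (trans (ℕₚ.*-identityˡ _) (ℕₚ.*-identityʳ (suc d))))))) ⟩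
      ℚᵘ.1ℚᵘ                                    ∎)
      where open ℚᵘₚ.≤-Reasoning

    -- The numerator of a positive rational is at least 1.
    1/[1+d]≤ : ∀ γ → 0ℚ < γ → 1/[1+ ℚ.denominator-1 γ ] ≤ γ
    1/[1+d]≤ γ 0<γ = go γ (positive 0<γ)
      where
      go : ∀ γ → Positive γ → 1/[1+ ℚ.denominator-1 γ ] ≤ γ
      go γ@(mkℚ (+ suc m) d _) _ = toℚᵘ-cancel-≤ (begin
        toℚᵘ 1/[1+ d ]       ≃⟨ toℚᵘ-fromℚᵘ (mkℚᵘ (+ 1) d) ⟩
        mkℚᵘ (+ 1) d         ≤⟨ *≤* (ℤₚ.*-monoʳ-≤-nonNeg (+ suc d) (ℤ.+≤+ (ℕ.s≤s (ℕ.z≤n {m})))) ⟩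
        mkℚᵘ (+ suc m) d     ∎)
        where open ℚᵘₚ.≤-Reasoning

    ^ℚ-distrib-* : ∀ x y j → (x * y) ^ℚ j ≡ (x ^ℚ j) * (y ^ℚ j)
    ^ℚ-distrib-* x y ℕ.zero  = refl
    ^ℚ-distrib-* x y (suc j) = trans (cong (x * y *_) (^ℚ-distrib-* x y j)) (interchange x y (x ^ℚ j) (y ^ℚ j))

    ι-pos : ∀ m .{{_ : ℕ.NonZero m}} → Positive (ι m)
    ι-pos m = normalize-pos m 1

    -- With q the denominator of γ, a ≥ σ′ + 1/q; multiplying by q N clears all fractions.
    dense-ℕ : ∀ σ′ γ a X N → 0ℚ < γ → ι X ≡ a * ι N → ι (suc σ′) - 1ℚ + γ ≤ a →
      let q = suc (ℚ.denominator-1 γ) in suc (q ℕ.* σ′) ℕ.* N ℕ.≤ q ℕ.* X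
    dense-ℕ σ′ γ a X N 0<γ X≡ ≤a = ι-cancel-≤ (begin
      ι (suc (q ℕ.* σ′) ℕ.* N)                    ≡⟨ ι-* (suc (q ℕ.* σ′)) N ⟩
      ι (suc (q ℕ.* σ′)) * ι N                    ≡⟨ cong (_* ι N) expand ⟩
      ι q * (ι σ′ + 1/[1+ d ]) * ι N              ≤⟨ *-monoʳ-≤-nonNeg (ι N) {{normalize-nonNeg N 1}} (*-monoˡ-≤-nonNeg (ι q) {{normalize-nonNeg q 1}} below) ⟩
      ι q * a * ι N                               ≡⟨ *-assoc (ι q) a (ι N) ⟩
      ι q * (a * ι N)                             ≡⟨ cong (ι q *_) X≡ ⟨
      ι q * ι X                                   ≡⟨ ι-* q X ⟨
      ι (q ℕ.* X)                                 ∎)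
      where
      open ≤-Reasoning
      d q : ℕ
      d = ℚ.denominator-1 γ
      q = suc d
      expand : ι (suc (q ℕ.* σ′)) ≡ ι q * (ι σ′ + 1/[1+ d ])
      expand = begin-equality
        ι (suc (q ℕ.* σ′))               ≡⟨ ι-+ 1 (q ℕ.* σ′) ⟩
        1ℚ + ι (q ℕ.* σ′)                ≡⟨ +-comm 1ℚ (ι (q ℕ.* σ′)) ⟩
        ι (q ℕ.* σ′) + 1ℚ                ≡⟨ cong₂ _+_ (ι-* q σ′) (trans (sym (1/[1+d]*[1+d]≡1 d)) (*-comm 1/[1+ d ] (ι q))) ⟩
        ι q * ι σ′ + ι q * 1/[1+ d ]     ≡⟨ *-distribˡ-+ (ι q) (ι σ′) 1/[1+ d ] ⟨
        ι q * (ι σ′ + 1/[1+ d ])         ∎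
      below : ι σ′ + 1/[1+ d ] ≤ a
      below = begin
        ι σ′ + 1/[1+ d ]         ≤⟨ +-monoʳ-≤ (ι σ′) (1/[1+d]≤ γ 0<γ) ⟩
        ι σ′ + γ                 ≡⟨ cong (_+ γ) σ-1 ⟨
        ι (suc σ′) - 1ℚ + γ      ≤⟨ ≤a ⟩
        a                        ∎
        where
        σ-1 : ι (suc σ′) - 1ℚ ≡ ι σ′
        σ-1 = begin-equality
          ι (suc σ′) - 1ℚ        ≡⟨ cong (_- 1ℚ) (trans (ι-+ 1 σ′) (+-comm 1ℚ (ι σ′))) ⟩
          ι σ′ + 1ℚ - 1ℚ         ≡⟨ +-assoc (ι σ′) 1ℚ (- 1ℚ) ⟩
          ι σ′ + (1ℚ - 1ℚ)       ≡⟨ cong (λ x → ι σ′ + x) (+-inverseʳ 1ℚ) ⟩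
          ι σ′ + 0ℚ              ≡⟨ +-identityʳ (ι σ′) ⟩
          ι σ′                   ∎

    -- The bound is divided by N^t and by K + 1, the successor because nothing excludes K = 0.
    copies-ℚ : ∀ K t j n a X N c .{{_ : ℕ.NonZero N}} → ι X ≡ a * ι N → X ℕ.^ t ℕ.* n ℕ.^ j ℕ.≤ K ℕ.* c ℕ.* N ℕ.^ t →
      1/[1+ K ] * (a ^ℚ t) * (ι n ^ℚ j) ≤ ι c
    copies-ℚ K t j n a X N c X≡ le = begin
      1/[1+ K ] * (a ^ℚ t) * (ι n ^ℚ j)        ≡⟨ *-assoc 1/[1+ K ] (a ^ℚ t) (ι n ^ℚ j) ⟩
      1/[1+ K ] * ((a ^ℚ t) * (ι n ^ℚ j))      ≤⟨ *-monoˡ-≤-nonNeg 1/[1+ K ] {{normalize-nonNeg 1 (suc K)}} scaled ⟩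
      1/[1+ K ] * (ι (suc K) * ι c)            ≡⟨ *-assoc 1/[1+ K ] (ι (suc K)) (ι c) ⟨
      1/[1+ K ] * ι (suc K) * ι c              ≡⟨ cong (_* ι c) (1/[1+d]*[1+d]≡1 K) ⟩
      1ℚ * ι c                                 ≡⟨ *-identityˡ (ι c) ⟩
      ι c                                      ∎
      where
      open ≤-Reasoning
      instance
        Nᵗ : ℕ.NonZero (N ℕ.^ t)
        Nᵗ = ℕₚ.m^n≢0 N t
      scaled : (a ^ℚ t) * (ι n ^ℚ j) ≤ ι (suc K) * ι c
      scaled = *-cancelʳ-≤-pos (ι (N ℕ.^ t)) {{ι-pos (N ℕ.^ t)}} (begin
        (a ^ℚ t) * (ι n ^ℚ j) * ι (N ℕ.^ t)        ≡⟨ cong ((a ^ℚ t) * (ι n ^ℚ j) *_) (ι-^ N t) ⟩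
        (a ^ℚ t) * (ι n ^ℚ j) * (ι N ^ℚ t)         ≡⟨ xy∙z≈xz∙y (a ^ℚ t) (ι n ^ℚ j) (ι N ^ℚ t) ⟩
        (a ^ℚ t) * (ι N ^ℚ t) * (ι n ^ℚ j)         ≡⟨ cong (_* (ι n ^ℚ j)) (^ℚ-distrib-* a (ι N) t) ⟨
        ((a * ι N) ^ℚ t) * (ι n ^ℚ j)              ≡⟨ cong (λ x → (x ^ℚ t) * (ι n ^ℚ j)) X≡ ⟨
        (ι X ^ℚ t) * (ι n ^ℚ j)                    ≡⟨ cong₂ _*_ (ι-^ X t) (ι-^ n j) ⟨
        ι (X ℕ.^ t) * ι (n ℕ.^ j)                  ≡⟨ ι-* (X ℕ.^ t) (n ℕ.^ j) ⟨
        ι (X ℕ.^ t ℕ.* n ℕ.^ j)                    ≤⟨ ι-mono-≤ (ℕₚ.≤-trans le (ℕₚ.*-monoˡ-≤ (N ℕ.^ t) (ℕₚ.*-monoˡ-≤ c (ℕₚ.n≤1+n K)))) ⟩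
        ι (suc K ℕ.* c ℕ.* N ℕ.^ t)                ≡⟨ ι-* (suc K ℕ.* c) (N ℕ.^ t) ⟩
        ι (suc K ℕ.* c) * ι (N ℕ.^ t)              ≡⟨ cong (_* ι (N ℕ.^ t)) (ι-* (suc K) c) ⟩
        ι (suc K) * ι c * ι (N ℕ.^ t)              ∎)

open RationalBounds

theorem4p4 : (k : ℕ) → k ≥ 4 →
  (γ : ℚ) → 0ℚ < γ → γ < 1ℚ →
  (s : ℕ) (H : List (Subset s)) → IsKTree k s H → TwoContractible H →
  (σ : ℕ) → IsCrossCutNumber H σ →
  ∃[ β ] (0ℚ < β × ∃[ n₀ ] (∀ (n : ℕ) → n ≥ n₀ →
    (F : List (Subset n)) → IsKGraph k n F →
    (a : ℚ) → (+ length F / 1) ≡ a * (+ (n C (k ∸ 1)) / 1) →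
    (+ σ / 1) - 1ℚ + γ ≤ a →
    ∃[ Cs ] (CopiesList H F Cs ×
      β * (a ^ℚ length H) * ((+ n / 1) ^ℚ (s ∸ length H)) ≤ (+ length Cs / 1))))
-- A hypertree has an edge, and a cross-cut meets it, so σ = 0 is impossible.
theorem4p4 (suc (suc k″)) (s≤s (s≤s _)) γ 0<γ _ s H tree twoContractible zero ((S , crossCut , ∣S∣≡0) , _) =
  ⊥-elim (<⇒≢ (crossCut-nonempty S (IsKTree.hypertree tree) crossCut) (sym ∣S∣≡0))
theorem4p4 (suc (suc k″)) (s≤s (s≤s _)) γ 0<γ _ s H tree twoContractible (suc σ′) ((S , crossCut , ∣S∣≡σ) , _) =
  let K , n₀ , many = supersaturation-binomial tree
        (private-pairs (KGraphOn.distinct (IsKTree.kgraph tree)) twoContractible) S crossCut ∣S∣≡σ (suc (ℚ.denominator-1 γ))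
  in 1/[1+ K ] , positive⁻¹ 1/[1+ K ] {{normalize-pos 1 (suc K)}} , n₀ , λ n n≥ F graph a ∣F∣≡ ≤a →
    let C≢0 , Cs , valid , enough = many n n≥ F graph (dense-ℕ σ′ γ a (length F) (n C suc k″) 0<γ ∣F∣≡ ≤a)
    in Cs , valid , copies-ℚ K (length H) (s ∸ length H) n a (length F) (n C suc k″) (length Cs) {{C≢0}} ∣F∣≡ enough
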